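{- Given $0<\varepsilon<\frac12$ and $k,\sigma>0$, there exists a constant $c>0$ such that the following holds. Let $G$ be a tournament on $N$ vertices which is $(\varepsilon,\sigma\log N)$-pseudorandom, let $S$ be a directed tree on $n$ vertices, and let $T$ be a directed tree on $m$ vertices with at most $k$ leaves, where $n,m\le N/c$ and $nm\le\frac{N^2}{c^2\log N}$. Then $G\to(S,T)$.
   Context: An oriented graph $G$ is $(\varepsilon,k)$-pseudorandom if for all disjoint $A,B\subseteq V(G)$ with $|A|,|B|\ge k$, at least $\varepsilon|A||B|$ edges are directed from $A$ to $B$. A tournament is an orientation of a complete graph. A directed tree is an oriented tree in which there is a vertex (the root) such that all edges are directed away from it or all are directed towards it. Leaves are vertices of degree $1$ in the underlying tree. $G\to(S,T)$ means every red/blue edge-colouring of $G$ contains a blue copy of $S$ or a red copy of $T$ (as oriented subgraphs). Logarithms are base $2$. -}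

module Defs where

open import Data.Nat using (ℕ; zero; suc; _+_; _*_; _^_; _≤_; _<_; _≡ᵇ_)
open import Data.Bool using (Bool; true; false; _∧_; _∨_; not; if_then_else_)
open import Data.Fin using (Fin)
open import Data.Fin.Subset using (Subset; _∈_; _∉_; ∣_∣)
open import Data.Vec using (lookup)
open import Data.List using (allFin; map)
open import Data.Nat.ListAction using (sum)
open import Data.Product using (Σ; _×_; ∃)
open import Data.Sum using (_⊎_)
open import Function.Definitions using (Injective)
open import Relation.Binary.PropositionalEquality using (_≡_; _≢_)

Digraph : ℕ → Set
Digraph n = Fin n → Fin n → Bool

count : {n : ℕ} → (Fin n → Bool) → ℕ
count {n} p = sum (map (λ i → if p i then 1 else 0) (allFin n))

IsTournament : {N : ℕ} → Digraph N → Set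
IsTournament {N} G = (∀ (i : Fin N) → G i i ≡ false)
                   × (∀ (i j : Fin N) → i ≢ j → G i j ≡ not (G j i))

IsOriented : {n : ℕ} → Digraph n → Set
IsOriented {n} D = (∀ (i : Fin n) → D i i ≡ false)
                 × (∀ (i j : Fin n) → D i j ≡ true → D j i ≡ false)

edgesFromTo : {N : ℕ} → Digraph N → Subset N → Subset N → ℕ
edgesFromTo {N} G A B =
  sum (map (λ i → count (λ j → lookup A i ∧ lookup B j ∧ G i j)) (allFin N))

Disjoint : {N : ℕ} → Subset N → Subset N → Set
Disjoint {N} A B = ∀ (i : Fin N) → i ∈ A → i ∉ B

-- (ε, σ log₂ N)-pseudorandom with ε = εn/εd and σ = σn/σd.
-- |A| ≥ σ log₂ N  is rendered exactly as  N ^ σn ≤ 2 ^ (σd * |A|),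
-- and  e(A,B) ≥ ε |A| |B|  as  εn * |A| * |B| ≤ εd * e(A,B).
IsPseudorandomLog : (εn εd σn σd : ℕ) → {N : ℕ} → Digraph N → Set
IsPseudorandomLog εn εd σn σd {N} G =
  ∀ (A B : Subset N) → Disjoint A B →
    N ^ σn ≤ 2 ^ (σd * ∣ A ∣) →
    N ^ σn ≤ 2 ^ (σd * ∣ B ∣) →
    εn * ∣ A ∣ * ∣ B ∣ ≤ εd * edgesFromTo G A B

Und : {n : ℕ} → Digraph n → Digraph n
Und D i j = D i j ∨ D j i

data Walk {n : ℕ} (R : Digraph n) : Fin n → Fin n → Set where
  here : ∀ {u} → Walk R u u
  step : ∀ {u w v} → R u w ≡ true → Walk R w v → Walk R u v

edgeCount : {n : ℕ} → Digraph n → ℕ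
edgeCount {n} D = sum (map (λ i → count (λ j → D i j)) (allFin n))

-- Oriented tree: an oriented graph whose underlying graph is a tree
-- (connected, with exactly n - 1 edges; in particular n ≥ 1).
IsOrientedTree : {n : ℕ} → Digraph n → Set
IsOrientedTree {n} D = IsOriented D
                     × (∀ (u v : Fin n) → Walk (Und D) u v)
                     × (edgeCount D + 1 ≡ n)

-- Directed tree: an oriented tree with a root r such that all edges are directed
-- away from r (every vertex reachable from r by a directed path) or all towards r.
IsDirectedTree : {n : ℕ} → Digraph n → Set
IsDirectedTree {n} D = IsOrientedTree D
  × Σ (Fin n) (λ r → (∀ (v : Fin n) → Walk D r v) ⊎ (∀ (v : Fin n) → Walk D v r))

degree : {n : ℕ} → Digraph n → Fin n → ℕ
degree D i = count (λ j → Und D i j)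

leaves : {n : ℕ} → Digraph n → ℕ
leaves D = count (λ i → degree D i ≡ᵇ 1)

-- a red/blue edge colouring of G (only values on edges matter); true = blue, false = red
Colouring : ℕ → Set
Colouring N = Fin N → Fin N → Bool

MonoCopy : {N n : ℕ} → Digraph N → Colouring N → Bool → Digraph n → Set
MonoCopy {N} {n} G col b S =
  Σ (Fin n → Fin N) (λ f → Injective _≡_ _≡_ f
     × (∀ (u v : Fin n) → S u v ≡ true → (G (f u) (f v) ≡ true) × (col (f u) (f v) ≡ b)))

Arrows : {N n m : ℕ} → Digraph N → Digraph n → Digraph m → Set
Arrows {N} G S T = ∀ (col : Colouring N) → MonoCopy G col true S ⊎ MonoCopy G col false T

{-# OPTIONS --safe #-}
module Submission where

-- Reversing all edges if necessary, S branches away from its root.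
-- Two large sets without red edges in either direction have, by pseudorandomness, many blue edges both ways. S embeds into
-- a long enough sequence of such pairs (P, Q), with no red edge from earlier pairs to later ones: at each pair, vertices
-- with few children go to Q and their children to P, and if only vertices with many children are pending, one of them
-- goes to a set Z reserved in front of the next pair.
-- In a depth-first forest of the red graph no red edge goes from left to right. Joining the red paths of large neighbouring
-- subtrees from right to left yields one long red path, or pairs as above, or many small subtrees. The small ones are grouped
-- into blocks of about equal size. By Gallai-Milgram and Rédei, most of a block is covered by red paths or by blue paths of
-- prescribed lengths. Red blocks are linked from right to left, where a failure to link again produces a pair. A sequence of
-- blue blocks receives S block by block: each takes a path of S, or many vertices, or all roots of the pending subtrees.
-- So every large set contains a long red path, or there is a blue copy of S. Finally T is a union of one path per leaf,
-- glued one at a time: if the available end vertices and start vertices in two halves of a set cannot be joined in red,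
-- exchanging the halves shows that some two large sets have no red edges in either direction.
open import Defs
open import Data.Bool using (Bool; true; false; if_then_else_; _∧_; _∨_; not)
open import Data.Bool.Properties using (T?; T-≡; ∨-zeroʳ)
open import Data.Empty using (⊥; ⊥-elim)
open import Data.Fin using (Fin)
import Data.Fin.Properties as Finₚ
import Data.Fin.Subset as Subset
open import Data.List using (List; []; _∷_; _++_; length; map; concat; filter; filterᵇ; take; drop; reverse; _ʳ++_; [_]; allFin)
import Data.List as List
open import Data.List.Properties using (length-++; ++-assoc; ++-identityʳ; length-map; length-reverse; length-tabulate; unfold-reverse; reverse-++; reverse-involutive; length-take; length-drop; take++drop≡id; drop-drop; filter-++; concat-++; map-++; ʳ++-defn)
import Data.List.Membership.DecPropositional as DecMembership
open import Data.List.Membership.Propositional using (_∈_; _∉_; find; lose)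
open import Data.List.Membership.Propositional.Properties using (∈-++⁺ˡ; ∈-++⁺ʳ; ∈-++⁻; ∈-∃++; ∈-filter⁺; ∈-filter⁻; ∈-map⁺; ∈-map⁻; ∈-concat⁺′; ∈-concat⁻′; ∈-allFin)
open import Data.List.Relation.Binary.Permutation.Propositional using (_↭_; ↭-refl; ↭-sym; ↭-trans; ↭-reflexive; prep; swap) renaming (refl to ↭refl; trans to ↭trans)
open import Data.List.Relation.Binary.Permutation.Propositional.Properties using (∈-resp-↭; ↭-length; shift; shifts; ↭-reverse; ++-commutativeMonoid) renaming (++⁺ˡ to ↭-++⁺ˡ; ++⁺ʳ to ↭-++⁺ʳ; ++⁺ to ↭-++⁺; ++-comm to ↭-++-comm; map⁺ to ↭-map⁺)
open import Data.List.Relation.Binary.Sublist.Propositional using (_⊆_; ⊆-refl; ⊆-trans; ⊆-reflexive; minimum) renaming ([] to ⊆[]; _∷_ to _⊆∷_; _∷ʳ_ to _⊆∷ʳ_)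
import Data.List.Relation.Binary.Sublist.Propositional.Properties as Sublistₚ
open import Data.List.Relation.Unary.All as All using (All; []; _∷_)
import Data.List.Relation.Unary.All.Properties as Allₚ
open import Data.List.Relation.Unary.AllPairs using (AllPairs; []; _∷_)
open import Data.List.Relation.Unary.AllPairs.Properties using () renaming (++⁺ to allPairs-++)
open import Data.List.Relation.Unary.Any using (Any; here; there; any?)
open import Data.List.Relation.Unary.Linked using (Linked; []; [-]; _∷_)
open import Data.List.Relation.Unary.Unique.Propositional using (Unique)
import Data.List.Relation.Unary.Unique.Propositional.Properties as Uniqueₚ
open import Data.Nat hiding (_≟_)
open import Data.Nat.DivMod using (_/_; _%_; m≡m%n+[m/n]*n; m%n<n; m/n*n≤m; m/n≤m)
open import Data.Nat.ListAction using (sum)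
open import Data.Nat.ListAction.Properties using (sum-++; sum-↭)
open import Data.Nat.Properties hiding (_≟_; ≡-irrelevant; ≡-isDecEquivalence; ≡-decSetoid)
open import Data.Nat.Tactic.RingSolver using (solve-∀)
open import Data.Product using (Σ; _×_; _,_; proj₁; proj₂; Σ-syntax)
open import Data.Sum using (_⊎_; inj₁; inj₂; [_,_]′)
open import Data.Unit using (⊤; tt)
open import Data.Vec using (tabulate; lookup)
open import Data.Vec.Properties using (lookup∘tabulate; []=⇒lookup)
open import Function using (_∘_; id; case_of_; Equivalence)
open import Relation.Binary using (DecidableEquality)
open import Relation.Binary.PropositionalEquality hiding ([_])
open import Relation.Nullary using (¬_; Dec; yes; no; contradiction; ¬?; does)
open import Relation.Nullary.Decidable using (_×-dec_)

-- The two scales are `K`, of order log N, and `u`, of order N / log N. `K` is the price of a pair: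
-- pseudorandomness allows about log N exceptional vertices for each set, so a sequence of pairs
-- hosts S only if its total size exceeds `K` times the number of pairs by a constant times n. Every
-- join of two red paths may create a pair, and joins of tiny subtrees would create too many; hence
-- only subtrees with at least `s` = 96 `K` vertices are joined, and the case of many small subtrees
-- needs its own argument. There the blocks have about `s` vertices and a constant times `u` of them
-- are available. If `u` blocks are to supply m red vertices or n vertices of S, then each must
-- contain red paths of about m/u vertices or blue paths of about n/u vertices. Gallai-Milgram
-- yields them when (m/u)(n/u) is at most of order `K`, that is, when mn is at most of order `K` u²,
-- which is N² / log N up to a constant. This is the place where the hypothesis on nm enters.

infix 4 _⊑_

_⊑_ : {A : Set} → List A → List A → Set
xs ⊑ ys = ∀ {x} → x ∈ xs → x ∈ ys

Disj : {A : Set} → List A → List A → Set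
Disj xs ys = ∀ {x} → x ∈ xs → x ∈ ys → ⊥

does-true : ∀ {P : Set} (d : Dec P) → does d ≡ true → P
does-true (yes p) _ = p

does-yes : ∀ {P : Set} (d : Dec P) → P → does d ≡ true
does-yes (yes _) _ = refl
does-yes (no ¬p) p = contradiction p ¬p

does-false : ∀ {P : Set} (d : Dec P) → does d ≡ false → ¬ P
does-false (no ¬p) _ = ¬p

-- Lists without repetition as finite sets

module _ {A : Set} where

  ∉-unique : ∀ {x : A} {xs} → Unique (x ∷ xs) → x ∉ xs
  ∉-unique = Uniqueₚ.Unique[x∷xs]⇒x∉xs

  unique-cons : ∀ {x : A} {xs} → x ∉ xs → Unique xs → Unique (x ∷ xs)
  unique-cons x∉ u = All.tabulate (λ { y∈ refl → x∉ y∈ }) ∷ u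

  unique-++ : ∀ {xs ys : List A} → Unique xs → Unique ys → Disj xs ys → Unique (xs ++ ys)
  unique-++ ux uy d = Uniqueₚ.++⁺ ux uy (λ (p , q) → d p q)

  unique-++ˡ : ∀ (xs : List A) {ys} → Unique (xs ++ ys) → Unique xs
  unique-++ˡ [] u = []
  unique-++ˡ (x ∷ xs) (a ∷ u) = Allₚ.++⁻ˡ xs a ∷ unique-++ˡ xs u

  unique-++ʳ : ∀ (xs : List A) {ys} → Unique (xs ++ ys) → Unique ys
  unique-++ʳ [] u = u
  unique-++ʳ (x ∷ xs) (a ∷ u) = unique-++ʳ xs u

  unique-disj : ∀ (xs : List A) {ys} → Unique (xs ++ ys) → Disj xs ys
  unique-disj (x ∷ xs) u (here refl) q = ∉-unique u (∈-++⁺ʳ xs q)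
  unique-disj (x ∷ xs) (_ ∷ u) (there p) q = unique-disj xs u p q

  unique-↭ : ∀ {xs ys : List A} → xs ↭ ys → Unique xs → Unique ys
  unique-↭ ↭refl u = u
  unique-↭ (prep x p) u@(_ ∷ u′) =
    unique-cons (λ q → ∉-unique u (∈-resp-↭ (↭-sym p) q)) (unique-↭ p u′)
  unique-↭ (swap x y p) u@((x≢y ∷ _) ∷ u″@(_ ∷ u′)) =
    unique-cons (λ { (here refl) → x≢y refl
                   ; (there q) → ∉-unique u″ (∈-resp-↭ (↭-sym p) q) })
      (unique-cons (λ q → ∉-unique u (there (∈-resp-↭ (↭-sym p) q))) (unique-↭ p u′))
  unique-↭ (↭trans p q) u = unique-↭ q (unique-↭ p u)

  ∈-split : ∀ {x : A} {xs} → x ∈ xs → Σ[ ys ∈ List A ] xs ↭ x ∷ ys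
  ∈-split {x} p with ∈-∃++ p
  ... | ys , zs , refl = ys ++ zs , shift x ys zs

  length-⊑ : ∀ {xs ys : List A} → Unique xs → xs ⊑ ys → length xs ≤ length ys
  length-⊑ {[]} _ _ = z≤n
  length-⊑ {x ∷ xs} {ys} u@(_ ∷ u′) s with ∈-split (s (here refl))
  ... | zs , p = subst (suc (length xs) ≤_) (sym (↭-length p)) (s≤s (length-⊑ u′ sub))
    where
    sub : xs ⊑ zs
    sub q with ∈-resp-↭ p (s (there q))
    ... | here refl = contradiction q (∉-unique u)
    ... | there r = r

  ∈-filterᵇ⁺ : ∀ (p : A → Bool) {x xs} → x ∈ xs → p x ≡ true → x ∈ filterᵇ p xs
  ∈-filterᵇ⁺ p x∈ e = ∈-filter⁺ (T? ∘ p) x∈ (Equivalence.from T-≡ e)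

  ∈-filterᵇ⁻ : ∀ (p : A → Bool) {x xs} → x ∈ filterᵇ p xs → x ∈ xs × p x ≡ true
  ∈-filterᵇ⁻ p x∈ with ∈-filter⁻ (T? ∘ p) x∈
  ... | q , t = q , Equivalence.to T-≡ t

  unique-filterᵇ : ∀ (p : A → Bool) {xs} → Unique xs → Unique (filterᵇ p xs)
  unique-filterᵇ p = Uniqueₚ.filter⁺ (T? ∘ p)

  filterᵇ-∷-true : ∀ (p : A → Bool) {x xs} → p x ≡ true → filterᵇ p (x ∷ xs) ≡ x ∷ filterᵇ p xs
  filterᵇ-∷-true p {x} e with p x | e
  ... | true | refl = refl

  length-filterᵇ-not : ∀ (p : A → Bool) xs →
    length (filterᵇ p xs) + length (filterᵇ (not ∘ p) xs) ≡ length xs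
  length-filterᵇ-not p [] = refl
  length-filterᵇ-not p (x ∷ xs) with p x
  ... | true = cong suc (length-filterᵇ-not p xs)
  ... | false = trans (+-suc _ _) (cong suc (length-filterᵇ-not p xs))

  find? : ∀ (p : A → Bool) xs → (Σ[ x ∈ A ] x ∈ xs × p x ≡ true) ⊎ (∀ {x} → x ∈ xs → p x ≡ false)
  find? p [] = inj₂ λ ()
  find? p (x ∷ xs) with p x in e | find? p xs
  ... | true | _ = inj₁ (x , here refl , e)
  ... | false | inj₁ (y , y∈ , q) = inj₁ (y , there y∈ , q)
  ... | false | inj₂ h = inj₂ λ { (here refl) → e ; (there q) → h q }

  find₂? : ∀ (p : A → A → Bool) xs ys →
    (Σ[ x ∈ A ] Σ[ y ∈ A ] x ∈ xs × y ∈ ys × p x y ≡ true) ⊎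
    (∀ {x y} → x ∈ xs → y ∈ ys → p x y ≡ false)
  find₂? p [] ys = inj₂ λ ()
  find₂? p (x ∷ xs) ys with find? (p x) ys | find₂? p xs ys
  ... | inj₁ (y , y∈ , q) | _ = inj₁ (x , y , here refl , y∈ , q)
  ... | inj₂ h | inj₁ (a , b , a∈ , b∈ , q) = inj₁ (a , b , there a∈ , b∈ , q)
  ... | inj₂ h | inj₂ h′ = inj₂ λ { (here refl) b → h b ; (there a) b → h′ a b }

  take-⊑ : ∀ k {xs : List A} → take k xs ⊑ xs
  take-⊑ (suc k) {x ∷ xs} (here e) = here e
  take-⊑ (suc k) {x ∷ xs} (there p) = there (take-⊑ k p)

  length-take-≤ : ∀ k (xs : List A) → k ≤ length xs → length (take k xs) ≡ k
  length-take-≤ k xs h = trans (length-take k xs) (m≤n⇒m⊓n≡m h)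

module _ {A : Set} (_≟_ : DecidableEquality A) where
  open DecMembership _≟_ using (_∈?_)

  _∖_ : List A → List A → List A
  xs ∖ ys = filter (λ x → ¬? (x ∈? ys)) xs

  ∈-∖⁻ : ∀ {x} xs ys → x ∈ xs ∖ ys → x ∈ xs × x ∉ ys
  ∈-∖⁻ xs ys = ∈-filter⁻ (λ x → ¬? (x ∈? ys))

  ∈-∖⁺ : ∀ {x} {xs ys} → x ∈ xs → x ∉ ys → x ∈ xs ∖ ys
  ∈-∖⁺ {ys = ys} = ∈-filter⁺ (λ x → ¬? (x ∈? ys))

  unique-∖ : ∀ {xs} ys → Unique xs → Unique (xs ∖ ys)
  unique-∖ ys = Uniqueₚ.filter⁺ (λ x → ¬? (x ∈? ys))

  length-∩-∖ : ∀ xs ys → length (filter (_∈? ys) xs) + length (xs ∖ ys) ≡ length xs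
  length-∩-∖ [] ys = refl
  length-∩-∖ (x ∷ xs) ys with x ∈? ys
  ... | yes _ = cong suc (length-∩-∖ xs ys)
  ... | no _ = trans (+-suc _ _) (cong suc (length-∩-∖ xs ys))

  length-∖ : ∀ {xs} ys → Unique xs → length xs ≤ length ys + length (xs ∖ ys)
  length-∖ {xs} ys u = begin
    length xs ≡⟨ sym (length-∩-∖ xs ys) ⟩
    length (filter (_∈? ys) xs) + length (xs ∖ ys) ≤⟨ +-monoˡ-≤ _ (length-⊑ (Uniqueₚ.filter⁺ (_∈? ys) u) (λ p → proj₂ (∈-filter⁻ (_∈? ys) {xs = xs} p))) ⟩
    length ys + length (xs ∖ ys) ∎
    where open ≤-Reasoning

  pick : ∀ d {xs} ys → Unique xs → length ys + d ≤ length xs →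
         Σ[ zs ∈ List A ] length zs ≡ d × Unique zs × zs ⊑ xs × Disj zs ys
  pick d {xs} ys u h =
    take d (xs ∖ ys) , length-take-≤ d (xs ∖ ys) bound , Uniqueₚ.take⁺ d (unique-∖ ys u) ,
    (λ p → proj₁ (∈-∖⁻ xs ys (take-⊑ d p))) , (λ p q → proj₂ (∈-∖⁻ xs ys (take-⊑ d p)) q)
    where
    bound : d ≤ length (xs ∖ ys)
    bound = +-cancelˡ-≤ (length ys) _ _ (≤-trans h (length-∖ ys u))

-- Depth-first forests

-- Ordered forests; c ⟨ F ⟩∷ G has first tree c with children F, and further trees G.
data Forest (A : Set) : Set where
  ∅ : Forest A
  _⟨_⟩∷_ : A → Forest A → Forest A → Forest A

module _ {A : Set} where

  verts : Forest A → List A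
  verts ∅ = []
  verts (c ⟨ F ⟩∷ G) = (c ∷ verts F) ++ verts G

  roots : Forest A → List A
  roots ∅ = []
  roots (c ⟨ F ⟩∷ G) = c ∷ roots G

module _ {A : Set} (r : A → A → Bool) where

  None : List A → List A → Set
  None X Y = ∀ {x y} → x ∈ X → y ∈ Y → r x y ≡ false

  IsDFS : Forest A → Set
  IsDFS ∅ = ⊤
  IsDFS (c ⟨ F ⟩∷ G) =
    All (λ d → r c d ≡ true) (roots F) × None (c ∷ verts F) (verts G) × IsDFS F × IsDFS G

  -- The search returns only when no visited vertex has a red edge to a vertex left over. The trees
  -- of `G` are built from what `F` left over, which is why no red edge leads from `c` and `F` into
  -- `G`.
  explore : ∀ fuel v (U : List A) → length U ≤ fuel →
    Σ[ F ∈ Forest A ] Σ[ U′ ∈ List A ] U ↭ verts F ++ U′ ×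
      All (λ d → r v d ≡ true) (roots F) × IsDFS F × None (v ∷ verts F) U′
  explore fuel v U h with find? (r v) U
  ... | inj₂ no-nbr = ∅ , U , ↭-refl , [] , tt , λ { (here refl) → no-nbr }
  explore zero v (_ ∷ _) () | inj₁ _
  explore zero v [] h | inj₁ (_ , () , _)
  explore (suc fuel) v U h | inj₁ (c , c∈ , rc) with ∈-split c∈
  ... | U₁ , p with explore fuel c U₁ (s≤s⁻¹ (subst (_≤ suc fuel) (↭-length p) h))
  ... | F , U₂ , q , rF , dF , nF with explore fuel v U₂ bound
    where
    bound : length U₂ ≤ fuel
    bound = ≤-trans (≤-trans (m≤n+m _ (length (verts F)))
              (≤-reflexive (trans (sym (length-++ (verts F))) (sym (↭-length q)))))
              (s≤s⁻¹ (subst (_≤ suc fuel) (↭-length p) h))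
  ... | G , U₃ , q′ , rG , dG , nG =
    c ⟨ F ⟩∷ G , U₃ , perm , rc ∷ rG , (rF , sep , dF , dG) , none
    where
    perm : U ↭ (c ∷ verts F ++ verts G) ++ U₃
    perm = ↭-trans p (prep c (↭-trans q (↭-trans (↭-++⁺ˡ (verts F) q′)
             (subst (verts F ++ verts G ++ U₃ ↭_) (sym (++-assoc (verts F) _ _)) ↭-refl))))
    sep : None (c ∷ verts F) (verts G)
    sep a b = nF a (∈-resp-↭ (↭-sym q′) (∈-++⁺ˡ b))
    none : None (v ∷ c ∷ verts F ++ verts G) U₃
    none (here refl) b = nG (here refl) b
    none (there a) b with ∈-++⁻ (c ∷ verts F) a
    ... | inj₁ a′ = nF a′ (∈-resp-↭ (↭-sym q′) (∈-++⁺ʳ (verts G) b))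
    ... | inj₂ a′ = nG (there a′) b

  dfs : ∀ fuel (U : List A) → length U ≤ fuel → Σ[ F ∈ Forest A ] U ↭ verts F × IsDFS F
  dfs fuel [] h = ∅ , ↭-refl , tt
  dfs (suc fuel) (c ∷ U) (s≤s h) with explore fuel c U h
  ... | F , U′ , p , rF , dF , nF with dfs fuel U′ (≤-trans (≤-trans (m≤n+m _ (length (verts F)))
              (≤-reflexive (trans (sym (length-++ (verts F))) (sym (↭-length p))))) h)
  ... | G , q , dG = c ⟨ F ⟩∷ G , prep c (↭-trans p (↭-++⁺ˡ (verts F) q)) ,
                     (rF , (λ a b → nF a (∈-resp-↭ (↭-sym q) b)) , dF , dG)

-- Sequences of pairs

module _ {A : Set} where

  sublist-∈ : ∀ {xs ys : List A} → xs ⊆ ys → xs ⊑ ys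
  sublist-∈ (y ⊆∷ʳ s) p = there (sublist-∈ s p)
  sublist-∈ (refl ⊆∷ s) (here e) = here e
  sublist-∈ (refl ⊆∷ s) (there p) = there (sublist-∈ s p)

  sublist-length : ∀ {xs ys : List A} → xs ⊆ ys → length xs ≤ length ys
  sublist-length ⊆[] = z≤n
  sublist-length (y ⊆∷ʳ s) = m≤n⇒m≤1+n (sublist-length s)
  sublist-length (_ ⊆∷ s) = s≤s (sublist-length s)

  sublist-++ˡ : ∀ {xs ys : List A} zs → xs ⊆ ys → xs ⊆ zs ++ ys
  sublist-++ˡ [] s = s
  sublist-++ˡ (z ∷ zs) s = z ⊆∷ʳ sublist-++ˡ zs s

  sublist-dropˡ : ∀ (zs : List A) {xs ys} → zs ++ xs ⊆ ys → xs ⊆ ys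
  sublist-dropˡ zs s = ⊆-trans (sublist-++ˡ zs ⊆-refl) s

  sublist-++ : ∀ {ws xs ys zs : List A} → ws ⊆ xs → ys ⊆ zs → ws ++ ys ⊆ xs ++ zs
  sublist-++ ⊆[] t = t
  sublist-++ (y ⊆∷ʳ s) t = y ⊆∷ʳ sublist-++ s t
  sublist-++ (e ⊆∷ s) t = e ⊆∷ sublist-++ s t

  sublist-split : ∀ K₁ p K₂ {π : List A} → K₁ ++ p ∷ K₂ ⊆ π →
    Σ[ π₁ ∈ List A ] Σ[ π₂ ∈ List A ] π ≡ π₁ ++ p ∷ π₂ × K₁ ⊆ π₁ × K₂ ⊆ π₂
  sublist-split [] p K₂ (y ⊆∷ʳ s) with sublist-split [] p K₂ s
  ... | π₁ , π₂ , refl , s₁ , s₂ = y ∷ π₁ , π₂ , refl , y ⊆∷ʳ s₁ , s₂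
  sublist-split [] p K₂ (refl ⊆∷ s) = [] , _ , refl , ⊆[] , s
  sublist-split (k ∷ K₁) p K₂ (y ⊆∷ʳ s) with sublist-split (k ∷ K₁) p K₂ s
  ... | π₁ , π₂ , refl , s₁ , s₂ = y ∷ π₁ , π₂ , refl , y ⊆∷ʳ s₁ , s₂
  sublist-split (k ∷ K₁) p K₂ (refl ⊆∷ s) with sublist-split K₁ p K₂ s
  ... | π₁ , π₂ , refl , s₁ , s₂ = k ∷ π₁ , π₂ , refl , refl ⊆∷ s₁ , s₂

  -- For linking two paths by an edge from `p`: the first path is cut after `p`. In the application
  -- the vertices of `K₂` have already been moved to a pair, so no vertex that must stay on the path
  -- is lost. `suffix-from` does the same for the second path.
  prefix-through : ∀ K₁ b K₂ {p} {π : List A} → K₁ ++ b ∷ K₂ ⊆ π → p ∈ b ∷ K₂ →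
    Σ[ π₁ ∈ List A ] Σ[ π₂ ∈ List A ] π ≡ π₁ ++ p ∷ π₂ × K₁ ++ [ b ] ⊆ π₁ ++ [ p ]
  prefix-through K₁ b K₂ s (here refl) with sublist-split K₁ b K₂ s
  ... | π₁ , π₂ , e , s₁ , _ = π₁ , π₂ , e , sublist-++ s₁ ⊆-refl
  prefix-through K₁ b K₂ {p} {π} s (there q) with ∈-∃++ q
  ... | M₁ , M₂ , refl with sublist-split (K₁ ++ b ∷ M₁) p M₂ (subst (_⊆ π) (sym (++-assoc K₁ (b ∷ M₁) (p ∷ M₂))) s)
  ... | π₁ , π₂ , e , s₁ , _ = π₁ , π₂ , e ,
    ⊆-trans (sublist-++ (⊆-refl {x = K₁}) (refl ⊆∷ minimum _)) (⊆-trans s₁ (⊆-trans (⊆-reflexive (sym (++-identityʳ π₁))) (sublist-++ (⊆-refl {x = π₁}) (minimum [ p ]))))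

  suffix-from : ∀ A₁ a K {q} {π : List A} → A₁ ++ a ∷ K ⊆ π → q ∈ a ∷ A₁ →
    Σ[ π₃ ∈ List A ] Σ[ π₄ ∈ List A ] π ≡ π₃ ++ q ∷ π₄ × a ∷ K ⊆ q ∷ π₄
  suffix-from A₁ a K s (here refl) with sublist-split A₁ a K s
  ... | π₃ , π₄ , e , _ , s₂ = π₃ , π₄ , e , refl ⊆∷ s₂
  suffix-from A₁ a K {q} {π} s (there m) with ∈-∃++ m
  ... | N₁ , N₂ , refl with sublist-split N₁ q (N₂ ++ a ∷ K) (subst (_⊆ π) (++-assoc N₁ (q ∷ N₂) (a ∷ K)) s)
  ... | π₃ , π₄ , e , _ , s₂ = π₃ , π₄ , e , q ⊆∷ʳ sublist-dropˡ N₂ s₂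

  module _ {R : A → A → Set} where

    linked-tail : ∀ {x xs} → Linked R (x ∷ xs) → Linked R xs
    linked-tail [-] = []
    linked-tail (_ ∷ l) = l

    linked-cons : ∀ {c π} → (∀ {x xs} → π ≡ x ∷ xs → R c x) → Linked R π → Linked R (c ∷ π)
    linked-cons h [] = [-]
    linked-cons h [-] = h refl ∷ [-]
    linked-cons h (x ∷ l) = h refl ∷ x ∷ l

    linked-prefix : ∀ xs {p ys} → Linked R (xs ++ p ∷ ys) → Linked R (xs ++ [ p ])
    linked-prefix [] l = [-]
    linked-prefix (x ∷ []) (e ∷ l) = e ∷ [-]
    linked-prefix (x ∷ y ∷ xs) (e ∷ l) = e ∷ linked-prefix (y ∷ xs) l

    linked-suffix : ∀ xs {ys} → Linked R (xs ++ ys) → Linked R ys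
    linked-suffix [] l = l
    linked-suffix (x ∷ xs) l = linked-suffix xs (linked-tail l)

    linked-join : ∀ xs {p q ys} → Linked R (xs ++ [ p ]) → R p q → Linked R (q ∷ ys) →
                  Linked R ((xs ++ [ p ]) ++ q ∷ ys)
    linked-join [] l e l′ = e ∷ l′
    linked-join (x ∷ []) (e′ ∷ l) e l′ = e′ ∷ e ∷ l′
    linked-join (x ∷ y ∷ xs) (e′ ∷ l) e l′ = e′ ∷ linked-join (y ∷ xs) l e l′

-- The two sides of a node are the event's bidirectionally non-red pair P, Q.
data Str (A : Set) : Set where
  leaf : Str A
  node : Str A → (P Q : List A) → Str A → Str A

module _ {A : Set} where

  events : Str A → ℕ
  events leaf = 0
  events (node l P Q m) = suc (events l + events m)

  core : Str A → List A
  core leaf = []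
  core (node l P Q m) = (P ++ Q) ++ core l ++ core m

  weight : Str A → ℕ
  weight leaf = 0
  weight (node l P Q m) = length P + (weight l + weight m)

module _ {A : Set} (r : A → A → Bool) where

  -- The pairs are ordered as `l`, then `P`, `Q`, then `m`. Since `X` contains `P` and everything in
  -- `l`, and `Y` contains `Q` and everything in `m`, the single condition `None r X Y` excludes all
  -- red edges from earlier to later sets at this node. Only the direction from `Q` to `P` has to be
  -- added.
  data OK : Str A → List A → Set where
    leaf : ∀ {W} → OK leaf W
    node : ∀ {l P Q m W} (X Y : List A) → None r X Y → None r Q P → P ⊑ X → Q ⊑ Y →
           length P ≡ length Q → OK l X → OK m Y → X ⊑ W → Y ⊑ W → OK (node l P Q m) W

  OK-mono : ∀ {σ W W′} → W ⊑ W′ → OK σ W → OK σ W′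
  OK-mono s leaf = leaf
  OK-mono s (node X Y n n′ p q e o o′ x y) = node X Y n n′ p q e o o′ (s ∘ x) (s ∘ y)

  length-core : ∀ {σ W} → OK σ W → length (core σ) ≡ weight σ + weight σ
  length-core leaf = refl
  length-core (node {l} {P} {Q} {m} X Y _ _ _ _ e o o′ _ _) = begin
    length ((P ++ Q) ++ core l ++ core m)
      ≡⟨ trans (length-++ (P ++ Q)) (cong₂ _+_ (length-++ P) (length-++ (core l))) ⟩
    (length P + length Q) + (length (core l) + length (core m))
      ≡⟨ cong₂ _+_ (cong (length P +_) (sym e)) (cong₂ _+_ (length-core o) (length-core o′)) ⟩
    (length P + length P) + ((weight l + weight l) + (weight m + weight m))
      ≡⟨ arith (length P) (weight l) (weight m) ⟩
    (length P + (weight l + weight m)) + (length P + (weight l + weight m)) ∎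
    where
    open ≡-Reasoning
    arith : ∀ p l m → (p + p) + ((l + l) + (m + m)) ≡ (p + (l + m)) + (p + (l + m))
    arith = solve-∀

  -- `rp` is the right-hand path read from its end, `kq` the left-hand path read from its start. One
  -- vertex is taken from each at a time, and the taken vertices `B₁`, `A₁` never have a red edge
  -- from right to left. A red edge from `p` to `q` that appears when `b` and `a` are tried stops
  -- the process before `b` and `a` are taken.
  record Meet (X Y rp kq : List A) : Set where
    field
      A₁ B₁ rp′ kq′ : List A
      rp≡ : rp ≡ B₁ ++ rp′
      kq≡ : kq ≡ A₁ ++ kq′
      len : length A₁ ≡ length B₁
      none : None r (B₁ ++ Y) (A₁ ++ X)
      end : rp′ ≡ [] ⊎ kq′ ≡ [] ⊎
        (Σ[ b ∈ A ] Σ[ rp″ ∈ List A ] Σ[ a ∈ A ] Σ[ kq″ ∈ List A ] Σ[ p ∈ A ] Σ[ q ∈ A ]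
          rp′ ≡ b ∷ rp″ × kq′ ≡ a ∷ kq″ × p ∈ b ∷ B₁ ++ Y × q ∈ a ∷ A₁ ++ X × r p q ≡ true)

  meet : ∀ X Y rp kq → None r Y X → Meet X Y rp kq
  meet X Y [] kq n = record { A₁ = [] ; B₁ = [] ; rp≡ = refl ; kq≡ = refl ; len = refl ; none = n ; end = inj₁ refl }
  meet X Y (b ∷ rp) [] n = record { A₁ = [] ; B₁ = [] ; rp≡ = refl ; kq≡ = refl ; len = refl ; none = n ; end = inj₂ (inj₁ refl) }
  meet X Y (b ∷ rp) (a ∷ kq) n with find₂? r (b ∷ Y) (a ∷ X)
  ... | inj₁ (p , q , p∈ , q∈ , e) = record
    { A₁ = [] ; B₁ = [] ; rp≡ = refl ; kq≡ = refl ; len = refl ; none = n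
    ; end = inj₂ (inj₂ (b , rp , a , kq , p , q , refl , refl , p∈ , q∈ , e)) }
  ... | inj₂ n′ = record
    { A₁ = a ∷ M.A₁ ; B₁ = b ∷ M.B₁ ; rp≡ = cong (b ∷_) M.rp≡ ; kq≡ = cong (a ∷_) M.kq≡
    ; len = cong suc M.len
    ; none = λ p q → M.none (∈-resp-↭ (↭-sym (shift b M.B₁ Y)) p) (∈-resp-↭ (↭-sym (shift a M.A₁ X)) q)
    ; end = fix M.end }
    where
    module M = Meet (meet (a ∷ X) (b ∷ Y) rp kq n′)
    fix : _ → _
    fix (inj₁ e) = inj₁ e
    fix (inj₂ (inj₁ e)) = inj₂ (inj₁ e)
    fix (inj₂ (inj₂ (b′ , rp″ , a′ , kq″ , p , q , e₁ , e₂ , p∈ , q∈ , e))) =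
      inj₂ (inj₂ (b′ , rp″ , a′ , kq″ , p , q , e₁ , e₂ ,
        ∈-resp-↭ (prep b′ (shift b M.B₁ Y)) p∈ , ∈-resp-↭ (prep a′ (shift a M.A₁ X)) q∈ , e))

core-⊑ : {A : Set} {r : A → A → Bool} → ∀ {σ W} → OK r σ W → core σ ⊑ W
core-⊑ {σ = node l P Q m} (node X Y _ _ p q _ o o′ x y) z with ∈-++⁻ (P ++ Q) z
... | inj₁ a = [ x ∘ p , y ∘ q ]′ (∈-++⁻ P a)
... | inj₂ a = [ x ∘ core-⊑ o , y ∘ core-⊑ o′ ]′ (∈-++⁻ (core l) a)

module _ {A : Set} where
  open import Algebra.Solver.CommutativeMonoid (++-commutativeMonoid {A = A}) using (solve; _⊜_; _⊕_)

  concat-⊑ : ∀ {h : List A} {hs} → h ∈ hs → h ⊑ concat hs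
  concat-⊑ h∈ x∈ = ∈-concat⁺′ x∈ h∈

  module _ (r : A → A → Bool) (s : ℕ) where

    Red : A → A → Set
    Red x y = r x y ≡ true

    -- `κ` consists of the vertices of `π` that belong to no pair. The path may also run through
    -- vertices of `core σ`, because a linking edge can start or end at a vertex just moved to a
    -- pair. `start` lets the parent of the roots be put in front of the path. In `few` every pair
    -- is charged `s` vertices and one more share is held in reserve: when two layouts are joined,
    -- their two reserves become the charge of the new pair and the new reserve.
    record Layout (X R : List A) : Set where
      field
        π κ : List A
        σ : Str A
        hs : List (List A)
        perm : X ↭ κ ++ core σ ++ concat hs
        κ⊆π : κ ⊆ π
        chain : Linked Red π
        π⊑X : π ⊑ X
        uniq : Unique π
        start : ∀ {x xs} → π ≡ x ∷ xs → x ∈ R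
        ok : OK r σ X
        small : All (λ h → length h < s) hs
        sep : AllPairs (None r) hs
        few : (π ≡ [] × σ ≡ leaf) ⊎ s * suc (events σ) ≤ length X

      hs⊑X : concat hs ⊑ X
      hs⊑X p = ∈-resp-↭ (↭-sym perm) (∈-++⁺ʳ κ (∈-++⁺ʳ (core σ) p))

      κ⊑X : κ ⊑ X
      κ⊑X p = ∈-resp-↭ (↭-sym perm) (∈-++⁺ˡ p)

    ∅-layout : Layout [] []
    ∅-layout = record
      { π = [] ; κ = [] ; σ = leaf ; hs = [] ; perm = ↭-refl ; κ⊆π = ⊆[] ; chain = [] ; π⊑X = id
      ; uniq = [] ; start = λ () ; ok = leaf ; small = [] ; sep = [] ; few = inj₁ (refl , refl) }

    -- A tree with `s` vertices pays the reserve share itself, even if the forest below its root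
    -- consists of small trees only.
    tree-layout : ∀ {c X R} → Unique (c ∷ X) → All (Red c) R → s ≤ length (c ∷ X) →
                  Layout X R → Σ[ L ∈ Layout (c ∷ X) [ c ] ] s * suc (events (Layout.σ L)) ≤ length (c ∷ X)
    tree-layout {c} {X} {R} u red-roots big L = (record
      { π = c ∷ L.π ; κ = c ∷ L.κ ; σ = L.σ ; hs = L.hs
      ; perm = prep c L.perm
      ; κ⊆π = refl ⊆∷ L.κ⊆π
      ; chain = linked-cons (λ e → All.lookup red-roots (L.start e)) L.chain
      ; π⊑X = λ { (here e) → here e ; (there p) → there (L.π⊑X p) }
      ; uniq = unique-cons (λ p → ∉-unique u (L.π⊑X p)) L.uniq
      ; start = λ { refl → here refl }
      ; ok = OK-mono r there L.ok
      ; small = L.small ; sep = L.sep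
      ; few = inj₂ (fewer L.few) }) , fewer L.few
      where
      module L = Layout L
      fewer : _ → s * suc (events L.σ) ≤ suc (length X)
      fewer (inj₁ (_ , refl)) = subst (_≤ _) (sym (*-identityʳ s)) big
      fewer (inj₂ h) = m≤n⇒m≤1+n h

    hang-layout : ∀ {T X R c} → None r T X → length T < s → Layout X R → Layout (T ++ X) (c ∷ R)
    hang-layout {T} {X} none h L = record
      { π = L.π ; κ = L.κ ; σ = L.σ ; hs = T ∷ L.hs
      ; perm = ↭-trans (↭-++⁺ˡ T L.perm)
                 (solve 4 (λ t k c h → t ⊕ (k ⊕ (c ⊕ h)) ⊜ k ⊕ (c ⊕ (t ⊕ h))) ↭-refl T L.κ (core L.σ) (concat L.hs))
      ; κ⊆π = L.κ⊆π ; chain = L.chain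
      ; π⊑X = λ p → ∈-++⁺ʳ T (L.π⊑X p)
      ; uniq = L.uniq
      ; start = λ e → there (L.start e)
      ; ok = OK-mono r (∈-++⁺ʳ T) L.ok
      ; small = h ∷ L.small
      ; sep = All.tabulate (λ h∈ a b → none a (L.hs⊑X (concat-⊑ h∈ b))) ∷ L.sep
      ; few = [ inj₁ , (λ q → inj₂ (≤-trans q (≤-trans (m≤n+m _ (length T)) (≤-reflexive (sym (length-++ T)))))) ]′ L.few }
      where module L = Layout L

    module _ {T X R : List A} {c : A} (u : Unique (T ++ X)) (none : None r T X)
             (LT : Layout T [ c ]) (LX : Layout X R) where
      private
        module P = Layout LT
        module Q = Layout LX

      sep-both : AllPairs (None r) (P.hs ++ Q.hs)
      sep-both = allPairs-++ P.sep Q.sep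
        (All.tabulate λ h∈ → All.tabulate λ h′∈ a b → none (P.hs⊑X (concat-⊑ h∈ a)) (Q.hs⊑X (concat-⊑ h′∈ b)))

      -- With an empty path and no pairs to the right, all of `X` lies in small trees, and there is
      -- nothing to join.
      join-first : s ≤ length T → s * suc (events P.σ) ≤ length T →
                   Q.π ≡ [] → Q.σ ≡ leaf → Layout (T ++ X) (c ∷ R)
      join-first big few eπ eσ = record
        { π = P.π ; κ = P.κ ; σ = P.σ ; hs = P.hs ++ Q.hs
        ; perm = ↭-trans (↭-++⁺ P.perm permX)
            (subst (λ z → (P.κ ++ core P.σ ++ concat P.hs) ++ concat Q.hs ↭ P.κ ++ core P.σ ++ z)
              (concat-++ P.hs Q.hs)
              (solve 4 (λ k c h g → (k ⊕ (c ⊕ h)) ⊕ g ⊜ k ⊕ (c ⊕ (h ⊕ g))) ↭-refl P.κ (core P.σ) (concat P.hs) (concat Q.hs)))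
        ; κ⊆π = P.κ⊆π ; chain = P.chain
        ; π⊑X = λ p → ∈-++⁺ˡ (P.π⊑X p)
        ; uniq = P.uniq
        ; start = λ e → first (P.start e)
        ; ok = OK-mono r ∈-++⁺ˡ P.ok
        ; small = Allₚ.++⁺ P.small Q.small
        ; sep = sep-both
        ; few = inj₂ (≤-trans few (≤-trans (m≤m+n _ _) (≤-reflexive (sym (length-++ T))))) }
        where
        first : ∀ {x} → x ∈ [ c ] → x ∈ c ∷ R
        first (here e) = here e
        no-κ : Q.κ ≡ []
        no-κ with Q.κ | sublist-length (subst (Q.κ ⊆_) eπ Q.κ⊆π)
        ... | [] | _ = refl
        permX : X ↭ concat Q.hs
        permX = subst₂ (λ k σ → X ↭ k ++ core σ ++ concat Q.hs) no-κ eσ Q.perm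

      -- No red edge leads from `T` to `X`, so the joined path must run through `X` before `T`. For
      -- the vertices taken by `meet`, `None r T X` excludes one direction and `Meet.none` the
      -- other, so they form a pair. All other kept vertices stay on the path: the part of the right
      -- path up to `p` and the part of the left path from `q` contain them.
      join : s * suc (events P.σ) ≤ length T → s * suc (events Q.σ) ≤ length X → Layout (T ++ X) (c ∷ R)
      join fewT fewX with meet r [] [] (reverse Q.κ) P.κ (λ ())
      ... | record { A₁ = A₁ ; B₁ = B₁ ; rp′ = rp′ ; kq′ = kq′ ; rp≡ = rp≡ ; kq≡ = kq≡ ; len = len ; none = noneBA ; end = end } =
        record
        { π = proj₁ path ; κ = reverse rp′ ++ kq′ ; σ = node P.σ A₁ B₁ Q.σ ; hs = P.hs ++ Q.hs
        ; perm = perm′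
        ; κ⊆π = proj₁ (proj₂ path)
        ; chain = proj₁ (proj₂ (proj₂ path))
        ; π⊑X = proj₁ (proj₂ (proj₂ (proj₂ path)))
        ; uniq = proj₁ (proj₂ (proj₂ (proj₂ (proj₂ path))))
        ; start = proj₂ (proj₂ (proj₂ (proj₂ (proj₂ path))))
        ; ok = node T X none (λ a b → noneBA (∈-++⁺ˡ a) (∈-++⁺ˡ b)) A₁⊑ B₁⊑ len P.ok Q.ok ∈-++⁺ˡ (∈-++⁺ʳ T)
        ; small = Allₚ.++⁺ P.small Q.small
        ; sep = sep-both
        ; few = inj₂ few′ }
        where
        κQ≡ : Q.κ ≡ reverse rp′ ++ reverse B₁
        κQ≡ = trans (sym (reverse-involutive Q.κ)) (trans (cong reverse rp≡) (reverse-++ B₁ rp′))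
        A₁⊑ : A₁ ⊑ T
        A₁⊑ p = P.κ⊑X (subst (_ ∈_) (sym kq≡) (∈-++⁺ˡ p))
        B₁⊑ : B₁ ⊑ X
        B₁⊑ p = Q.κ⊑X (subst (_ ∈_) (sym κQ≡) (∈-++⁺ʳ (reverse rp′) (∈-resp-↭ (↭-sym (↭-reverse B₁)) p)))
        few′ : s * suc (suc (events P.σ + events Q.σ)) ≤ length (T ++ X)
        few′ = begin
          s * suc (suc (events P.σ + events Q.σ)) ≡⟨ cong (s *_) (sym (cong suc (+-suc (events P.σ) _))) ⟩
          s * (suc (events P.σ) + suc (events Q.σ)) ≡⟨ *-distribˡ-+ s _ _ ⟩
          s * suc (events P.σ) + s * suc (events Q.σ) ≤⟨ +-mono-≤ fewT fewX ⟩
          length T + length X ≡⟨ sym (length-++ T) ⟩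
          length (T ++ X) ∎
          where open ≤-Reasoning
        perm′ : T ++ X ↭ (reverse rp′ ++ kq′) ++ core (node P.σ A₁ B₁ Q.σ) ++ concat (P.hs ++ Q.hs)
        perm′ = ↭-trans (↭-++⁺ P.perm Q.perm)
          (subst₂ (λ k l → (k ++ core P.σ ++ concat P.hs) ++ (l ++ core Q.σ ++ concat Q.hs) ↭ _) (sym kq≡) (sym κQ≡)
          (↭-trans (↭-++⁺ˡ ((A₁ ++ kq′) ++ core P.σ ++ concat P.hs) (↭-++⁺ʳ (core Q.σ ++ concat Q.hs) (↭-++⁺ˡ (reverse rp′) (↭-reverse B₁))))
          (subst (λ z → ((A₁ ++ kq′) ++ core P.σ ++ concat P.hs) ++ ((reverse rp′ ++ B₁) ++ core Q.σ ++ concat Q.hs) ↭ (reverse rp′ ++ kq′) ++ ((A₁ ++ B₁) ++ core P.σ ++ core Q.σ) ++ z)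
            (concat-++ P.hs Q.hs)
            (solve 8 (λ a k c h q b d g → ((a ⊕ k) ⊕ (c ⊕ h)) ⊕ ((q ⊕ b) ⊕ (d ⊕ g)) ⊜ (q ⊕ k) ⊕ (((a ⊕ b) ⊕ (c ⊕ d)) ⊕ (h ⊕ g)))
              ↭-refl A₁ kq′ (core P.σ) (concat P.hs) (reverse rp′) B₁ (core Q.σ) (concat Q.hs)))))
        Path = Σ[ π ∈ List A ] reverse rp′ ++ kq′ ⊆ π × Linked Red π × π ⊑ (T ++ X) × Unique π ×
                 (∀ {x xs} → π ≡ x ∷ xs → x ∈ c ∷ R)
        path : Path
        go : (rp′ ≡ [] ⊎ kq′ ≡ [] ⊎
          (Σ[ b ∈ A ] Σ[ rp″ ∈ List A ] Σ[ a ∈ A ] Σ[ kq″ ∈ List A ] Σ[ p ∈ A ] Σ[ q ∈ A ]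
            rp′ ≡ b ∷ rp″ × kq′ ≡ a ∷ kq″ × p ∈ b ∷ B₁ ++ [] × q ∈ a ∷ A₁ ++ [] × r p q ≡ true)) → Path
        path = go end
        -- If one side has no kept vertices left, the path of the other side alone contains all that
        -- remain.
        go (inj₁ e₀) = P.π , subst (λ z → reverse z ++ kq′ ⊆ P.π) (sym e₀) (sublist-dropˡ A₁ (subst (_⊆ P.π) kq≡ P.κ⊆π)) , P.chain , (λ p → ∈-++⁺ˡ (P.π⊑X p)) , P.uniq ,
                          (λ e → case P.start e of λ { (here q) → here q })
        go (inj₂ (inj₁ e₀)) = Q.π , subst (λ z → reverse rp′ ++ z ⊆ Q.π) (sym e₀) (⊆-trans (⊆-trans (sublist-++ ⊆-refl (minimum (reverse B₁))) (⊆-reflexive (sym κQ≡))) Q.κ⊆π) ,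
                          Q.chain , (λ p → ∈-++⁺ʳ T (Q.π⊑X p)) , Q.uniq , (λ e → there (Q.start e))
        go (inj₂ (inj₂ (b , rp″ , a , kq″ , p , q , refl , refl , p∈ , q∈ , e)))
          with prefix-through (reverse rp″) b (reverse B₁) {p}
                 (subst (_⊆ Q.π) (trans κQ≡ (trans (cong (_++ reverse B₁) (unfold-reverse b rp″)) (++-assoc (reverse rp″) [ b ] (reverse B₁)))) Q.κ⊆π)
                 (∈-resp-↭ (prep b (↭-trans (↭-reflexive (++-identityʳ B₁)) (↭-sym (↭-reverse B₁)))) p∈)
             | suffix-from A₁ a kq″ (subst (_⊆ P.π) kq≡ P.κ⊆π) (subst (λ z → q ∈ a ∷ z) (++-identityʳ A₁) q∈)
        ... | π₁ , π₂ , eQ , s₁ | π₃ , π₄ , eP , s₂ =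
          (π₁ ++ [ p ]) ++ q ∷ π₄ ,
          sublist-++ (subst (_⊆ π₁ ++ [ p ]) (sym (unfold-reverse b rp″)) s₁) s₂ ,
          linked-join π₁ (linked-prefix π₁ (subst (Linked Red) eQ Q.chain)) e (linked-suffix π₃ (subst (Linked Red) eP P.chain)) ,
          (λ x∈ → [ (λ y → ∈-++⁺ʳ T (Q.π⊑X (inQ y))) , (λ y → ∈-++⁺ˡ (P.π⊑X (inP y))) ]′ (∈-++⁻ (π₁ ++ [ p ]) x∈)) ,
          unique-++ (unique-++ˡ (π₁ ++ [ p ]) (subst Unique (trans eQ (sym (++-assoc π₁ [ p ] π₂))) Q.uniq))
                    (unique-++ʳ π₃ (subst Unique eP P.uniq))
                    (λ y y′ → unique-disj T u (P.π⊑X (inP y′)) (Q.π⊑X (inQ y))) ,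
          (λ e′ → there (head π₁ eQ e′))
          where
          inQ : π₁ ++ [ p ] ⊑ Q.π
          inQ {x} y = subst (x ∈_) (sym (trans eQ (sym (++-assoc π₁ [ p ] π₂)))) (∈-++⁺ˡ y)
          inP : q ∷ π₄ ⊑ P.π
          inP {x} y = subst (x ∈_) (sym eP) (∈-++⁺ʳ π₃ y)
          head : ∀ π₁ {x xs} → Q.π ≡ π₁ ++ p ∷ π₂ → (π₁ ++ [ p ]) ++ q ∷ π₄ ≡ x ∷ xs → x ∈ R
          head [] h refl = Q.start h
          head (y ∷ π₁) h refl = Q.start h

    forest-layout : 0 < s → ∀ F → IsDFS r F → Unique (verts F) → Layout (verts F) (roots F)
    forest-layout s>0 ∅ _ _ = ∅-layout
    forest-layout s>0 (c ⟨ F ⟩∷ G) (red , none , dF , dG) u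
      with forest-layout s>0 G dG (unique-++ʳ (c ∷ verts F) u) | length (c ∷ verts F) <? s
    ... | LG | yes h = hang-layout none h LG
    ... | LG | no h
      with tree-layout (unique-++ˡ (c ∷ verts F) u) red (≮⇒≥ h) (forest-layout s>0 F dF (unique-++ˡ (verts F) (tail (unique-++ˡ (c ∷ verts F) u))))
      where
      tail : ∀ {x : A} {xs} → Unique (x ∷ xs) → Unique (xs ++ [])
      tail (_ ∷ u) = subst Unique (sym (++-identityʳ _)) u
    ... | LF , fewF with Layout.few LG
    ... | inj₁ (eπ , eσ) = join-first u none LF LG (≮⇒≥ h) fewF eπ eσ
    ... | inj₂ fewG = join u none LF LG fewF fewG

-- Gallai-Milgram and Rédei

module _ {A : Set} where

  unique-split : ∀ {p X : List A} → Unique p → p ⊑ X → Σ[ X′ ∈ List A ] X ↭ p ++ X′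
  unique-split {[]} {X} _ _ = X , ↭-refl
  unique-split {x ∷ p} {X} u@(_ ∷ u′) s with ∈-split (s (here refl))
  ... | Y , q with unique-split {p} {Y} u′ sub
    where
    sub : p ⊑ Y
    sub y∈ with ∈-resp-↭ q (s (there y∈))
    ... | here refl = contradiction y∈ (∉-unique u)
    ... | there z = z
  ... | X′ , q′ = X′ , ↭-trans q (prep x q′)

  linked-reverse : ∀ {R : A → A → Set} {p} → Linked (λ x y → R y x) p → Linked R (reverse p)
  linked-reverse [] = []
  linked-reverse [-] = [-]
  linked-reverse {R} {x ∷ y ∷ p} (e ∷ l) =
    subst (Linked R) (sym (trans (unfold-reverse x (y ∷ p)) (cong (_++ [ x ]) (unfold-reverse y p))))
      (linked-join (reverse p) (subst (Linked R) (unfold-reverse y p) (linked-reverse l)) e [-])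

  linked-take : ∀ {R : A → A → Set} k {p} → Linked R p → Linked R (take k p)
  linked-take zero l = []
  linked-take (suc k) [] = []
  linked-take (suc k) [-] = subst (Linked _) (lemma k) [-]
    where
    lemma : ∀ k {x : A} → [ x ] ≡ take (suc k) [ x ]
    lemma zero = refl
    lemma (suc k) = refl
  linked-take (suc zero) (e ∷ l) = [-]
  linked-take (suc (suc k)) (e ∷ l) = e ∷ linked-take (suc k) l

  linked-head : ∀ {R : A → A → Set} {x y p} → Linked R (x ∷ y ∷ p) → R x y
  linked-head (e ∷ _) = e

  insert-path : ∀ (b : A → A → Bool) v p → (∀ {x} → x ∈ p → b v x ≡ true ⊎ b x v ≡ true) →
    Linked (λ x y → b x y ≡ true) p →
    Σ[ q ∈ List A ] q ↭ v ∷ p × Linked (λ x y → b x y ≡ true) q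
  insert-path b v p h l with go p h l
    where
    Edge : A → A → Set
    Edge x y = b x y ≡ true
    -- The new path begins with `v` or with the old first vertex; this is what is needed to put the
    -- preceding vertex back in front.
    go : ∀ p → (∀ {x} → x ∈ p → Edge v x ⊎ Edge x v) → Linked Edge p →
      Σ[ q ∈ List A ] q ↭ v ∷ p × Linked Edge q × (∀ {x xs} → q ≡ x ∷ xs → x ≡ v ⊎ (Σ[ ys ∈ List A ] p ≡ x ∷ ys))
    go [] h l = [ v ] , ↭-refl , [-] , λ { refl → inj₁ refl }
    go (x ∷ p) h l with h (here refl)
    ... | inj₁ vx = v ∷ x ∷ p , ↭-refl , vx ∷ l , λ { refl → inj₁ refl }
    ... | inj₂ xv with go p (h ∘ there) (linked-tail l)
    ... | q , perm , lq , st = x ∷ q , ↭-trans (prep x perm) (swap x v ↭-refl) , linked-cons (λ {y} e → first (st e)) lq ,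
                               λ { refl → inj₂ (p , refl) }
      where
      first : ∀ {y} → y ≡ v ⊎ (Σ[ ys ∈ List A ] p ≡ y ∷ ys) → Edge x y
      first (inj₁ refl) = xv
      first (inj₂ (ys , refl)) = linked-head l
  ... | q , perm , lq , _ = q , perm , lq

  redei : ∀ (b : A → A → Bool) I → Unique I → (∀ {x y} → x ∈ I → y ∈ I → x ≢ y → b x y ≡ true ⊎ b y x ≡ true) →
    Σ[ q ∈ List A ] q ↭ I × Linked (λ x y → b x y ≡ true) q
  redei b [] u h = [] , ↭-refl , []
  redei b (v ∷ I) u@(_ ∷ u′) h with redei b I u′ (λ x y → h (there x) (there y))
  ... | p , perm , l with insert-path b v p (λ x∈ → h (here refl) (there (∈-resp-↭ perm x∈)) (λ { refl → ∉-unique u (∈-resp-↭ perm x∈) })) l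
  ... | q , perm′ , l′ = q , ↭-trans perm′ (prep v perm) , l′

IsPath : {A : Set} → (A → A → Bool) → ℕ → List A → Set
IsPath c k p = length p ≡ k × Unique p × Linked (λ x y → c x y ≡ true) p

module GallaiMilgram {A : Set} (_≟_ : DecidableEquality A) (r : A → A → Bool) (irr : ∀ x → r x x ≡ false) where
  open DecMembership _≟_ using (_∈?_)

  -- A nonempty path is stored with its last vertex in front.
  Path : Set
  Path = A × List A

  flat : Path → List A
  flat (u , p) = u ∷ p

  Valid : Path → Set
  Valid (u , p) = Linked (λ x y → r y x ≡ true) (u ∷ p)

  flatten : List Path → List A
  flatten [] = []
  flatten (P ∷ 𝒫) = flat P ++ flatten 𝒫

  ends : List Path → List A
  ends = map proj₁

  flatten-↭ : ∀ {𝒫 𝒬} → 𝒫 ↭ 𝒬 → flatten 𝒫 ↭ flatten 𝒬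
  flatten-↭ ↭refl = ↭-refl
  flatten-↭ (prep P p) = ↭-++⁺ˡ (flat P) (flatten-↭ p)
  flatten-↭ {_ ∷ _ ∷ 𝒫} (swap P Q p) =
    ↭-trans (↭-++⁺ˡ (flat P) (↭-++⁺ˡ (flat Q) (flatten-↭ p)))
      (subst₂ _↭_ (++-assoc (flat P) (flat Q) _) (++-assoc (flat Q) (flat P) _) (↭-++⁺ʳ _ (↭-++-comm (flat P) (flat Q))))
  flatten-↭ (↭trans p q) = ↭-trans (flatten-↭ p) (flatten-↭ q)

  all-↭ : ∀ {𝒫 𝒬} → 𝒫 ↭ 𝒬 → All Valid 𝒫 → All Valid 𝒬
  all-↭ p a = All.tabulate λ q → All.lookup a (∈-resp-↭ (↭-sym p) q)

  ends⊑ : ∀ 𝒫 → ends 𝒫 ⊑ flatten 𝒫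
  ends⊑ (P ∷ 𝒫) (here e) = here e
  ends⊑ (P ∷ 𝒫) (there p) = ∈-++⁺ʳ (flat P) (ends⊑ 𝒫 p)

  unique-ends : ∀ 𝒫 → Unique (flatten 𝒫) → Unique (ends 𝒫)
  unique-ends [] u = []
  unique-ends (P ∷ 𝒫) u = unique-cons (λ q → unique-disj (flat P) u (here refl) (ends⊑ 𝒫 q)) (unique-ends 𝒫 (unique-++ʳ (flat P) u))

  split-end : ∀ {u} 𝒫 → u ∈ ends 𝒫 → Σ[ p ∈ List A ] Σ[ 𝒬 ∈ List Path ] 𝒫 ↭ (u , p) ∷ 𝒬
  split-end 𝒫 u∈ with ∈-map⁻ proj₁ u∈
  ... | (u , p) , P∈ , refl with ∈-split P∈
  ... | 𝒬 , perm = p , 𝒬 , perm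

  Independent : List Path → Set
  Independent 𝒫 = Σ[ I ∈ List A ] Unique I × I ⊑ flatten 𝒫 × length I ≡ length 𝒫 × None r I I

  Better : List Path → Set
  Better 𝒫 = Σ[ 𝒬 ∈ List Path ] flatten 𝒬 ↭ flatten 𝒫 × All Valid 𝒬 × length 𝒬 < length 𝒫 × ends 𝒬 ⊑ ends 𝒫

  map-len : ∀ (𝒫 : List Path) → length (ends 𝒫) ≡ length 𝒫
  map-len 𝒫 = length-map proj₁ 𝒫

  extend : ∀ {w x} {𝒬 : List Path} {y z R} → r x w ≡ true → All Valid 𝒬 → flatten 𝒬 ↭ R → Unique R →
    (𝒬 ↭ (x , y) ∷ z) → All Valid ((w , x ∷ y) ∷ z) × flatten ((w , x ∷ y) ∷ z) ↭ w ∷ R × x ∉ ends z × length ((w , x ∷ y) ∷ z) ≡ length 𝒬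
  extend {w} {x} {𝒬} {y} {z} e val perm u split with all-↭ split val
  ... | vx ∷ vz = (e ∷ vx) ∷ vz , prep w (↭-trans (flatten-↭ (↭-sym split)) perm) ,
                  (λ x∈ → unique-disj (x ∷ y) (unique-↭ (↭-trans (↭-sym perm) (flatten-↭ split)) u) (here refl) (ends⊑ z x∈)) ,
                  sym (↭-length split)

  -- If the ends are not independent, let `w` be an end with a red edge from another end `x`. If `w`
  -- is a path by itself, it is appended after `x`. Otherwise `w` is deleted, its predecessor `w′`
  -- becomes an end, and induction applies. In a better cover of the rest, `w` is appended after
  -- `w′` or after `x` if one of them is an end. If neither is, the ends of that cover lie among
  -- those of `rest`, so it has at least two paths fewer than `𝒫`, and `w` can be added as a new
  -- path. This last case is why `Better` also controls the set of ends.
  improve : ∀ n 𝒫 → length (flatten 𝒫) ≤ n → Unique (flatten 𝒫) → All Valid 𝒫 → Independent 𝒫 ⊎ Better 𝒫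
  improve n 𝒫 h u val with find₂? r (ends 𝒫) (ends 𝒫)
  ... | inj₂ none = inj₁ (ends 𝒫 , unique-ends 𝒫 u , ends⊑ 𝒫 , map-len 𝒫 , none)
  ... | inj₁ (x , w , x∈ , w∈ , e) with split-end 𝒫 w∈
  ... | q , 𝒫₁ , perm₁ with split-end {x} 𝒫₁ (x∈𝒫₁ (∈-resp-↭ (map-perm perm₁) x∈))
    where
    map-perm : ∀ {𝒫 𝒬} → 𝒫 ↭ 𝒬 → ends 𝒫 ↭ ends 𝒬
    map-perm = Data.List.Relation.Binary.Permutation.Propositional.Properties.map⁺ proj₁
    x∈𝒫₁ : x ∈ w ∷ ends 𝒫₁ → x ∈ ends 𝒫₁
    x∈𝒫₁ (here refl) = contradiction (trans (sym e) (irr x)) (λ ())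
    x∈𝒫₁ (there p) = p
  ... | p , rest , perm₂ = finish n q h (↭-trans perm₁ (prep (w , q) perm₂))
    where
    finish : ∀ n q → length (flatten 𝒫) ≤ n → 𝒫 ↭ (w , q) ∷ (x , p) ∷ rest → Independent 𝒫 ⊎ Better 𝒫
    finish n [] h perm with all-↭ perm val
    ... | vw ∷ vx ∷ vr = inj₂ ((w , x ∷ p) ∷ rest , ↭-sym (flatten-↭ perm) , (e ∷ vx) ∷ vr ,
                           ≤-reflexive (sym (↭-length perm)) , sub)
      where
      sub : w ∷ ends rest ⊑ ends 𝒫
      sub (here refl) = w∈
      sub (there z) with ∈-map⁻ proj₁ z
      ... | P , P∈ , refl = ∈-map⁺ proj₁ (∈-resp-↭ (↭-sym perm) (there (there P∈)))
    finish zero (w′ ∷ q) h perm with subst (_≤ 0) (↭-length (flatten-↭ perm)) h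
    ... | ()
    finish (suc n) (w′ ∷ q) h perm with all-↭ perm val
    ... | (ew ∷ vw) ∷ vx ∷ vr = go (improve n 𝒫′ (s≤s⁻¹ (subst (_≤ suc n) (↭-length (flatten-↭ perm)) h)) u′ (vw ∷ vx ∷ vr))
      where
      𝒫′ = (w′ , q) ∷ (x , p) ∷ rest
      uw : Unique (w ∷ flatten 𝒫′)
      uw = unique-↭ (flatten-↭ perm) u
      u′ : Unique (flatten 𝒫′)
      u′ with uw
      ... | _ ∷ z = z
      back : ∀ {z} → z ∈ (x , p) ∷ rest → proj₁ z ∈ ends 𝒫
      back P∈ = ∈-map⁺ proj₁ (∈-resp-↭ (↭-sym perm) (there P∈))
      back′ : ∀ {z} → z ∈ x ∷ ends rest → z ∈ ends 𝒫
      back′ (here refl) = back (here refl)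
      back′ (there z) with ∈-map⁻ proj₁ z
      ... | P , P∈ , refl = back (there P∈)
      go : Independent 𝒫′ ⊎ Better 𝒫′ → Independent 𝒫 ⊎ Better 𝒫
      go (inj₁ (I , uI , sI , lI , nI)) =
        inj₁ (I , uI , (λ z → ∈-resp-↭ (↭-sym (flatten-↭ perm)) (there (sI z))) , trans lI (sym (↭-length perm)) , nI)
      go (inj₂ (𝒬 , pQ , vQ , lQ , sQ)) with w′ ∈? ends 𝒬
      ... | yes w′∈ with split-end 𝒬 w′∈
      ... | y , z , split with extend ew vQ pQ u′ split
      ... | v′ , p′ , ∉z , l′ = inj₂ (_ , ↭-trans p′ (↭-sym (flatten-↭ perm)) , v′ ,
              subst₂ _<_ (sym l′) (sym (↭-length perm)) lQ , sub)
        where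
        sub : w ∷ ends z ⊑ ends 𝒫
        sub (here refl) = w∈
        sub (there t) with ∈-map⁻ proj₁ t
        ... | P , P∈ , refl with sQ (∈-map⁺ proj₁ (∈-resp-↭ (↭-sym split) (there P∈)))
        ... | here refl = contradiction t ∉z
        ... | there t′ = back′ t′
      go (inj₂ (𝒬 , pQ , vQ , lQ , sQ)) | no w′∉ with x ∈? ends 𝒬
      ... | yes x∈Q with split-end 𝒬 x∈Q
      ... | y , z , split with extend e vQ pQ u′ split
      ... | v′ , p′ , ∉z , l′ = inj₂ (_ , ↭-trans p′ (↭-sym (flatten-↭ perm)) , v′ ,
              subst₂ _<_ (sym l′) (sym (↭-length perm)) lQ , sub)
        where
        sub : w ∷ ends z ⊑ ends 𝒫
        sub (here refl) = w∈
        sub (there t) with ∈-map⁻ proj₁ t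
        ... | P , P∈ , refl with ∈-map⁺ proj₁ (∈-resp-↭ (↭-sym split) (there P∈))
        ... | m with sQ m
        ... | here refl = contradiction m w′∉
        ... | there t′ = back′ t′
      go (inj₂ (𝒬 , pQ , vQ , lQ , sQ)) | no w′∉ | no x∉ =
        inj₂ ((w , []) ∷ 𝒬 , ↭-trans (prep w pQ) (↭-sym (flatten-↭ perm)) , [-] ∷ vQ ,
          subst (suc (suc (length 𝒬)) ≤_) (sym (↭-length perm))
            (s≤s (s≤s (subst₂ _≤_ (map-len 𝒬) (map-len rest)
              (length-⊑ (unique-ends 𝒬 (unique-↭ (↭-sym pQ) u′)) sub-rest)))) , sub)
        where
        sub-rest : ends 𝒬 ⊑ ends rest
        sub-rest t with sQ t
        ... | here refl = contradiction t w′∉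
        ... | there (here refl) = contradiction t x∉
        ... | there (there t′) = t′
        sub : w ∷ ends 𝒬 ⊑ ends 𝒫
        sub (here refl) = w∈
        sub (there t) = back′ (there (sub-rest t))

  optimise : ∀ n 𝒫 → length 𝒫 ≤ n → Unique (flatten 𝒫) → All Valid 𝒫 →
    Σ[ 𝒬 ∈ List Path ] flatten 𝒬 ↭ flatten 𝒫 × All Valid 𝒬 × Independent 𝒬
  optimise n 𝒫 h u val with improve (length (flatten 𝒫)) 𝒫 ≤-refl u val
  ... | inj₁ ind = 𝒫 , ↭-refl , val , ind
  optimise zero [] h u val | inj₂ (𝒬 , _ , _ , () , _)
  optimise (suc n) 𝒫 h u val | inj₂ (𝒬 , pQ , vQ , lQ , _) with optimise n 𝒬 (s≤s⁻¹ (≤-trans lQ h)) (unique-↭ (↭-sym pQ) u) vQ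
  ... | 𝒬′ , p′ , v′ , ind = 𝒬′ , ↭-trans p′ pQ , v′ , ind

  gallai-milgram : ∀ X → Unique X → Σ[ 𝒬 ∈ List Path ] flatten 𝒬 ↭ X × All Valid 𝒬 × Independent 𝒬
  gallai-milgram X u with optimise (length 𝒫) 𝒫 ≤-refl (subst Unique (sym (flat-singles X)) u) (valid-singles X)
    where
    singles : List A → List Path
    singles = map (λ x → x , [])
    𝒫 = singles X
    flat-singles : ∀ X → flatten (singles X) ≡ X
    flat-singles [] = refl
    flat-singles (x ∷ X) = cong (x ∷_) (flat-singles X)
    valid-singles : ∀ X → All Valid (singles X)
    valid-singles [] = []
    valid-singles (x ∷ X) = [-] ∷ valid-singles X
  ... | 𝒬 , p , v , ind = 𝒬 , ↭-trans p (↭-reflexive (flat-singles X)) , v , ind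
    where
    flat-singles : ∀ X → flatten (map (λ x → x , []) X) ≡ X
    flat-singles [] = refl
    flat-singles (x ∷ X) = cong (x ∷_) (flat-singles X)

  module _ (b : A → A → Bool)
           (complete : ∀ {x y} → x ≢ y → r x y ≡ false → r y x ≡ false → b x y ≡ true ⊎ b y x ≡ true) where

    -- If all paths of the cover have fewer than `i` vertices, there are at least `j` of them, hence
    -- `j` vertices without red edges among them. Any two of these are joined by a blue edge, and
    -- Rédei's theorem orders them into a path.
    mono-path : ∀ i j X → Unique X → 0 < i → 0 < j → i * j ≤ length X →
      Σ[ p ∈ List A ] p ⊑ X × (IsPath r i p ⊎ IsPath b j p)
    mono-path (suc i) (suc j) X u _ _ h with gallai-milgram X u
    ... | 𝒬 , perm , val , I , uI , sI , lI , nI with find? (λ P → does (suc i ≤? length (flat P))) 𝒬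
    -- Paths are stored backwards, so `take` selects the end of the path and `reverse` restores its
    -- direction.
    ... | inj₁ (P , P∈ , e) = reverse (take (suc i) (flat P)) , sub ,
            inj₁ (trans (length-reverse (take (suc i) (flat P))) (length-take-≤ (suc i) (flat P) long) ,
                  unique-↭ (↭-sym (↭-reverse _)) (Uniqueₚ.take⁺ (suc i) uP) ,
                  linked-reverse (linked-take (suc i) (All.lookup val P∈)))
      where
      long : suc i ≤ length (flat P)
      long = does-true (suc i ≤? length (flat P)) e
      in-flat : ∀ {P 𝒬} → P ∈ 𝒬 → flat P ⊑ flatten 𝒬
      in-flat (here refl) z = ∈-++⁺ˡ z
      in-flat {𝒬 = Q ∷ 𝒬} (there q) z = ∈-++⁺ʳ (flat Q) (in-flat q z)
      uniq-flat : ∀ {P} 𝒬 → P ∈ 𝒬 → Unique (flatten 𝒬) → Unique (flat P)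
      uniq-flat (Q ∷ 𝒬) (here refl) u = unique-++ˡ (flat Q) u
      uniq-flat (Q ∷ 𝒬) (there q) u = uniq-flat 𝒬 q (unique-++ʳ (flat Q) u)
      uP : Unique (flat P)
      uP = uniq-flat 𝒬 P∈ (unique-↭ (↭-sym perm) u)
      sub : reverse (take (suc i) (flat P)) ⊑ X
      sub z = ∈-resp-↭ perm (in-flat P∈ (take-⊑ (suc i) (∈-resp-↭ (↭-reverse _) z)))
    ... | inj₂ short with redei b I uI (λ x y x≢y → complete x≢y (nI x y) (nI y x))
    ... | q , pq , lq = take (suc j) q , (λ z → ∈-resp-↭ perm (sI (∈-resp-↭ pq (take-⊑ (suc j) z)))) ,
            inj₂ (length-take-≤ (suc j) q enough , Uniqueₚ.take⁺ (suc j) (unique-↭ (↭-sym pq) uI) , linked-take (suc j) lq)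
      where
      bound : ∀ 𝒬 → (∀ {P} → P ∈ 𝒬 → does (suc i ≤? length (flat P)) ≡ false) → length (flatten 𝒬) ≤ i * length 𝒬
      bound [] _ = z≤n
      bound (P ∷ 𝒬) s = subst₂ _≤_ (sym (length-++ (flat P))) (sym (*-suc i (length 𝒬)))
        (+-mono-≤ ≤i (bound 𝒬 (s ∘ there)))
        where
        ≤i : length (flat P) ≤ i
        ≤i = s≤s⁻¹ (≰⇒> (does-false (suc i ≤? length (flat P)) (s (here refl))))
      enough : suc j ≤ length q
      enough = subst (suc j ≤_) (trans (sym lI) (sym (↭-length pq))) (≮⇒≥ λ lt → <-irrefl refl (begin-strict
        length X ≡⟨ sym (↭-length perm) ⟩
        length (flatten 𝒬) ≤⟨ bound 𝒬 short ⟩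
        i * length 𝒬 ≤⟨ *-monoʳ-≤ i (s≤s⁻¹ lt) ⟩
        i * j ≤⟨ *-monoʳ-≤ i (n≤1+n j) ⟩
        i * suc j <⟨ m<n+m _ {suc j} (s≤s z≤n) ⟩
        suc i * suc j ≤⟨ h ⟩
        length X ∎))
        where open ≤-Reasoning

    extract : ∀ n i j X → length X ≤ n → Unique X → 0 < i → 0 < j →
      Σ[ rs ∈ List (List A) ] Σ[ bs ∈ List (List A) ] Σ[ rest ∈ List A ]
        X ↭ concat rs ++ concat bs ++ rest × All (IsPath r i) rs × All (IsPath b j) bs × length rest < i * j
    extract n i j X h u i>0 j>0 with i * j ≤? length X
    ... | no q = [] , [] , X , ↭-refl , [] , [] , ≰⇒> q
    ... | yes q with mono-path i j X u i>0 j>0 q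
    ... | p , p⊑ , c with unique-split (unique-p c) p⊑
      where
      unique-p : ∀ {p} → IsPath r i p ⊎ IsPath b j p → Unique p
      unique-p = [ (λ z → proj₁ (proj₂ z)) , (λ z → proj₁ (proj₂ z)) ]′
    extract zero i j [] h u i>0 j>0 | yes q | p , p⊑ , c | X′ , perm =
      contradiction q (<⇒≱ (*-mono-≤ i>0 j>0))
    extract (suc n) i j X h u i>0 j>0 | yes q | p , p⊑ , c | X′ , perm
      with extract n i j X′ shorter (unique-++ʳ p (unique-↭ perm u)) i>0 j>0
      where
      pos : 0 < length p
      pos = [ (λ z → subst (0 <_) (sym (proj₁ z)) i>0) , (λ z → subst (0 <_) (sym (proj₁ z)) j>0) ]′ c
      shorter : length X′ ≤ n
      shorter = s≤s⁻¹ (≤-trans (+-monoˡ-≤ (length X′) pos) (subst (_≤ suc n) (trans (↭-length perm) (length-++ p)) h))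
    ... | rs , bs , rest , perm′ , ar , ab , lr with c
    ... | inj₁ c′ = p ∷ rs , bs , rest , ↭-trans perm (subst (λ z → p ++ X′ ↭ z) (sym (++-assoc p (concat rs) _)) (↭-++⁺ˡ p perm′)) , c′ ∷ ar , ab , lr
    ... | inj₂ c′ = rs , p ∷ bs , rest ,
            ↭-trans perm (↭-trans (↭-++⁺ˡ p perm′) (shuffle (concat rs) p (concat bs) rest)) , ar , c′ ∷ ab , lr
      where
      shuffle : ∀ r p b z → p ++ r ++ b ++ z ↭ r ++ (p ++ b) ++ z
      shuffle r p b z = subst (λ w → p ++ r ++ b ++ z ↭ r ++ w) (sym (++-assoc p b z))
        (shifts p r)

-- Embedding out-trees

-- The value of `par` at the root is arbitrary, which explains the guards `v ≢ root`.
record OutTree (n : ℕ) : Set where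
  field
    root : Fin n
    par : Fin n → Fin n
    depth : Fin n → ℕ
    depth-par : ∀ v → v ≢ root → depth (par v) < depth v

  ch : Fin n → List (Fin n)
  ch u = filter (λ v → ¬? (v Finₚ.≟ root) ×-dec (par v Finₚ.≟ u)) (allFin n)

  ∈-ch⁺ : ∀ {u v} → v ≢ root → par v ≡ u → v ∈ ch u
  ∈-ch⁺ {u} {v} h e = ∈-filter⁺ (λ v → ¬? (v Finₚ.≟ root) ×-dec (par v Finₚ.≟ u)) (∈-allFin v) (h , e)

  ∈-ch⁻ : ∀ {u v} → v ∈ ch u → v ≢ root × par v ≡ u
  ∈-ch⁻ {u} v∈ = proj₂ (∈-filter⁻ (λ v → ¬? (v Finₚ.≟ root) ×-dec (par v Finₚ.≟ u)) {xs = allFin n} v∈)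

  unique-ch : ∀ u → Unique (ch u)
  unique-ch u = Uniqueₚ.filter⁺ (λ v → ¬? (v Finₚ.≟ root) ×-dec (par v Finₚ.≟ u)) (Uniqueₚ.allFin⁺ n)

  children : List (Fin n) → List (Fin n)
  children us = concat (map ch us)

  unique-children : ∀ {us} → Unique us → Unique (children us)
  unique-children [] = []
  unique-children {u ∷ us} w@(_ ∷ w′) = unique-++ (unique-ch u) (unique-children w′) disj
    where
    disj : Disj (ch u) (children us)
    disj p q with ∈-concat⁻′ (map ch us) q
    ... | c , v∈ , c∈ with ∈-map⁻ ch c∈
    ... | u′ , u′∈ , refl = ∉-unique w (subst (_∈ us) (trans (sym (proj₂ (∈-ch⁻ v∈))) (proj₂ (∈-ch⁻ p))) u′∈)

length-≤-fin : ∀ {n} {xs : List (Fin n)} → Unique xs → length xs ≤ n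
length-≤-fin {n} {xs} u = subst (length xs ≤_) (length-tabulate id) (length-⊑ u (λ {x} _ → ∈-allFin x))

module Embedding {n : ℕ} (S : OutTree n) {A : Set} (_≟_ : DecidableEquality A) (blue : A → A → Bool) where
  open OutTree S
  open DecMembership (Finₚ._≟_ {n}) using (_∈?_)

  Embedded : Set
  Embedded = Σ[ f ∈ (Fin n → A) ] (∀ {x y} → f x ≡ f y → x ≡ y) × (∀ v → v ≢ root → blue (f (par v)) (f v) ≡ true)

  record Partial (D : List (Fin n)) (f : Fin n → A) : Set where
    field
      uniq : Unique D
      inj : ∀ {x y} → x ∈ D → y ∈ D → f x ≡ f y → x ≡ y
      edge : ∀ {v} → v ∈ D → v ≢ root → par v ∈ D × blue (f (par v)) (f v) ≡ true
      root∈ : root ∈ D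

  -- Induction on the depth: if nothing is pending, membership in `D` passes from a parent to its
  -- children.
  complete : ∀ {D f} → Partial D f → (∀ v → v ∉ D → par v ∉ D) → Embedded
  complete {D} {f} P none = f , (λ e → inj (all _) (all _) e) , (λ v v≢ → proj₂ (edge (all v) v≢))
    where
    open Partial P
    go : ∀ d v → depth v < d → v ∈ D
    go (suc d) v (s≤s h) with v ∈? D | v Finₚ.≟ root
    ... | yes v∈ | _ = v∈
    ... | no v∉ | yes refl = root∈
    ... | no v∉ | no v≢ = contradiction (go d (par v) (<-≤-trans (depth-par v v≢) h)) (none v v∉)
    all : ∀ v → v ∈ D
    all v = go (suc (depth v)) v ≤-refl

  _[_↦_] : (Fin n → A) → Fin n → A → Fin n → A
  (f [ v ↦ h ]) x = if does (x Finₚ.≟ v) then h else f x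

  ↦-same : ∀ f v h → (f [ v ↦ h ]) v ≡ h
  ↦-same f v h with v Finₚ.≟ v
  ... | yes _ = refl
  ... | no q = contradiction refl q

  ↦-other : ∀ f {v h x} → x ≢ v → (f [ v ↦ h ]) x ≡ f x
  ↦-other f {v} {h} {x} x≢ with x Finₚ.≟ v
  ... | yes e = contradiction e x≢
  ... | no _ = refl

  extend : ∀ {D f v h} → Partial D f → v ∉ D → par v ∈ D → blue (f (par v)) h ≡ true →
    (∀ {x} → x ∈ D → f x ≢ h) → Partial (v ∷ D) (f [ v ↦ h ])
  extend {D} {f} {v} {h} P v∉ par∈ b fresh = record
    { uniq = unique-cons v∉ P.uniq
    ; inj = inj′
    ; edge = edge′
    ; root∈ = there P.root∈ }
    where
    module P = Partial P
    old : ∀ {x} → x ∈ D → (f [ v ↦ h ]) x ≡ f x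
    old x∈ = ↦-other f (λ { refl → v∉ x∈ })
    inj′ : ∀ {x y} → x ∈ v ∷ D → y ∈ v ∷ D → (f [ v ↦ h ]) x ≡ (f [ v ↦ h ]) y → x ≡ y
    inj′ (here refl) (here refl) e = refl
    inj′ (here refl) (there y∈) e = contradiction (trans (sym (old y∈)) (trans (sym e) (↦-same f v h))) (fresh y∈)
    inj′ (there x∈) (here refl) e = contradiction (trans (sym (old x∈)) (trans e (↦-same f v h))) (fresh x∈)
    inj′ (there x∈) (there y∈) e = P.inj x∈ y∈ (trans (sym (old x∈)) (trans e (old y∈)))
    edge′ : ∀ {x} → x ∈ v ∷ D → x ≢ root → par x ∈ v ∷ D × blue ((f [ v ↦ h ]) (par x)) ((f [ v ↦ h ]) x) ≡ true
    edge′ (here refl) _ = there par∈ , trans (cong₂ blue (old par∈) (↦-same f v h)) b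
    edge′ (there x∈) x≢ with P.edge x∈ x≢
    ... | p , e = there p , trans (cong₂ blue (old p) (old x∈)) e

  record Extension (D vs : List (Fin n)) (f : Fin n → A) (hs : List A) : Set where
    field
      g : Fin n → A
      partial : Partial (vs ++ D) g
      old : ∀ {x} → x ∈ D → g x ≡ f x
      new : ∀ {x} → x ∈ vs → g x ∈ hs

  extend-list : ∀ {D f u} vs hs → Partial D f → Unique vs → Disj vs D → (∀ {v} → v ∈ vs → par v ≡ u) → u ∈ D →
    length hs ≡ length vs → Unique hs → (∀ {h} → h ∈ hs → blue (f u) h ≡ true) →
    (∀ {x} → x ∈ D → f x ∉ hs) → Extension D vs f hs
  extend-list {f = f} [] [] P _ _ _ _ _ _ _ _ = record { g = f ; partial = P ; old = λ _ → refl ; new = λ () }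
  extend-list {D} {f} {u} (v ∷ vs) (h ∷ hs) P uv@(_ ∷ uv′) dis pv u∈ len uh@(_ ∷ uh′) bl fresh = record
    { g = E.g [ v ↦ h ]
    ; partial = extend E.partial v∉ (∈-++⁺ʳ vs par∈)
        (subst (λ z → blue z h ≡ true) (sym (trans (cong E.g (pv (here refl))) (E.old u∈))) (bl (here refl))) fresh′
    ; old = λ x∈ → trans (↦-other E.g (λ { refl → dis (here refl) x∈ })) (E.old x∈)
    ; new = new′ }
    where
    E = extend-list vs hs P uv′ (dis ∘ there) (pv ∘ there) u∈ (suc-injective len) uh′ (bl ∘ there) (λ x∈ q → fresh x∈ (there q))
    module E = Extension E
    par∈ : par v ∈ D
    par∈ = subst (_∈ D) (sym (pv (here refl))) u∈
    v∉ : v ∉ vs ++ D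
    v∉ p = [ ∉-unique uv , dis (here refl) ]′ (∈-++⁻ vs p)
    fresh′ : ∀ {x} → x ∈ vs ++ D → E.g x ≢ h
    fresh′ p e with ∈-++⁻ vs p
    ... | inj₁ q = ∉-unique uh (subst (_∈ hs) e (E.new q))
    ... | inj₂ q = fresh q (here (trans (sym (E.old q)) e))
    new′ : ∀ {x} → x ∈ v ∷ vs → (E.g [ v ↦ h ]) x ∈ h ∷ hs
    new′ {x} p with x Finₚ.≟ v
    ... | yes _ = here refl
    new′ (here refl) | no q = contradiction refl q
    new′ (there p) | no q = there (E.new p)

  nb : A → List A → ℕ
  nb v X = length (filterᵇ (blue v) X)

  start : ∀ h → Partial [ root ] (λ _ → h)
  start h = record
    { uniq = [] ∷ []
    ; inj = λ { (here refl) (here refl) _ → refl }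
    ; edge = λ { (here refl) q → contradiction refl q }
    ; root∈ = here refl }

  pending? : ∀ D (p : Fin n → Bool) →
    (Σ[ u ∈ Fin n ] u ∉ D × par u ∈ D × p u ≡ true) ⊎ (∀ u → u ∉ D → par u ∈ D → p u ≡ false)
  pending? D p with find? (λ u → not (does (u ∈? D)) ∧ (does (par u ∈? D) ∧ p u)) (allFin n)
  ... | inj₁ (u , _ , e) = inj₁ (u , go e)
    where
    go : not (does (u ∈? D)) ∧ (does (par u ∈? D) ∧ p u) ≡ true → u ∉ D × par u ∈ D × p u ≡ true
    go e with u ∈? D | par u ∈? D
    ... | no u∉ | yes p∈ = u∉ , p∈ , e
  ... | inj₂ none = inj₂ λ u u∉ p∈ → go u u∉ p∈ (none (∈-allFin u))
    where
    go : ∀ u → u ∉ D → par u ∈ D → not (does (u ∈? D)) ∧ (does (par u ∈? D) ∧ p u) ≡ false → p u ≡ false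
    go u u∉ p∈ e with u ∈? D | par u ∈? D
    ... | yes u∈ | _ = contradiction u∈ u∉
    ... | no _ | no q = contradiction p∈ q
    ... | no _ | yes _ = e

  pick-blue : ∀ d v X ys → Unique X → length ys + d ≤ nb v X →
    Σ[ hs ∈ List A ] length hs ≡ d × Unique hs × hs ⊑ X × Disj hs ys × (∀ {h} → h ∈ hs → blue v h ≡ true)
  pick-blue d v X ys u h with pick _≟_ d ys (unique-filterᵇ (blue v) u) h
  ... | hs , l , uh , s , dis = hs , l , uh , (λ p → proj₁ (∈-filterᵇ⁻ (blue v) {xs = X} (s p))) , dis ,
                                (λ p → proj₂ (∈-filterᵇ⁻ (blue v) {xs = X} (s p)))

-- Embedding a tree into a sequence of events

module _ {n : ℕ} (S : OutTree n) {A : Set} (_≟_ : DecidableEquality A) (blue : A → A → Bool) where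
  open OutTree S
  open Embedding S _≟_ blue
  open DecMembership (Finₚ._≟_ {n}) using (_∈?_)

  -- `q` is the quota that the event must account for: it hosts at least `q` vertices in `P` and
  -- `Q`, or it hosts in `Z` a vertex with more than `q` children.
  record Event : Set where
    field
      P Q Z : List A
      q : ℕ
    hosts : List A
    hosts = P ++ Q ++ Z

  open Event

  quota : List Event → ℕ
  quota es = sum (map q es)

  allHosts : List Event → List A
  allHosts es = concat (map hosts es)

  Exit : List Event → A → Set
  Exit es h = All (λ e → q e ≤ nb h (Q e) × 1 ≤ nb h (Z e)) es

  -- The children of a vertex placed in Q are placed in P at once, so only P and Z need exits.
  Good : List Event → Set
  Good [] = ⊤
  Good (e ∷ es) =
    (∀ {a} → a ∈ P e → Exit (e ∷ es) a) × (∀ {b} → b ∈ Q e → 2 * q e ≤ nb b (P e)) ×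
    (∀ {z} → z ∈ Z e → Exit es z) × Unique (hosts e) × Disj (hosts e) (allHosts es) × Good es

  Settled : List Event → List (Fin n) → (Fin n → A) → Set
  Settled es D f = ∀ {v} → v ∈ D → ch v ⊑ D ⊎ Exit es (f v)

  exit-of : ∀ {es D f u} → Partial D f → Settled es D f → u ∉ D → par u ∈ D → Exit es (f (par u))
  exit-of P st u∉ par∈ with st par∈
  ... | inj₂ x = x
  ... | inj₁ c = contradiction (c (∈-ch⁺ (λ { refl → u∉ (Partial.root∈ P) }) refl)) u∉

  record Inside (e : Event) (es : List Event) (D₀ : List (Fin n)) (D : List (Fin n)) (f : Fin n → A) (placed : ℕ) : Set where
    field
      partial : Partial D f
      settled : Settled (e ∷ es) D f
      usedP usedQ : List A
      inP : ∀ {v} → v ∈ D → f v ∈ P e → f v ∈ usedP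
      inQ : ∀ {v} → v ∈ D → f v ∈ Q e → f v ∈ usedQ
      notZ : ∀ {v} → v ∈ D → f v ∉ Z e
      later : ∀ {v} → v ∈ D → f v ∉ allHosts es
      boundP : length usedP ≤ placed
      boundQ : length usedQ ≤ placed
      size : length D₀ + placed ≤ length D
      grows : D₀ ⊑ D

  module _ (e : Event) (es : List Event) (good : Good (e ∷ es)) where
    private
      exitP = proj₁ good
      backQ : ∀ {b} → b ∈ Q e → 2 * q e ≤ nb b (P e)
      backQ = proj₁ (proj₂ good)
      exitZ = proj₁ (proj₂ (proj₂ good))
      uniqE : Unique (hosts e)
      uniqE = proj₁ (proj₂ (proj₂ (proj₂ good)))
      disjE : Disj (hosts e) (allHosts es)
      disjE = proj₁ (proj₂ (proj₂ (proj₂ (proj₂ good))))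
      goodEs = proj₂ (proj₂ (proj₂ (proj₂ (proj₂ good))))
      uniqP : Unique (P e)
      uniqP = unique-++ˡ (P e) uniqE
      uniqQ : Unique (Q e)
      uniqQ = unique-++ˡ (Q e) (unique-++ʳ (P e) uniqE)
      uniqZ : Unique (Z e)
      uniqZ = unique-++ʳ (Q e) (unique-++ʳ (P e) uniqE)
      P-Q : Disj (P e) (Q e)
      P-Q p x = unique-disj (P e) uniqE p (∈-++⁺ˡ x)
      P-Z : Disj (P e) (Z e)
      P-Z p x = unique-disj (P e) uniqE p (∈-++⁺ʳ (Q e) x)
      Q-Z : Disj (Q e) (Z e)
      Q-Z = unique-disj (Q e) (unique-++ʳ (P e) uniqE)

    Result : List (Fin n) → Set
    Result D₀ = Embedded ⊎ (Σ[ D ∈ List (Fin n) ] Σ[ f ∈ (Fin n → A) ] Σ[ p ∈ ℕ ] Inside e es D₀ D f p ×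
      (q e ≤ p ⊎ (∀ u → u ∉ D → par u ∈ D → q e < length (ch u))))

    -- As long as fewer than `q` vertices are placed, fewer than `q` vertices of each of `P` and `Q`
    -- are in use. The parent of `u` has `q` blue out-neighbours in `Q`, so one of them, `b`, is
    -- free; and `b` has 2`q` in `P`, which leaves `q` free ones for the at most `q` children of
    -- `u`.
    fill : ∀ fuel {D₀ D f placed} → q e ≤ fuel + placed → Inside e es D₀ D f placed → Result D₀
    fill fuel {D₀} {D} {f} {placed} h I with q e ≤? placed
    ... | yes full = inj₂ (D , f , placed , I , inj₁ full)
    ... | no room with pending? D (λ u → does (length (ch u) ≤? q e))
    ... | inj₂ none = inj₂ (D , f , placed , I , inj₂ λ u u∉ par∈ → ≰⇒> (does-false (length (ch u) ≤? q e) (none u u∉ par∈)))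
    fill zero h I | no room | inj₁ _ = contradiction h room
    fill (suc fuel) {D₀} {D} {f} {placed} h I | no room | inj₁ (u , u∉ , par∈ , e₁)
      with pick-blue 1 (f (par u)) (Q e) I.usedQ uniqQ
             (≤-trans (≤-reflexive (+-comm _ 1)) (≤-trans (s≤s I.boundQ) (≤-trans (≰⇒> room) (proj₁ (All.lookup (exit-of I.partial I.settled u∉ par∈) (here refl))))))
      where module I = Inside I
    ... | b ∷ [] , _ , ub , b⊑ , b-fresh , b-blue
      with pick-blue (length (ch u)) b (P e) (Inside.usedP I) uniqP
             (≤-trans (+-mono-≤ (≤-trans (Inside.boundP I) (<⇒≤ (≰⇒> room))) (does-true (length (ch u) ≤? q e) e₁))
                (≤-trans (≤-reflexive (cong (q e +_) (sym (+-identityʳ (q e))))) (backQ (b⊑ (here refl)))))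
    ... | hs , lhs , uhs , hs⊑ , hs-fresh , hs-blue =
      fill fuel (≤-trans h (≤-trans (≤-reflexive (sym (+-suc fuel placed))) (+-monoʳ-≤ fuel (s≤s (m≤m+n placed (length (ch u))))))) I′
      where
      module I = Inside I
      b∈ : b ∈ Q e
      b∈ = b⊑ (here refl)
      E₁ : Extension D [ u ] f [ b ]
      E₁ = extend-list [ u ] [ b ] I.partial ([] ∷ []) (λ { (here refl) → u∉ }) (λ { (here refl) → refl }) par∈ refl ([] ∷ [])
             b-blue (λ { x∈ (here r) → b-fresh (here refl) (subst (_∈ I.usedQ) r (I.inQ x∈ (subst (_∈ Q e) (sym r) b∈))) })
      module E₁ = Extension E₁
      gu : E₁.g u ≡ b
      gu with E₁.new (here refl)
      ... | here r = r
      ch∉ : Disj (ch u) (u ∷ D)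
      ch∉ v∈ (here refl) = <-irrefl (cong depth (proj₂ (∈-ch⁻ v∈))) (depth-par u (proj₁ (∈-ch⁻ v∈)))
      ch∉ {v} v∈ (there v∈D) = u∉ (subst (_∈ D) (proj₂ (∈-ch⁻ v∈)) (proj₁ (Partial.edge I.partial v∈D (proj₁ (∈-ch⁻ v∈)))))
      fresh₁ : ∀ {x} → x ∈ u ∷ D → E₁.g x ∉ hs
      fresh₁ (here refl) m = P-Q (hs⊑ m) (subst (_∈ Q e) (sym gu) b∈)
      fresh₁ {x} (there x∈) m = hs-fresh m (subst (_∈ I.usedP) (sym r) (I.inP x∈ (subst (_∈ P e) r (hs⊑ m))))
        where r = E₁.old x∈
      E₂ : Extension (u ∷ D) (ch u) E₁.g hs
      E₂ = extend-list (ch u) hs E₁.partial (unique-ch u) ch∉ (λ v∈ → proj₂ (∈-ch⁻ v∈)) (here refl) lhs uhs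
             (λ m → subst (λ z → blue z _ ≡ true) (sym gu) (hs-blue m)) fresh₁
      module E₂ = Extension E₂
      D′ = ch u ++ u ∷ D
      place : ∀ {v} → v ∈ D′ → E₂.g v ∈ hs ⊎ E₂.g v ≡ b ⊎ (Σ[ v∈ ∈ v ∈ D ] E₂.g v ≡ f v)
      place v∈ with ∈-++⁻ (ch u) v∈
      ... | inj₁ p = inj₁ (E₂.new p)
      ... | inj₂ (here refl) = inj₂ (inj₁ (trans (E₂.old (here refl)) gu))
      ... | inj₂ (there p) = inj₂ (inj₂ (p , trans (E₂.old (there p)) (E₁.old p)))
      settled′ : Settled (e ∷ es) D′ E₂.g
      settled′ v∈ with ∈-++⁻ (ch u) v∈
      ... | inj₁ p = inj₂ (exitP (hs⊑ (E₂.new p)))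
      ... | inj₂ (here refl) = inj₁ ∈-++⁺ˡ
      ... | inj₂ (there p) with I.settled p
      ... | inj₁ c = inj₁ (∈-++⁺ʳ (ch u) ∘ there ∘ c)
      ... | inj₂ x = inj₂ (subst (Exit (e ∷ es)) (sym (trans (E₂.old (there p)) (E₁.old p))) x)
      I′ : Inside e es D₀ D′ E₂.g (suc (placed + length (ch u)))
      I′ = record
        { partial = E₂.partial
        ; settled = settled′
        ; usedP = hs ++ I.usedP ; usedQ = b ∷ I.usedQ
        ; inP = λ v∈ m → [ ∈-++⁺ˡ , [ (λ r → ⊥-elim (P-Q (subst (_∈ P e) r m) b∈)) , (λ (p , r) → subst (_∈ _) (sym r) (∈-++⁺ʳ hs (I.inP p (subst (_∈ P e) r m)))) ]′ ]′ (place v∈)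
        ; inQ = λ v∈ m → [ (λ z → ⊥-elim (P-Q (hs⊑ z) m)) , [ here , (λ (p , r) → subst (_∈ _) (sym r) (there (I.inQ p (subst (_∈ Q e) r m)))) ]′ ]′ (place v∈)
        ; notZ = λ v∈ m → [ (λ z → P-Z (hs⊑ z) m) , [ (λ r → Q-Z b∈ (subst (_∈ Z e) r m)) , (λ (p , r) → I.notZ p (subst (_∈ Z e) r m)) ]′ ]′ (place v∈)
        ; later = λ v∈ m → [ (λ z → disjE (∈-++⁺ˡ (hs⊑ z)) m) , [ (λ r → disjE (∈-++⁺ʳ (P e) (∈-++⁺ˡ b∈)) (subst (_∈ allHosts es) r m)) , (λ (p , r) → I.later p (subst (_∈ allHosts es) r m)) ]′ ]′ (place v∈)
        ; boundP = ≤-trans (≤-reflexive (trans (length-++ hs) (cong (_+ length I.usedP) lhs)))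
                     (≤-trans (+-monoʳ-≤ (length (ch u)) I.boundP) (m≤n⇒m≤1+n (≤-reflexive (+-comm (length (ch u)) placed))))
        ; boundQ = s≤s (≤-trans I.boundQ (m≤m+n placed _))
        ; size = begin
            length D₀ + suc (placed + length (ch u)) ≡⟨ +-suc (length D₀) _ ⟩
            suc (length D₀ + (placed + length (ch u))) ≡⟨ cong suc (sym (+-assoc (length D₀) placed _)) ⟩
            suc (length D₀ + placed + length (ch u)) ≤⟨ s≤s (+-monoˡ-≤ _ I.size) ⟩
            suc (length D + length (ch u)) ≡⟨ cong suc (+-comm (length D) _) ⟩
            suc (length (ch u) + length D) ≡⟨ sym (+-suc (length (ch u)) _) ⟩
            length (ch u) + suc (length D) ≡⟨ sym (length-++ (ch u)) ⟩
            length D′ ∎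
        ; grows = λ x∈ → ∈-++⁺ʳ (ch u) (there (I.grows x∈)) }
        where open ≤-Reasoning

    enter : ∀ {D f} → Partial D f → Settled (e ∷ es) D f → (∀ {v} → v ∈ D → f v ∉ allHosts (e ∷ es)) →
            Inside e es D D f 0
    enter {D} P st out = record
      { partial = P ; settled = st ; usedP = [] ; usedQ = []
      ; inP = λ v∈ m → ⊥-elim (out v∈ (∈-++⁺ˡ (∈-++⁺ˡ m)))
      ; inQ = λ v∈ m → ⊥-elim (out v∈ (∈-++⁺ˡ (∈-++⁺ʳ (Event.P e) (∈-++⁺ˡ m))))
      ; notZ = λ v∈ m → out v∈ (∈-++⁺ˡ (∈-++⁺ʳ (Event.P e) (∈-++⁺ʳ (Q e) m)))
      ; later = λ v∈ m → out v∈ (∈-++⁺ʳ (hosts e) m)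
      ; boundP = z≤n ; boundQ = z≤n ; size = ≤-reflexive (+-identityʳ _) ; grows = id }

    -- Called when only vertices with many children are pending: placing one of them in Z pays for the rest of the quota.
    leave : ∀ {D₀ D f p} → Inside e es D₀ D f p →
      Embedded ⊎ (Σ[ u ∈ Fin n ] Σ[ g ∈ (Fin n → A) ] u ∉ D × par u ∈ D × Partial (u ∷ D) g × Settled es (u ∷ D) g ×
        (∀ {v} → v ∈ u ∷ D → g v ∉ allHosts es))
    leave {D₀} {D} {f} I with pending? D (λ _ → true)
    ... | inj₂ none = inj₁ (complete (Inside.partial I) (λ u u∉ par∈ → contradiction (none u u∉ par∈) (λ ())))
    ... | inj₁ (u , u∉ , par∈ , _)
      with pick-blue 1 (f (par u)) (Z e) [] uniqZ (proj₂ (All.lookup (exit-of (Inside.partial I) (Inside.settled I) u∉ par∈) (here refl)))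
    ... | z ∷ [] , _ , _ , z⊑ , _ , z-blue =
      inj₂ (u , E.g , u∉ , par∈ , E.partial , st , out)
      where
      module I = Inside I
      E : Extension D [ u ] f [ z ]
      E = extend-list [ u ] [ z ] I.partial ([] ∷ []) (λ { (here refl) → u∉ }) (λ { (here refl) → refl }) par∈ refl ([] ∷ [])
            z-blue (λ { x∈ (here r) → I.notZ x∈ (subst (_∈ Z e) (sym r) (z⊑ (here refl))) })
      module E = Extension E
      gz : E.g u ≡ z
      gz with E.new (here refl)
      ... | here r = r
      st : Settled es (u ∷ D) E.g
      st (here refl) = inj₂ (subst (Exit es) (sym gz) (exitZ (z⊑ (here refl))))
      st (there p) with I.settled p
      ... | inj₁ c = inj₁ (there ∘ c)
      ... | inj₂ (_ ∷ x) = inj₂ (subst (Exit es) (sym (E.old p)) x)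
      out : ∀ {v} → v ∈ u ∷ D → E.g v ∉ allHosts es
      out (here refl) m = disjE (∈-++⁺ʳ (P e) (∈-++⁺ʳ (Q e) (z⊑ (here refl)))) (subst (_∈ allHosts es) gz m)
      out (there p) m = I.later p (subst (_∈ allHosts es) (E.old p) m)

  -- Every event adds its quota to the number of placed vertices or, through a new element of
  -- `bigs`, to the number of children of `bigs`. Different vertices have disjoint sets of children,
  -- so both numbers are at most n, and a total quota above 2n cannot be used up.
  run-events : ∀ es {D f} bigs → Partial D f → Good es → Settled es D f → (∀ {v} → v ∈ D → f v ∉ allHosts es) →
    Unique bigs → bigs ⊑ D → n + n < quota es + (length D + length (children bigs)) → Embedded
  run-events [] {D} bigs P _ _ _ ub _ h = contradiction (+-mono-≤ (length-≤-fin (Partial.uniq P)) (length-≤-fin (unique-children ub))) (<⇒≱ h)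
  run-events (e ∷ es) {D} {f} bigs P good st out ub bigs⊑ h
    with fill e es good (q e) (m≤m+n (q e) 0) (enter e es good P st out)
  ... | inj₁ done = done
  ... | inj₂ (D′ , f′ , p , I , inj₁ full) =
    run-events es bigs I.partial (proj₂ (proj₂ (proj₂ (proj₂ (proj₂ good))))) (λ v∈ → [ inj₁ , (λ { (_ ∷ x) → inj₂ x }) ]′ (I.settled v∈)) I.later ub (I.grows ∘ bigs⊑)
      (begin-strict
        n + n <⟨ h ⟩
        q e + quota es + (length D + length (children bigs)) ≡⟨ arith (q e) (quota es) (length D) _ ⟩
        quota es + ((length D + q e) + length (children bigs)) ≤⟨ +-monoʳ-≤ (quota es) (+-monoˡ-≤ _ (≤-trans (+-monoʳ-≤ (length D) full) I.size)) ⟩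
        quota es + (length D′ + length (children bigs)) ∎)
    where
    module I = Inside I
    open ≤-Reasoning
    arith : ∀ a b c d → a + b + (c + d) ≡ b + ((c + a) + d)
    arith = solve-∀
  ... | inj₂ (D′ , f′ , p , I , inj₂ big) with leave e es good I
  ... | inj₁ done = done
  ... | inj₂ (u , g , u∉ , par∈ , P′ , st′ , out′) =
    run-events es (u ∷ bigs) P′ (proj₂ (proj₂ (proj₂ (proj₂ (proj₂ good))))) st′ out′ (unique-cons (λ u∈ → u∉ (Inside.grows I (bigs⊑ u∈))) ub) (λ { (here r) → here r ; (there p) → there (Inside.grows I (bigs⊑ p)) })
      (begin-strict
        n + n <⟨ h ⟩
        q e + quota es + (length D + length (children bigs)) ≡⟨ arith (q e) (quota es) (length D) _ ⟩
        quota es + (length D + (q e + length (children bigs)))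
          ≤⟨ +-monoʳ-≤ (quota es) (+-mono-≤ (m≤n⇒m≤1+n (≤-trans (m≤m+n (length D) p) (Inside.size I))) (≤-trans (+-monoˡ-≤ _ (<⇒≤ (big u u∉ par∈))) (≤-reflexive (sym (length-++ (ch u)))))) ⟩
        quota es + (length (u ∷ D′) + length (children (u ∷ bigs))) ∎)
    where
    open ≤-Reasoning
    arith : ∀ a b c d → a + b + (c + d) ≡ b + (c + (a + d))
    arith = solve-∀

  embed-in-events : ∀ es h → Good es → Exit es h → h ∉ allHosts es → n + n < quota es → Embedded
  embed-in-events es h good ex h∉ lt =
    run-events es [] (start h) good (λ { (here refl) → inj₂ ex }) (λ _ → h∉) [] (λ ()) (≤-trans lt (m≤m+n (quota es) _))

-- Embedding a tree into a sequence of blue blocks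

module _ {n : ℕ} (S : OutTree n) {A : Set} (_≟_ : DecidableEquality A) (blue : A → A → Bool) where
  open OutTree S
  open Embedding S _≟_ blue
  open DecMembership (Finₚ._≟_ {n}) using (_∈?_)

  -- A block is entered in `F`, where it can host `g` separate vertices; from any entry vertex it
  -- can also host a path of `g` vertices, inside `U`. So one use of the block can gain `g` vertices
  -- in either way.
  record Block (g : ℕ) : Set where
    field
      F U : List A
      uniqF : Unique F
      F⊑U : F ⊑ U
      run : ∀ {w} → w ∈ F → Σ[ p ∈ List A ] length (w ∷ p) ≡ g × Unique (w ∷ p) ×
              Linked (λ x y → blue x y ≡ true) (w ∷ p) × w ∷ p ⊑ U

  open Block

  module _ {g : ℕ} where

    allU : List (Block g) → List A
    allU es = concat (map U es)

    Open : List (Block g) → A → Set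
    Open es h = All (λ e → g ≤ nb h (F e)) es

    Forward : List (Block g) → Set
    Forward [] = ⊤
    Forward (e ∷ es) = (∀ {h} → h ∈ U e → Open es h) × Disj (U e) (allU es) × Forward es

  Long : ℕ → Fin n → Set
  Long zero u = ⊤
  Long (suc l) u = Any (Long l) (ch u)

  long? : ∀ l u → Dec (Long l u)
  long? zero u = yes tt
  long? (suc l) u = any? (long? l) (ch u)

  long-mono : ∀ l {u} → Long (suc l) u → Long l u
  long-mono zero _ = tt
  long-mono (suc l) p with find p
  ... | c , c∈ , q = lose c∈ (long-mono l q)

  long-≤ : ∀ {l l′ u} → l ≤ l′ → Long l′ u → Long l u
  long-≤ {l} {l′} {u} h p with m≤n⇒∃[o]m+o≡n h
  ... | o , refl = go o (subst (λ z → Long z u) (+-comm l o) p)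
    where
    go : ∀ o {u} → Long (o + l) u → Long l u
    go zero p = p
    go (suc o) p = go o (long-mono (o + l) p)

  descent : ∀ l u → Long l u → Σ[ q ∈ List (Fin n) ] length q ≡ l × Linked (λ x y → y ∈ ch x) (u ∷ q)
  descent zero u _ = [] , refl , [-]
  descent (suc l) u p with find p
  ... | c , c∈ , r with descent l c r
  ... | q , e , lk = c ∷ q , cong suc e , c∈ ∷ lk

  record Moved (D : List (Fin n)) (f : Fin n → A) (X : List A) (k : ℕ) : Set where
    field
      D′ : List (Fin n)
      f′ : Fin n → A
      partial : Partial D′ f′
      grows : D ⊑ D′
      size : length D′ ≡ k + length D
      old : ∀ {x} → x ∈ D → f′ x ≡ f x
      where-is : ∀ {x} → x ∈ D′ → x ∈ D ⊎ f′ x ∈ X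

  child-fresh : ∀ {D f u c} → Partial D f → u ∉ D → c ∈ ch u → c ∉ u ∷ D
  child-fresh P u∉ c∈ (here refl) = <-irrefl (cong depth (proj₂ (∈-ch⁻ c∈))) (depth-par _ (proj₁ (∈-ch⁻ c∈)))
  child-fresh {D} P u∉ c∈ (there c∈D) = u∉ (subst (_∈ D) (proj₂ (∈-ch⁻ c∈)) (proj₁ (Partial.edge P c∈D (proj₁ (∈-ch⁻ c∈)))))

  -- The new list of placed vertices is given explicitly because it is needed as a list that depends
  -- on the tree only, not on the host path.
  place-path : ∀ {D f} u q w p → Partial D f → u ∉ D → par u ∈ D → blue (f (par u)) w ≡ true →
    Linked (λ x y → y ∈ ch x) (u ∷ q) → Linked (λ x y → blue x y ≡ true) (w ∷ p) → length q ≡ length p →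
    Unique (w ∷ p) → (∀ {x} → x ∈ D → f x ∉ w ∷ p) →
    Σ[ M ∈ Moved D f (w ∷ p) (suc (length q)) ] Moved.D′ M ≡ q ʳ++ (u ∷ D)
  place-path {D} {f} u q w p P u∉ par∈ b lq lp len uw@(_ ∷ up) out = go q p lq lp len up (∉-unique uw) (λ x∈ → out x∈ ∘ there)
    where
    f₁ = f [ u ↦ w ]
    P₁ : Partial (u ∷ D) f₁
    P₁ = extend P u∉ par∈ b (λ x∈ e → out x∈ (here e))
    old : ∀ {x} → x ∈ D → f₁ x ≡ f x
    old x∈ = ↦-other f (λ { refl → u∉ x∈ })
    go : ∀ q p → Linked (λ x y → y ∈ ch x) (u ∷ q) → Linked (λ x y → blue x y ≡ true) (w ∷ p) → length q ≡ length p →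
         Unique p → w ∉ p → (∀ {x} → x ∈ D → f x ∉ p) → Σ[ M ∈ Moved D f (w ∷ p) (suc (length q)) ] Moved.D′ M ≡ q ʳ++ (u ∷ D)
    go [] [] _ _ _ _ _ _ = (record
      { D′ = u ∷ D ; f′ = f₁ ; partial = P₁ ; grows = there ; size = refl
      ; old = old
      ; where-is = λ { (here refl) → inj₂ (here (↦-same f u w)) ; (there x∈) → inj₁ x∈ } }) , refl
    go (c ∷ q) (w′ ∷ p) (c∈ ∷ lq) (b′ ∷ lp) len up w∉ out′ = (record
      { D′ = M.D′ ; f′ = M.f′ ; partial = M.partial ; grows = M.grows ∘ there
      ; size = trans M.size (+-suc (suc (length q)) (length D))
      ; old = λ x∈ → trans (M.old (there x∈)) (old x∈)
      ; where-is = λ x∈ → wh (M.where-is x∈) }) , proj₂ MM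
      where
      pc : par c ≡ u
      pc = proj₂ (∈-ch⁻ c∈)
      out₁ : ∀ {x} → x ∈ u ∷ D → f₁ x ∉ w′ ∷ p
      out₁ (here refl) m = w∉ (subst (_∈ w′ ∷ p) (↦-same f u w) m)
      out₁ (there x∈) m = out′ x∈ (subst (_∈ w′ ∷ p) (old x∈) m)
      MM = place-path c q w′ p P₁ (child-fresh P u∉ c∈) (subst (_∈ u ∷ D) (sym pc) (here refl))
            (subst (λ z → blue z w′ ≡ true) (sym (trans (cong f₁ pc) (↦-same f u w))) b′) lq lp (suc-injective len) up out₁
      module M = Moved (proj₁ MM)
      wh : ∀ {x} → x ∈ u ∷ D ⊎ M.f′ x ∈ w′ ∷ p → x ∈ D ⊎ M.f′ x ∈ w ∷ w′ ∷ p
      wh (inj₁ (here refl)) = inj₂ (here (trans (M.old (here refl)) (↦-same f u w)))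
      wh (inj₁ (there x∈)) = inj₁ x∈
      wh (inj₂ m) = inj₂ (there m)

  -- Greedy: each parent has as many blue out-neighbours in `X` as there are vertices to place, so a
  -- free one is always left.
  place-singles : ∀ {D f} X us → Partial D f → Unique us → (∀ {u} → u ∈ us → u ∉ D × par u ∈ D) →
    Unique X → (∀ {x} → x ∈ D → f x ∉ X × length us ≤ nb (f x) X) →
    Σ[ M ∈ Moved D f X (length us) ] (us ⊑ Moved.D′ M × (∀ {x} → x ∈ Moved.D′ M → x ∈ us ⊎ x ∈ D))
  place-singles {D} {f} X [] P _ _ _ _ =
    record { D′ = D ; f′ = f ; partial = P ; grows = id ; size = refl ; old = λ _ → refl ; where-is = inj₁ } , (λ ()) , inj₂
  place-singles {D} {f} X (u ∷ us) P uu@(_ ∷ uu′) pend uX out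
    with place-singles X us P uu′ (pend ∘ there) uX (λ x∈ → proj₁ (out x∈) , ≤-trans (n≤1+n _) (proj₂ (out x∈)))
  ... | M , us⊑ , from with pick-blue 1 (f (par u)) X (map (Moved.f′ M) us) uX
         (≤-trans (≤-reflexive (trans (+-comm _ 1) (cong suc (length-map (Moved.f′ M) us)))) (proj₂ (out (proj₂ (pend (here refl))))))
  ... | h ∷ [] , _ , _ , h⊑ , h-fresh , h-blue = record
    { D′ = u ∷ M.D′ ; f′ = M.f′ [ u ↦ h ]
    ; partial = extend M.partial u∉ (M.grows par∈)
        (subst (λ z → blue z h ≡ true) (sym old-par) (h-blue (here refl))) fresh
    ; grows = there ∘ M.grows ; size = cong suc M.size
    ; old = λ x∈ → trans (↦-other M.f′ (λ { refl → proj₁ (pend (here refl)) x∈ })) (M.old x∈)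
    ; where-is = λ { (here refl) → inj₂ (subst (_∈ X) (sym (↦-same M.f′ u h)) (h⊑ (here refl)))
                   ; (there x∈) → wh x∈ (M.where-is x∈) } } ,
    (λ { (here r) → here r ; (there p) → there (us⊑ p) }) ,
    (λ { (here r) → inj₁ (here r) ; (there p) → [ inj₁ ∘ there , inj₂ ]′ (from p) })
    where
    module M = Moved M
    par∈ = proj₂ (pend (here refl))
    u∉ : u ∉ M.D′
    u∉ p = [ ∉-unique uu , proj₁ (pend (here refl)) ]′ (from p)
    old-par : M.f′ (par u) ≡ f (par u)
    old-par = M.old par∈
    fresh : ∀ {x} → x ∈ M.D′ → M.f′ x ≢ h
    fresh x∈ e with from x∈
    ... | inj₁ x∈us = h-fresh (here refl) (subst (_∈ map M.f′ us) e (∈-map⁺ M.f′ x∈us))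
    ... | inj₂ x∈D = proj₁ (out x∈D) (subst (_∈ X) (trans (sym e) (M.old x∈D)) (h⊑ (here refl)))
    wh : ∀ {x} → x ∈ M.D′ → x ∈ D ⊎ M.f′ x ∈ X → x ∈ D ⊎ (M.f′ [ u ↦ h ]) x ∈ X
    wh x∈ (inj₁ d) = inj₁ d
    wh x∈ (inj₂ m) = inj₂ (subst (_∈ X) (sym (↦-other M.f′ (λ { refl → u∉ x∈ }))) m)

  Pending : List (Fin n) → List (Fin n)
  Pending D = filter (λ u → ¬? (u ∈? D) ×-dec (par u ∈? D)) (allFin n)

  pending⁻ : ∀ {D u} → u ∈ Pending D → u ∉ D × par u ∈ D
  pending⁻ {D} p = proj₂ (∈-filter⁻ (λ u → ¬? (u ∈? D) ×-dec (par u ∈? D)) {xs = allFin n} p)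

  pending⁺ : ∀ {D u} → u ∉ D → par u ∈ D → u ∈ Pending D
  pending⁺ {D} {u} p q = ∈-filter⁺ (λ u → ¬? (u ∈? D) ×-dec (par u ∈? D)) (∈-allFin u) (p , q)

  module _ {g : ℕ} where

    opens : ∀ {e} {es : List (Block (suc g))} {D f X l} → X ⊑ U e → Forward (e ∷ es) → (∀ {v} → v ∈ D → Open (e ∷ es) (f v)) →
      (M : Moved D f X l) → ∀ {v} → v ∈ Moved.D′ M → Open es (Moved.f′ M v)
    opens X⊑ (fwU , _) op M v∈ with Moved.where-is M v∈
    ... | inj₂ m = fwU (X⊑ m)
    ... | inj₁ d = subst (Open _) (sym (Moved.old M d)) (All.tail (op d))

    avoids : ∀ {e} {es : List (Block (suc g))} {D f X l} → X ⊑ U e → Forward (e ∷ es) → (∀ {v} → v ∈ D → f v ∉ allU (e ∷ es)) →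
      (M : Moved D f X l) → ∀ {v} → v ∈ Moved.D′ M → Moved.f′ M v ∉ allU es
    avoids {e} {es} X⊑ (_ , disU , _) out M v∈ m with Moved.where-is M v∈
    ... | inj₂ m′ = disU (X⊑ m′) m
    ... | inj₁ d = out d (∈-++⁺ʳ (U e) (subst (_∈ allU es) (Moved.old M d) m))

    advance : ∀ a {l d d′} → l ≡ suc g → d′ ≡ l + d → suc g * suc a + d ≤ suc g * a + d′
    advance a {d = d} refl refl = ≤-reflexive (trans (cong (_+ d) (trans (*-suc (suc g) a) (+-comm (suc g) _))) (+-assoc (suc g * a) (suc g) d))

    -- Every block either receives g vertices or lowers the height of all pending subtrees.
    run-blocks : ∀ (es : List (Block (suc g))) a H {D f} → Partial D f → Forward es →
      (∀ {v} → v ∈ D → Open es (f v)) → (∀ {v} → v ∈ D → f v ∉ allU es) →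
      (g < H ⊎ (∀ {u} → u ∈ Pending D → ¬ Long H u)) →
      n ≤ suc g * a + length D → a + H ≤ length es → Embedded
    run-blocks es zero H {D} P fw op out info cover len = complete P λ v v∉ _ →
      contradiction (length-≤-fin (unique-cons v∉ (Partial.uniq P)))
        (<⇒≱ (s≤s (subst (λ z → n ≤ z + length D) (*-zeroʳ (suc g)) cover)))
    run-blocks es (suc a) zero P fw op out (inj₂ none) cover len =
      complete P λ v v∉ p∈ → none (pending⁺ v∉ p∈) tt
    run-blocks (e ∷ es) (suc a) (suc H) {D} {f} P (fwU , disU , fw) op out info cover len
      with any? (long? g) (Pending D)
    ... | yes long with find long
    ... | u , u∈ , lu with descent g u lu
    ... | q , lq , dq with pick-blue 1 (f (par u)) (F e) [] (uniqF e) (≤-trans (s≤s z≤n) (All.head (op (proj₂ (pending⁻ u∈)))))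
    ... | w ∷ [] , _ , _ , w⊑ , _ , w-blue with run e (w⊑ (here refl))
    ... | p , lp , up , bp , p⊑ =
      run-blocks es a (suc H) M.partial fw (opens {e = e} p⊑ (fwU , disU , fw) op M) (avoids {e = e} p⊑ (fwU , disU , fw) out M) info′
        (≤-trans cover (advance a (cong suc lq) M.size)) (s≤s⁻¹ len)
      where
      M : Moved D f (w ∷ p) (suc (length q))
      M = proj₁ (place-path u q w p P (proj₁ (pending⁻ u∈)) (proj₂ (pending⁻ u∈)) (w-blue (here refl)) dq bp
            (trans lq (sym (suc-injective lp))) up (λ x∈ m → out x∈ (∈-++⁺ˡ (p⊑ m))))
      module M = Moved M
      -- If pending subtrees were known to have height below `suc H`, the descending path of length
      -- `g` just found shows `g < suc H`; so the first alternative holds from now on.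
      info′ : g < suc H ⊎ (∀ {u} → u ∈ Pending M.D′ → ¬ Long (suc H) u)
      info′ = inj₁ ([ id , (λ (none : ∀ {u} → u ∈ Pending D → ¬ Long (suc H) u) → ≰⇒> (λ H≤ → none u∈ (long-≤ H≤ lu))) ]′ info)
    run-blocks (e ∷ es) (suc a) (suc H) {D} {f} P (fwU , disU , fw) op out info cover len
      | no short with suc g ≤? length (Pending D)
    ... | yes many = run-blocks es a (suc H) M.partial fw (opens {e = e} (F⊑U e) (fwU , disU , fw) op M) (avoids {e = e} (F⊑U e) (fwU , disU , fw) out M) info′ (≤-trans cover (advance a lus M.size)) (s≤s⁻¹ len)
      where
      us = take (suc g) (Pending D)
      lus : length us ≡ suc g
      lus = length-take-≤ (suc g) (Pending D) many
      MM = place-singles (F e) us P (Uniqueₚ.take⁺ (suc g) (Uniqueₚ.filter⁺ _ (Uniqueₚ.allFin⁺ n)))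
            (λ u∈ → pending⁻ (take-⊑ (suc g) u∈)) (uniqF e)
            (λ {x} x∈ → (λ m → out x∈ (∈-++⁺ˡ (F⊑U e m))) , subst (_≤ nb (f x) (F e)) (sym lus) (All.head (op x∈)))
      M = proj₁ MM
      module M = Moved M
      info′ : g < suc H ⊎ (∀ {u} → u ∈ Pending M.D′ → ¬ Long (suc H) u)
      info′ = [ inj₁ , (λ (none : ∀ {u} → u ∈ Pending D → ¬ Long (suc H) u) → inj₂ (λ {u} → new none {u})) ]′ info
        where
        new : (∀ {u} → u ∈ Pending D → ¬ Long (suc H) u) → ∀ {u} → u ∈ Pending M.D′ → ¬ Long (suc H) u
        new none {u} u∈ lu with pending⁻ u∈
        ... | u∉ , p∈ with proj₂ (proj₂ MM) p∈
        ... | inj₂ p∈D = none (pending⁺ (u∉ ∘ M.grows) p∈D) lu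
        ... | inj₁ p∈us = none (take-⊑ (suc g) p∈us)
               (long-mono (suc H) (lose (∈-ch⁺ (λ { refl → u∉ (M.grows (Partial.root∈ P)) }) refl) lu))
    ... | no few = run-blocks es (suc a) H M.partial fw (opens {e = e} (F⊑U e) (fwU , disU , fw) op M) (avoids {e = e} (F⊑U e) (fwU , disU , fw) out M) (inj₂ info′)
           (≤-trans cover (+-monoʳ-≤ (suc g * suc a) (≤-trans (m≤n+m _ _) (≤-reflexive (sym M.size)))))
           (s≤s⁻¹ (subst (_≤ suc (length es)) (+-suc (suc a) H) len))
      where
      us = Pending D
      MM = place-singles (F e) us P (Uniqueₚ.filter⁺ _ (Uniqueₚ.allFin⁺ n)) pending⁻ (uniqF e)
            (λ {x} x∈ → (λ m → out x∈ (∈-++⁺ˡ (F⊑U e m))) , ≤-trans (<⇒≤ (≰⇒> few)) (All.head (op x∈)))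
      M = proj₁ MM
      module M = Moved M
      -- If only `g < suc H` is known, the height bound comes from the failed search for a
      -- descending path of length `g`. All pending vertices are then placed at once, the new
      -- pending vertices are their children, and the bound drops to `H`.
      low : ∀ {u} → u ∈ Pending D → ¬ Long (suc H) u
      low u∈ lu = [ (λ lt → short (lose u∈ (long-≤ (<⇒≤ lt) lu))) , (λ (none : ∀ {u} → u ∈ Pending D → ¬ Long (suc H) u) → none u∈ lu) ]′ info
      info′ : ∀ {u} → u ∈ Pending M.D′ → ¬ Long H u
      info′ {u} u∈ lu with pending⁻ u∈
      ... | u∉ , p∈ with proj₂ (proj₂ MM) p∈
      ... | inj₂ p∈D = u∉ (proj₁ (proj₂ MM) (pending⁺ (u∉ ∘ M.grows) p∈D))
      ... | inj₁ p∈us = low p∈us (lose (∈-ch⁺ (λ { refl → u∉ (M.grows (Partial.root∈ P)) }) refl) lu)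

    -- At most `a` blocks are used up by gaining `suc g` vertices each, and at most `suc g` by
    -- lowering the height bound, which starts at `suc g`.
    embed-in-blocks : ∀ (es : List (Block (suc g))) h a → Forward es → Open es h → h ∉ allU es →
      n ≤ suc g * a → a + suc g ≤ length es → Embedded
    embed-in-blocks es h a fw op h∉ cover len =
      run-blocks es a (suc g) (start h) fw (λ _ → op) (λ _ → h∉) (inj₁ ≤-refl) (≤-trans cover (m≤m+n _ _)) len

-- Density and exceptional vertices

deg : {A : Set} → (A → A → Bool) → A → List A → ℕ
deg r v X = length (filterᵇ (r v) X)

edgesBetween : {A : Set} → (A → A → Bool) → List A → List A → ℕ
edgesBetween r X Y = sum (map (λ x → deg r x Y) X)

-- In `dense`, 1/`E` takes the place of ε and `k` that of the threshold σ log N. The relations `g`,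
-- `red` and `blue` will be those of the tournament or their converses, according to the direction
-- of S.
record Coloured (A : Set) : Set where
  field
    _≟_ : DecidableEquality A
    g red blue : A → A → Bool
    E₀ k : ℕ
  E : ℕ
  E = suc E₀
  field
    irr : ∀ x → red x x ≡ false
    blue-rest : ∀ {x y} → g x y ≡ true → red x y ≡ false → blue x y ≡ true
    total : ∀ {x y} → x ≢ y → g x y ≡ true ⊎ g y x ≡ true
    k>0 : 0 < k
    dense : ∀ {X Y} → Unique X → Unique Y → Disj X Y → k ≤ length X → k ≤ length Y →
            length X * length Y ≤ E * edgesBetween g X Y

module Density {A : Set} (𝒢 : Coloured A) (V : List A) (uV : Unique V) where
  open Coloured 𝒢
  open DecMembership _≟_ using (_∈?_)

  poor : List A → A → Bool
  poor X v = does (E * deg g v X <? length X)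

  -- Nothing is known about sets with fewer than `k` vertices; with the empty list for them,
  -- `length-bad` holds for every set.
  bad′ : ∀ X → Dec (k ≤ length X) → List A
  bad′ X (yes _) = filterᵇ (poor X) (_∖_ _≟_ V X)
  bad′ X (no _) = []

  bad : List A → List A
  bad X = bad′ X (k ≤? length X)

  -- More than `k` poor vertices would form, together with `X`, two large disjoint sets with too few
  -- edges from the first to the second.
  length-bad : ∀ X → Unique X → length (bad X) ≤ k
  length-bad X uX with k ≤? length X
  ... | no _ = z≤n
  ... | yes k≤ = ≮⇒≥ λ k<B → <-irrefl refl (begin-strict
      E * edgesBetween g B X <⟨ few B (λ p → does-true (E * deg g _ X <? length X) (proj₂ (∈-filterᵇ⁻ (poor X) {xs = _∖_ _≟_ V X} p))) (≤-<-trans z≤n k<B) ⟩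
      length B * length X ≤⟨ dense (unique-filterᵇ (poor X) (unique-∖ _≟_ X uV)) uX
                               (λ p → proj₂ (∈-∖⁻ _≟_ V X (proj₁ (∈-filterᵇ⁻ (poor X) {xs = _∖_ _≟_ V X} p)))) (<⇒≤ k<B) k≤ ⟩
      E * edgesBetween g B X ∎)
    where
    open ≤-Reasoning
    B = filterᵇ (poor X) (_∖_ _≟_ V X)
    few≤ : ∀ B → (∀ {v} → v ∈ B → E * deg g v X < length X) → E * edgesBetween g B X ≤ length B * length X
    few≤ [] _ = ≤-reflexive (*-zeroʳ E)
    few≤ (v ∷ B) h = ≤-trans (≤-reflexive (*-distribˡ-+ E (deg g v X) _)) (+-mono-≤ (<⇒≤ (h (here refl))) (few≤ B (h ∘ there)))
    few : ∀ B → (∀ {v} → v ∈ B → E * deg g v X < length X) → 0 < length B → E * edgesBetween g B X < length B * length X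
    few (v ∷ B) h _ = ≤-<-trans (≤-reflexive (*-distribˡ-+ E (deg g v X) _)) (+-mono-<-≤ (h (here refl)) (few≤ B (h ∘ there)))

  deg-blue : ∀ {X v} → k ≤ length X → v ∈ V → v ∉ X → v ∉ bad X → (∀ {x} → x ∈ X → red v x ≡ false) →
             length X ≤ E * deg blue v X
  deg-blue {X} {v} k≤ v∈ v∉ v∉bad none with k ≤? length X
  ... | no q = contradiction k≤ q
  ... | yes _ = ≤-trans (≮⇒≥ λ lt → v∉bad (∈-filterᵇ⁺ (poor X) (∈-∖⁺ _≟_ v∈ v∉) (dec-yes lt)))
                        (*-monoʳ-≤ E (g≤blue X none))
    where
    dec-yes : E * deg g v X < length X → poor X v ≡ true
    dec-yes lt = does-yes (E * deg g v X <? length X) lt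
    g≤blue : ∀ X → (∀ {x} → x ∈ X → red v x ≡ false) → deg g v X ≤ deg blue v X
    g≤blue [] _ = z≤n
    g≤blue (x ∷ X) h with g v x in eg | g≤blue X (h ∘ there)
    ... | true | r = ≤-trans (s≤s r) (≤-reflexive (cong length (sym (filterᵇ-∷-true (blue v) {xs = X} (blue-rest eg (h (here refl)))))))
    ... | false | r with blue v x
    ... | true = m≤n⇒m≤1+n r
    ... | false = r

  module Clean (Bd : List A) where

    hit : List A → ℕ
    hit X = length (filter (_∈? Bd) X)

    hit-++ : ∀ X Y → hit (X ++ Y) ≡ hit X + hit Y
    hit-++ X Y = trans (cong length (filter-++ (_∈? Bd) X Y)) (length-++ (filter (_∈? Bd) X))

    clean : List A → List A
    clean X = _∖_ _≟_ X Bd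

    clean-⊑ : ∀ X → clean X ⊑ X
    clean-⊑ X p = proj₁ (∈-∖⁻ _≟_ X Bd p)

    clean-good : ∀ X {v} → v ∈ clean X → v ∉ Bd
    clean-good X p = proj₂ (∈-∖⁻ _≟_ X Bd p)

    deg-clean : ∀ (r : A → A → Bool) v X → deg r v X ≤ deg r v (clean X) + hit X
    deg-clean r v [] = z≤n
    deg-clean r v (x ∷ X) with x ∈? Bd
    ... | yes _ with r v x
    ... | true = ≤-trans (s≤s (deg-clean r v X)) (≤-reflexive (sym (+-suc _ _)))
    ... | false = ≤-trans (deg-clean r v X) (+-monoʳ-≤ _ (n≤1+n _))
    deg-clean r v (x ∷ X) | no _ with r v x
    ... | true = s≤s (deg-clean r v X)
    ... | false = deg-clean r v X

    -- By `deg-blue` there are at least h/E blue out-neighbours in `X`. Cleaning removes at most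
    -- h/(2E) of them, so at least h/(2E) survive.
    deg-blue-clean : ∀ {X v h d} → bad X ⊑ Bd → k ≤ h → h ≤ length X → 2 * E * hit X ≤ h → v ∈ V → v ∉ X → v ∉ Bd →
      (∀ {x} → x ∈ X → red v x ≡ false) → 2 * E * d ≤ h → d ≤ deg blue v (clean X)
    deg-blue-clean {X} {v} {h} {d} bad⊑ k≤h h≤ few v∈ v∉X v∉ none d≤ =
      *-cancelˡ-≤ (2 * E) (≤-trans d≤ (+-cancelʳ-≤ h h _ (begin
        h + h ≡⟨ cong (h +_) (sym (+-identityʳ h)) ⟩
        2 * h ≤⟨ *-monoʳ-≤ 2 (≤-trans h≤ (deg-blue (≤-trans k≤h h≤) v∈ v∉X (v∉ ∘ bad⊑) none)) ⟩
        2 * (E * deg blue v X) ≡⟨ sym (*-assoc 2 E _) ⟩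
        2 * E * deg blue v X ≤⟨ *-monoʳ-≤ (2 * E) (deg-clean blue v X) ⟩
        2 * E * (deg blue v (clean X) + hit X) ≡⟨ *-distribˡ-+ (2 * E) _ (hit X) ⟩
        2 * E * deg blue v (clean X) + 2 * E * hit X ≤⟨ +-monoʳ-≤ _ few ⟩
        2 * E * deg blue v (clean X) + h ∎)))
      where open ≤-Reasoning

    hit-≤ : ∀ {X} → Unique X → hit X ≤ length Bd
    hit-≤ {X} u = length-⊑ (Uniqueₚ.filter⁺ (_∈? Bd) u) (λ p → proj₂ (∈-filter⁻ (_∈? Bd) {xs = X} p))

-- From pairs to events

module EventPlan {A : Set} (𝒢 : Coloured A) (V : List A) (uV : Unique V) {n : ℕ} (S : OutTree n) where
  open Coloured 𝒢
  open Density 𝒢 V uV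
  open Embedding S _≟_ blue using (Embedded; nb)
  open import Algebra.Solver.CommutativeMonoid (++-commutativeMonoid {A = A}) using (solve; _⊜_; _⊕_)

  Ev : Set
  Ev = Event S _≟_ blue

  -- The first halves of `P` and `Q` host the event itself. The second halves are the reserve: that
  -- of `Q` can become the set `Z` of the event, that of `P` the entry to the events.
  lo hi : List A → List A
  lo X = take (length X / 2) X
  hi X = drop (length X / 2) X

  -- The exceptional vertices of all pairs are collected before any event is built, because a host
  -- must have exits into all later events.
  badOf : Str A → List A
  badOf leaf = []
  badOf (node l P Q m) = (bad (lo P) ++ bad (hi P) ++ bad (lo Q) ++ bad (hi Q)) ++ badOf l ++ badOf m

  half-≤ : ∀ x → x / 2 ≤ x
  half-≤ x = m/n≤m x 2

  2*half : ∀ x → x ≤ suc (x / 2 + x / 2)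
  2*half x = begin
    x ≡⟨ m≡m%n+[m/n]*n x 2 ⟩
    x % 2 + x / 2 * 2 ≤⟨ +-monoˡ-≤ _ (s≤s⁻¹ (m%n<n x 2)) ⟩
    1 + x / 2 * 2 ≡⟨ cong suc (trans (*-comm (x / 2) 2) (cong (x / 2 +_) (+-identityʳ _))) ⟩
    suc (x / 2 + x / 2) ∎
    where open ≤-Reasoning

  half+half : ∀ x → x / 2 + x / 2 ≤ x
  half+half x = ≤-trans (≤-reflexive (sym (trans (*-comm (x / 2) 2) (cong (x / 2 +_) (+-identityʳ _))))) (m/n*n≤m x 2)

  length-lo : ∀ X → length (lo X) ≡ length X / 2
  length-lo X = length-take-≤ _ X (half-≤ (length X))

  length-hi : ∀ X → length X / 2 ≤ length (hi X)
  length-hi X = subst (length X / 2 ≤_) (sym (length-drop (length X / 2) X)) (m+n≤o⇒m≤o∸n (length X / 2) (half+half (length X)))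

  lo⊑ : ∀ X → lo X ⊑ X
  lo⊑ X = take-⊑ (length X / 2)

  hi⊑ : ∀ X → hi X ⊑ X
  hi⊑ X p = subst (_ ∈_) (take++drop≡id (length X / 2) X) (∈-++⁺ʳ (lo X) p)

  unique-lo : ∀ X → Unique X → Unique (lo X)
  unique-lo X = Uniqueₚ.take⁺ (length X / 2)

  unique-hi : ∀ X → Unique X → Unique (hi X)
  unique-hi X u = unique-++ʳ (lo X) (subst Unique (sym (take++drop≡id (length X / 2) X)) u)

  length-badOf : ∀ σ → Unique (core σ) → length (badOf σ) ≤ events σ * (4 * k)
  length-badOf leaf u = z≤n
  length-badOf (node l P Q m) u = begin
    length ((bad (lo P) ++ bad (hi P) ++ bad (lo Q) ++ bad (hi Q)) ++ badOf l ++ badOf m)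
      ≡⟨ trans (length-++ (bad (lo P) ++ _)) (cong₂ _+_ (trans (length-++ (bad (lo P))) (cong (length (bad (lo P)) +_) (trans (length-++ (bad (hi P))) (cong (length (bad (hi P)) +_) (length-++ (bad (lo Q))))))) (length-++ (badOf l))) ⟩
    (length (bad (lo P)) + (length (bad (hi P)) + (length (bad (lo Q)) + length (bad (hi Q))))) + (length (badOf l) + length (badOf m))
      ≤⟨ +-mono-≤ (+-mono-≤ (length-bad _ (unique-lo P uP)) (+-mono-≤ (length-bad _ (unique-hi P uP)) (+-mono-≤ (length-bad _ (unique-lo Q uQ)) (length-bad _ (unique-hi Q uQ)))))
           (+-mono-≤ (length-badOf l (unique-++ˡ (core l) ulm)) (length-badOf m (unique-++ʳ (core l) ulm))) ⟩
    (k + (k + (k + k))) + (events l * (4 * k) + events m * (4 * k)) ≡⟨ arith k (events l) (events m) ⟩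
    suc (events l + events m) * (4 * k) ∎
    where
    open ≤-Reasoning
    uPQ = unique-++ˡ (P ++ Q) u
    uP = unique-++ˡ P uPQ
    uQ = unique-++ʳ P uPQ
    ulm = unique-++ʳ (P ++ Q) u
    arith : ∀ k a b → (k + (k + (k + k))) + (a * (4 * k) + b * (4 * k)) ≡ suc (a + b) * (4 * k)
    arith = solve-∀

  module _ (Bd : List A) where
    open Clean Bd
    open DecMembership _≟_ using (_∈?_)

    clean-split : ∀ X → Σ[ r ∈ List A ] X ↭ clean X ++ r
    clean-split [] = [] , ↭-refl
    clean-split (x ∷ X) with x ∈? Bd | clean-split X
    ... | yes _ | r , p = x ∷ r , ↭-trans (prep x p) (↭-sym (shift x (clean X) r))
    ... | no _ | r , p = r , prep x p

    halves-split : ∀ X → Σ[ r ∈ List A ] X ↭ clean (lo X) ++ clean (hi X) ++ r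
    halves-split X with clean-split (lo X) | clean-split (hi X)
    ... | r , p | r′ , p′ = r ++ r′ ,
      ↭-trans (↭-reflexive (sym (take++drop≡id (length X / 2) X))) (↭-trans (↭-++⁺ p p′)
        (solve 4 (λ a b c d → (a ⊕ b) ⊕ (c ⊕ d) ⊜ a ⊕ (c ⊕ (b ⊕ d))) ↭-refl (clean (lo X)) r (clean (hi X)) r′))

    hit-halves : ∀ X → hit X ≡ hit (lo X) + hit (hi X)
    hit-halves X = trans (cong hit (sym (take++drop≡id (length X / 2) X))) (hit-++ (lo X) (hi X))

    Sees : A → List A → Set
    Sees v C = v ∈ V × v ∉ Bd × v ∉ C × (∀ {x} → x ∈ C → red v x ≡ false)

    sees-⊑ : ∀ {v C C′} → C′ ⊑ C → Sees v C → Sees v C′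
    sees-⊑ s (a , b , c , d) = a , b , c ∘ s , d ∘ s

    Ex : List Ev → A → Set
    Ex = Exit S _≟_ blue

    hostsOf : List Ev → List A
    hostsOf = allHosts S _≟_ blue

    hostsOf-++ : ∀ xs ys → hostsOf (xs ++ ys) ≡ hostsOf xs ++ hostsOf ys
    hostsOf-++ xs ys = trans (cong concat (map-++ _ xs ys)) (sym (concat-++ (map Event.hosts xs) _))

    good-++ : ∀ xs {ys} → Good S _≟_ blue xs → Good S _≟_ blue ys → (∀ {v} → v ∈ hostsOf xs → Ex ys v) →
      Unique (hostsOf (xs ++ ys)) → Good S _≟_ blue (xs ++ ys)
    good-++ [] gx gy ex u = gy
    good-++ (e ∷ xs) {ys} (p , q , z , ue , de , gx) gy ex u =
      (λ a∈ → Allₚ.++⁺ (p a∈) (ex (∈-++⁺ˡ (∈-++⁺ˡ a∈)))) , q ,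
      (λ z∈ → Allₚ.++⁺ (z z∈) (ex (∈-++⁺ˡ (∈-++⁺ʳ (Event.P e) (∈-++⁺ʳ (Event.Q e) z∈))))) , ue ,
      unique-disj (Event.hosts e) u ,
      good-++ xs gx gy (λ v∈ → ex (∈-++⁺ʳ (Event.hosts e) v∈)) (unique-++ʳ (Event.hosts e) u)

    -- A stepping stone in front of `es`: every vertex that sees `C` has a blue edge into `Z`, and
    -- from `Z` the events can be entered. It becomes the set `Z` of the preceding event, or the
    -- host set of the root.
    record Gate (C : List A) (es : List Ev) (Z : List A) : Set where
      field
        exits : ∀ {z} → z ∈ Z → Ex es z
        some : Σ[ z ∈ A ] z ∈ Z
        into : ∀ {v} → Sees v C → 1 ≤ nb v Z

    -- zf is the place where an embedding enters the events of the plan.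
    record Plan (σ : Str A) : Set where
      field
        es : List Ev
        zf rest : List A
        perm : core σ ↭ (hostsOf es ++ zf) ++ rest
        good : Good S _≟_ blue es
        entry : ∀ {v} → Sees v (core σ) → Ex es v
        gate : es ≡ [] ⊎ Gate (core σ) es zf
        fresh : ∀ {v} → v ∈ hostsOf es ++ zf → v ∉ Bd
        bound : weight σ ≤ 8 * E * quota S _≟_ blue es + events σ * (2 * k + 8 * E) + 4 * E * hit (core σ)

      inside : hostsOf es ++ zf ⊑ core σ
      inside p = ∈-resp-↭ (↭-sym perm) (∈-++⁺ˡ p)

    -- An existing gate is kept. If no events follow, exits are vacuous and the reserve half `G`
    -- becomes the gate. The set not chosen is discarded.
    choose : ∀ {C C′ es Z G} → C ⊑ C′ → es ≡ [] ⊎ Gate C es Z → Gate C′ [] G →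
      Σ[ Z′ ∈ List A ] Σ[ r ∈ List A ] Z ++ G ↭ Z′ ++ r × Gate C′ es Z′
    choose {Z = Z} {G} s (inj₁ refl) gG = G , Z , ↭-++-comm Z G , gG
    choose {Z = Z} {G} s (inj₂ g) _ = Z , G , ↭-refl , record { exits = g.exits ; some = g.some ; into = g.into ∘ sees-⊑ s }
      where module g = Gate g

    quota-++ : ∀ xs ys → quota S _≟_ blue (xs ++ ys) ≡ quota S _≟_ blue xs + quota S _≟_ blue ys
    quota-++ xs ys = trans (cong sum (map-++ Event.q xs ys)) (sum-++ (map Event.q xs) _)

    module _ (l m : Str A) (P Q X Y W : List A) (noneXY : None red X Y) (noneQP : None red Q P)
             (P⊑X : P ⊑ X) (Q⊑Y : Q ⊑ Y) (len : length P ≡ length Q) (okl : OK red l X) (okm : OK red m Y)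
             (X⊑V : X ⊑ V) (Y⊑V : Y ⊑ V) (u : Unique (core (node l P Q m)))
             (bad⊑ : badOf (node l P Q m) ⊑ Bd) (L : Plan l) (M : Plan m) where
      private
        module L = Plan L
        module M = Plan M
        h = length P / 2
        uPQ : Unique (P ++ Q)
        uPQ = unique-++ˡ (P ++ Q) u

        left right : List A
        left = P ++ core l
        right = Q ++ core m

        left⊑ : left ⊑ X
        left⊑ p = [ P⊑X , core-⊑ okl ]′ (∈-++⁻ P p)
        right⊑ : right ⊑ Y
        right⊑ p = [ Q⊑Y , core-⊑ okm ]′ (∈-++⁻ Q p)

        left-right : Disj left right
        left-right p q with ∈-++⁻ P p | ∈-++⁻ Q q
        ... | inj₁ a | inj₁ b = unique-disj P uPQ a b
        ... | inj₁ a | inj₂ b = unique-disj (P ++ Q) u (∈-++⁺ˡ a) (∈-++⁺ʳ (core l) b)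
        ... | inj₂ a | inj₁ b = unique-disj (P ++ Q) u (∈-++⁺ʳ P b) (∈-++⁺ˡ a)
        ... | inj₂ a | inj₂ b = unique-disj (core l) (unique-++ʳ (P ++ Q) u) a b

        cross : ∀ {v} → v ∈ left → v ∉ Bd → Sees v right
        cross p v∉ = X⊑V (left⊑ p) , v∉ , left-right p , (λ q → noneXY (left⊑ p) (right⊑ q))

        P⊑core : P ⊑ core (node l P Q m)
        P⊑core p = ∈-++⁺ˡ (∈-++⁺ˡ p)
        Q⊑core : Q ⊑ core (node l P Q m)
        Q⊑core p = ∈-++⁺ˡ (∈-++⁺ʳ P p)
        l⊑core : core l ⊑ core (node l P Q m)
        l⊑core p = ∈-++⁺ʳ (P ++ Q) (∈-++⁺ˡ p)
        m⊑core : core m ⊑ core (node l P Q m)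
        m⊑core p = ∈-++⁺ʳ (P ++ Q) (∈-++⁺ʳ (core l) p)
        right⊑core : right ⊑ core (node l P Q m)
        right⊑core p = [ Q⊑core , m⊑core ]′ (∈-++⁻ Q p)

        hit-core : hit (core (node l P Q m)) ≡ (hit P + hit Q) + (hit (core l) + hit (core m))
        hit-core = trans (hit-++ (P ++ Q) _) (cong₂ _+_ (hit-++ P Q) (hit-++ (core l) _))

        uPlan : ∀ {es zf rest} → core (node l P Q m) ↭ (hostsOf es ++ zf) ++ rest → Unique (hostsOf es)
        uPlan {es} {zf} p = unique-++ˡ (hostsOf es) (unique-++ˡ (hostsOf es ++ zf) (unique-↭ p u))

      -- A small or spoilt pair yields no event, and the plans of the two sides are concatenated.
      -- The absence of red edges from `X` to `Y` gives the exits from the first plan into the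
      -- second.
      skip : length P ≤ 2 * k + 8 * E + 4 * E * (hit P + hit Q) → Plan (node l P Q m)
      skip small = record
        { es = es ; zf = zf ; rest = rest ; perm = perm
        ; good = good-++ L.es L.good M.good (λ v∈ → M.entry (sees-⊑ (∈-++⁺ʳ Q) (cross (∈-++⁺ʳ P (L.inside (∈-++⁺ˡ v∈))) (L.fresh (∈-++⁺ˡ v∈))))) (uPlan {es} {zf} perm)
        ; entry = λ s → Allₚ.++⁺ (L.entry (sees-⊑ l⊑core s)) (M.entry (sees-⊑ m⊑core s))
        ; gate = proj₂ (proj₂ (proj₂ choice))
        ; fresh = fresh
        ; bound = begin
            length P + (weight l + weight m) ≤⟨ +-mono-≤ small (+-mono-≤ L.bound M.bound) ⟩
            2 * k + 8 * E + 4 * E * (hit P + hit Q) + ((8 * E * ql + events l * (2 * k + 8 * E) + 4 * E * hit (core l)) + (8 * E * qm + events m * (2 * k + 8 * E) + 4 * E * hit (core m)))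
              ≡⟨ arith E (2 * k + 8 * E) (hit P + hit Q) ql qm (events l) (events m) (hit (core l)) (hit (core m)) ⟩
            8 * E * (ql + qm) + suc (events l + events m) * (2 * k + 8 * E) + 4 * E * ((hit P + hit Q) + (hit (core l) + hit (core m)))
              ≡⟨ cong₂ (λ a b → 8 * E * a + suc (events l + events m) * (2 * k + 8 * E) + 4 * E * b) (sym (quota-++ L.es M.es)) (sym hit-core) ⟩
            8 * E * quota S _≟_ blue es + suc (events l + events m) * (2 * k + 8 * E) + 4 * E * hit (core (node l P Q m)) ∎ }
        where
        open ≤-Reasoning
        ql = quota S _≟_ blue L.es
        qm = quota S _≟_ blue M.es
        arith : ∀ E K x a b c d e f → K + 4 * E * x + ((8 * E * a + c * K + 4 * E * e) + (8 * E * b + d * K + 4 * E * f)) ≡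
                  8 * E * (a + b) + suc (c + d) * K + 4 * E * (x + (e + f))
        arith = solve-∀
        es = L.es ++ M.es
        -- The gate of the first side that has events also serves the concatenation.
        choice : Σ[ Z ∈ List A ] Σ[ r ∈ List A ] L.zf ++ M.zf ↭ Z ++ r × (es ≡ [] ⊎ Gate (core (node l P Q m)) es Z)
        choice with L.gate | M.gate
        ... | inj₂ g | _ = L.zf , M.zf , ↭-refl , inj₂ (record
          { exits = λ z∈ → Allₚ.++⁺ (Gate.exits g z∈) (M.entry (sees-⊑ (∈-++⁺ʳ Q) (cross (∈-++⁺ʳ P (L.inside (∈-++⁺ʳ (hostsOf L.es) z∈))) (L.fresh (∈-++⁺ʳ (hostsOf L.es) z∈)))))
          ; some = Gate.some g ; into = λ s → Gate.into g (sees-⊑ l⊑core s) })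
        ... | inj₁ el | inj₂ g = M.zf , L.zf , ↭-++-comm L.zf M.zf , inj₂ (record
          { exits = λ z∈ → subst (λ z → Ex (z ++ M.es) _) (sym el) (Gate.exits g z∈)
          ; some = Gate.some g ; into = λ s → Gate.into g (sees-⊑ m⊑core s) })
        ... | inj₁ el | inj₁ em = L.zf , M.zf , ↭-refl , inj₁ (cong₂ _++_ el em)
        zf = proj₁ choice
        r = proj₁ (proj₂ choice)
        rest = r ++ L.rest ++ M.rest ++ P ++ Q
        perm : core (node l P Q m) ↭ (hostsOf es ++ zf) ++ rest
        perm = ↭-trans (↭-++⁺ˡ (P ++ Q) (↭-++⁺ L.perm M.perm)) (↭-trans
          (solve 8 (λ p q a b c d e f → (p ⊕ q) ⊕ (((a ⊕ b) ⊕ c) ⊕ ((d ⊕ e) ⊕ f)) ⊜ (b ⊕ e) ⊕ ((a ⊕ d) ⊕ (c ⊕ (f ⊕ (p ⊕ q))))) ↭-refl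
            P Q (hostsOf L.es) L.zf L.rest (hostsOf M.es) M.zf M.rest)
          (↭-trans (↭-++⁺ʳ _ (proj₁ (proj₂ (proj₂ choice))))
          (↭-trans (solve 4 (λ z r h t → (z ⊕ r) ⊕ (h ⊕ t) ⊜ (h ⊕ z) ⊕ (r ⊕ t)) ↭-refl zf r (hostsOf L.es ++ hostsOf M.es) (L.rest ++ M.rest ++ P ++ Q))
          (↭-reflexive (cong (λ z → (z ++ zf) ++ rest) (sym (hostsOf-++ L.es M.es)))))))
        fresh : ∀ {v} → v ∈ hostsOf es ++ zf → v ∉ Bd
        fresh p with ∈-++⁻ (hostsOf es) p
        ... | inj₁ a = [ L.fresh ∘ ∈-++⁺ˡ , M.fresh ∘ ∈-++⁺ˡ ]′ (∈-++⁻ (hostsOf L.es) (subst (_ ∈_) (hostsOf-++ L.es M.es) a))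
        ... | inj₂ a = [ L.fresh ∘ ∈-++⁺ʳ (hostsOf L.es) , M.fresh ∘ ∈-++⁺ʳ (hostsOf M.es) ]′
                          (∈-++⁻ L.zf (∈-resp-↭ (↭-sym (proj₁ (proj₂ (proj₂ choice)))) (∈-++⁺ˡ a)))

      -- The new event is put between the events of `l`, which lie in `X`, and those of `m`, which
      -- lie in `Y`. Its exits use that no red edge leads from `X` to `Y`; the way back from `Q` to
      -- `P` uses `noneQP`.
      use : k + 2 * E ≤ h → 2 * E * (hit P + hit Q) ≤ h → Plan (node l P Q m)
      use big clear = record
        { es = es ; zf = zf ; rest = rest ; perm = perm
        ; good = good-++ L.es L.good goodM (λ v∈ → crossExit (∈-++⁺ʳ P (L.inside (∈-++⁺ˡ v∈))) (L.fresh (∈-++⁺ˡ v∈))) uHosts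
        ; entry = λ s → Allₚ.++⁺ (L.entry (sees-⊑ l⊑core s)) (exit-right (sees-⊑ right⊑core s))
        ; gate = inj₂ (record { exits = λ z∈ → Allₚ.++⁺ (Gate.exits gateL z∈) (crossExit (zf⊑ z∈) (zf-fresh z∈)) ; some = Gate.some gateL ; into = Gate.into gateL })
        ; fresh = fresh
        ; bound = begin
            length P + (weight l + weight m) ≤⟨ +-mono-≤ heavy (+-mono-≤ L.bound M.bound) ⟩
            (8 * E * q + (2 * k + 8 * E)) + ((8 * E * ql + events l * (2 * k + 8 * E) + 4 * E * hit (core l)) + (8 * E * qm + events m * (2 * k + 8 * E) + 4 * E * hit (core m)))
              ≡⟨ arith E (2 * k + 8 * E) q ql qm (events l) (events m) (hit (core l)) (hit (core m)) ⟩
            8 * E * (ql + (q + qm)) + suc (events l + events m) * (2 * k + 8 * E) + 4 * E * (hit (core l) + hit (core m))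
              ≤⟨ +-monoʳ-≤ (8 * E * (ql + (q + qm)) + _) (*-monoʳ-≤ (4 * E) (m≤n+m _ (hit P + hit Q))) ⟩
            8 * E * (ql + (q + qm)) + suc (events l + events m) * (2 * k + 8 * E) + 4 * E * ((hit P + hit Q) + (hit (core l) + hit (core m)))
              ≡⟨ cong₂ (λ a b → 8 * E * a + suc (events l + events m) * (2 * k + 8 * E) + 4 * E * b) (sym (quota-++ L.es (e ∷ M.es))) (sym hit-core) ⟩
            8 * E * quota S _≟_ blue es + suc (events l + events m) * (2 * k + 8 * E) + 4 * E * hit (core (node l P Q m)) ∎ }
        where
        open ≤-Reasoning
        -- A cleaned half provides h/(2E) blue out-neighbours, and a vertex of `Q` must have 2`q` of
        -- them in `P`.
        q = h / (4 * E)
        ql = quota S _≟_ blue L.es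
        qm = quota S _≟_ blue M.es
        arith : ∀ E K x a b c d e f → (8 * E * x + K) + ((8 * E * a + c * K + 4 * E * e) + (8 * E * b + d * K + 4 * E * f)) ≡
                  8 * E * (a + (x + b)) + suc (c + d) * K + 4 * E * (e + f)
        arith = solve-∀
        heavy : length P ≤ 8 * E * q + (2 * k + 8 * E)
        heavy = begin
          length P ≤⟨ 2*half (length P) ⟩
          suc (h + h) ≤⟨ s≤s (+-mono-≤ h≤ h≤) ⟩
          suc ((E₄ + q * E₄) + (E₄ + q * E₄)) ≤⟨ +-monoˡ-≤ ((E₄ + q * E₄) + (E₄ + q * E₄)) (≤-trans k>0 (m≤m+n k (k + 0))) ⟩
          2 * k + ((E₄ + q * E₄) + (E₄ + q * E₄)) ≡⟨ arith′ k E q ⟩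
          8 * E * q + (2 * k + 8 * E) ∎
          where
          E₄ = 4 * E
          h≤ : h ≤ E₄ + q * E₄
          h≤ = ≤-trans (≤-reflexive (m≡m%n+[m/n]*n h (4 * E))) (+-monoˡ-≤ (q * E₄) (<⇒≤ (m%n<n h (4 * E))))
          arith′ : ∀ k E q → 2 * k + ((4 * E + q * (4 * E)) + (4 * E + q * (4 * E))) ≡ 8 * E * q + (2 * k + 8 * E)
          arith′ = solve-∀
        k≤h : k ≤ h
        k≤h = m+n≤o⇒m≤o k big
        2E≤h : 2 * E * 1 ≤ h
        2E≤h = ≤-trans (≤-reflexive (*-identityʳ (2 * E))) (m+n≤o⇒n≤o k big)
        2q : 2 * E * (2 * q) ≤ h
        2q = ≤-trans (≤-reflexive (assoc E q)) (m/n*n≤m h (4 * E))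
          where
          assoc : ∀ E q → 2 * E * (2 * q) ≡ q * (4 * E)
          assoc = solve-∀
        hQ : length Q / 2 ≡ h
        hQ = cong (_/ 2) (sym len)
        sideP : ∀ {v X′ d} → X′ ⊑ P → bad X′ ⊑ Bd → h ≤ length X′ → hit X′ ≤ hit P → v ∈ V → v ∉ Bd → v ∉ P → (∀ {x} → x ∈ P → red v x ≡ false) →
          2 * E * d ≤ h → d ≤ nb v (clean X′)
        sideP {X′ = X′} s b l≤ ht v∈ v∉ v∉P none d≤ =
          deg-blue-clean {X = X′} b k≤h l≤ (≤-trans (*-monoʳ-≤ (2 * E) (≤-trans ht (m≤m+n (hit P) (hit Q)))) clear) v∈ (v∉P ∘ s) v∉ (none ∘ s) d≤
        sideQ : ∀ {v X′ d} → X′ ⊑ Q → bad X′ ⊑ Bd → h ≤ length X′ → hit X′ ≤ hit Q → Sees v right → 2 * E * d ≤ h → d ≤ nb v (clean X′)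
        sideQ {X′ = X′} s b l≤ ht (v∈ , v∉ , v∉R , none) d≤ =
          deg-blue-clean {X = X′} b k≤h l≤ (≤-trans (*-monoʳ-≤ (2 * E) (≤-trans ht (m≤n+m (hit Q) (hit P)))) clear) v∈ (v∉R ∘ ∈-++⁺ˡ ∘ s) v∉ (none ∘ ∈-++⁺ˡ ∘ s) d≤
        badlP : bad (lo P) ⊑ Bd
        badlP p = bad⊑ (∈-++⁺ˡ (∈-++⁺ˡ p))
        badhP : bad (hi P) ⊑ Bd
        badhP p = bad⊑ (∈-++⁺ˡ (∈-++⁺ʳ (bad (lo P)) (∈-++⁺ˡ p)))
        badlQ : bad (lo Q) ⊑ Bd
        badlQ p = bad⊑ (∈-++⁺ˡ (∈-++⁺ʳ (bad (lo P)) (∈-++⁺ʳ (bad (hi P)) (∈-++⁺ˡ p))))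
        badhQ : bad (hi Q) ⊑ Bd
        badhQ p = bad⊑ (∈-++⁺ˡ (∈-++⁺ʳ (bad (lo P)) (∈-++⁺ʳ (bad (hi P)) (∈-++⁺ʳ (bad (lo Q)) p))))
        hit-lo : ∀ X → hit (lo X) ≤ hit X
        hit-lo X = ≤-trans (m≤m+n _ (hit (hi X))) (≤-reflexive (sym (hit-halves X)))
        hit-hi : ∀ X → hit (hi X) ≤ hit X
        hit-hi X = ≤-trans (m≤n+m _ (hit (lo X))) (≤-reflexive (sym (hit-halves X)))
        some-clean : ∀ X → h ≤ length X → 2 * E * hit X ≤ h → Σ[ z ∈ A ] z ∈ clean X
        some-clean X l≤ ht with clean X in eq
        ... | z ∷ _ = z , here refl
        ... | [] = contradiction (≤-trans (*-monoˡ-≤ (hit X) {2} {2 * E} (m≤m*n 2 E)) ht)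
                     (<⇒≱ (<-≤-trans (m<m+n h {h} (≤-trans k>0 k≤h)) (≤-trans (≤-reflexive (cong (h +_) (sym (+-identityʳ h)))) (*-monoʳ-≤ 2 (≤-trans l≤ (≤-reflexive lenX))))))
          where
          lenX : length X ≡ hit X
          lenX = trans (sym (length-∩-∖ _≟_ X Bd)) (trans (cong (λ z → hit X + length z) eq) (+-identityʳ _))
        clear′ : ∀ {x} → x ≤ hit P + hit Q → 2 * E * x ≤ h
        clear′ x≤ = ≤-trans (*-monoʳ-≤ (2 * E) x≤) clear
        h≤hiQ : h ≤ length (hi Q)
        h≤hiQ = subst (_≤ length (hi Q)) hQ (length-hi Q)

        gateQ : Gate right [] (clean (hi Q))
        gateQ = record
          { exits = λ _ → []
          ; some = some-clean (hi Q) h≤hiQ (clear′ (≤-trans (hit-hi Q) (m≤n+m (hit Q) (hit P))))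
          ; into = λ s → sideQ (hi⊑ Q) badhQ h≤hiQ (hit-hi Q) s 2E≤h }
        chosenM = choose {G = clean (hi Q)} (∈-++⁺ʳ Q) M.gate gateQ
        Z = proj₁ chosenM
        rM = proj₁ (proj₂ chosenM)
        permM = proj₁ (proj₂ (proj₂ chosenM))
        gateM : Gate right M.es Z
        gateM = proj₂ (proj₂ (proj₂ chosenM))

        gateP : Gate (core (node l P Q m)) [] (clean (hi P))
        gateP = record
          { exits = λ _ → []
          ; some = some-clean (hi P) (length-hi P) (clear′ (≤-trans (hit-hi P) (m≤m+n (hit P) (hit Q))))
          ; into = λ (v∈ , v∉ , v∉C , none) → sideP (hi⊑ P) badhP (length-hi P) (hit-hi P) v∈ v∉ (v∉C ∘ P⊑core) (none ∘ P⊑core) 2E≤h }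
        chosenL = choose {G = clean (hi P)} l⊑core L.gate gateP
        zf = proj₁ chosenL
        rL = proj₁ (proj₂ chosenL)
        permL = proj₁ (proj₂ (proj₂ chosenL))
        gateL : Gate (core (node l P Q m)) L.es zf
        gateL = proj₂ (proj₂ (proj₂ chosenL))

        e : Ev
        e = record { P = clean (lo P) ; Q = clean (lo Q) ; Z = Z ; q = q }
        es = L.es ++ e ∷ M.es

        zf-where : ∀ {z} → z ∈ zf → z ∈ L.zf ⊎ z ∈ clean (hi P)
        zf-where z∈ = ∈-++⁻ L.zf (∈-resp-↭ (↭-sym permL) (∈-++⁺ˡ z∈))
        zf⊑ : zf ⊑ left
        zf⊑ z∈ = [ (λ a → ∈-++⁺ʳ P (L.inside (∈-++⁺ʳ (hostsOf L.es) a))) , (λ a → ∈-++⁺ˡ (hi⊑ P (clean-⊑ (hi P) a))) ]′ (zf-where z∈)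
        zf-fresh : ∀ {z} → z ∈ zf → z ∉ Bd
        zf-fresh z∈ = [ (λ a → L.fresh (∈-++⁺ʳ (hostsOf L.es) a)) , clean-good (hi P) ]′ (zf-where z∈)
        Z-where : ∀ {z} → z ∈ Z → z ∈ M.zf ⊎ z ∈ clean (hi Q)
        Z-where z∈ = ∈-++⁻ M.zf (∈-resp-↭ (↭-sym permM) (∈-++⁺ˡ z∈))
        Z-fresh : ∀ {z} → z ∈ Z → z ∉ Bd
        Z-fresh z∈ = [ (λ a → M.fresh (∈-++⁺ʳ (hostsOf M.es) a)) , clean-good (hi Q) ]′ (Z-where z∈)

        exit-right : ∀ {v} → Sees v right → Ex (e ∷ M.es) v
        exit-right s = (sideQ (lo⊑ Q) badlQ (≤-reflexive (trans (sym hQ) (sym (length-lo Q)))) (hit-lo Q) s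
                          (≤-trans (*-monoʳ-≤ (2 * E) (m≤m+n q (q + 0))) 2q) , Gate.into gateM s) ∷ M.entry (sees-⊑ (∈-++⁺ʳ Q) s)
        crossExit : ∀ {v} → v ∈ left → v ∉ Bd → Ex (e ∷ M.es) v
        crossExit p v∉ = exit-right (cross p v∉)

        splitP = halves-split P
        splitQ = halves-split Q
        rP = proj₁ splitP
        rQ = proj₁ splitQ
        rest = rL ++ rM ++ L.rest ++ M.rest ++ rP ++ rQ
        cl₁ = clean (lo P)
        cl₂ = clean (lo Q)

        perm : core (node l P Q m) ↭ (hostsOf es ++ zf) ++ rest
        perm = ↭-trans (↭-++⁺ (↭-++⁺ (proj₂ splitP) (proj₂ splitQ)) (↭-++⁺ L.perm M.perm)) (↭-trans
          (solve 12 (λ p₁ p₂ p₃ q₁ q₂ q₃ a b c d e f → ((p₁ ⊕ (p₂ ⊕ p₃)) ⊕ (q₁ ⊕ (q₂ ⊕ q₃))) ⊕ (((a ⊕ b) ⊕ c) ⊕ ((d ⊕ e) ⊕ f)) ⊜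
             (b ⊕ p₂) ⊕ ((e ⊕ q₂) ⊕ (p₁ ⊕ (q₁ ⊕ (a ⊕ (d ⊕ (c ⊕ (f ⊕ (p₃ ⊕ q₃))))))))) ↭-refl
             cl₁ (clean (hi P)) rP cl₂ (clean (hi Q)) rQ (hostsOf L.es) L.zf L.rest (hostsOf M.es) M.zf M.rest)
          (↭-trans (↭-++⁺ permL (↭-++⁺ʳ _ permM))
          (↭-trans (solve 9 (λ z r z′ r′ p₁ q₁ a d t → (z ⊕ r) ⊕ ((z′ ⊕ r′) ⊕ (p₁ ⊕ (q₁ ⊕ (a ⊕ (d ⊕ t))))) ⊜
                     ((a ⊕ ((p₁ ⊕ (q₁ ⊕ z′)) ⊕ d)) ⊕ z) ⊕ (r ⊕ (r′ ⊕ t))) ↭-refl zf rL Z rM cl₁ cl₂ (hostsOf L.es) (hostsOf M.es) (L.rest ++ M.rest ++ rP ++ rQ))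
          (↭-reflexive (cong (λ z → (z ++ zf) ++ rest) (sym (hostsOf-++ L.es (e ∷ M.es))))))))

        uHosts : Unique (hostsOf es)
        uHosts = uPlan {es} {zf} perm
        uHosts′ : Unique (hostsOf (e ∷ M.es))
        uHosts′ = unique-++ʳ (hostsOf L.es) (subst Unique (hostsOf-++ L.es (e ∷ M.es)) uHosts)

        goodM : Good S _≟_ blue (e ∷ M.es)
        goodM =
          (λ a∈ → crossExit (∈-++⁺ˡ (lo⊑ P (clean-⊑ (lo P) a∈))) (clean-good (lo P) a∈)) ,
          (λ b∈ → sideP (lo⊑ P) badlP (≤-reflexive (sym (length-lo P))) (hit-lo P) (Y⊑V (Q⊑Y (lo⊑ Q (clean-⊑ (lo Q) b∈)))) (clean-good (lo Q) b∈)
                    (λ p → unique-disj P uPQ p (lo⊑ Q (clean-⊑ (lo Q) b∈))) (λ p → noneQP (lo⊑ Q (clean-⊑ (lo Q) b∈)) p) 2q) ,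
          Gate.exits gateM ,
          unique-++ˡ (Event.hosts e) uHosts′ , unique-disj (Event.hosts e) uHosts′ , M.good

        fresh : ∀ {v} → v ∈ hostsOf es ++ zf → v ∉ Bd
        fresh p with ∈-++⁻ (hostsOf es) p
        ... | inj₂ a = zf-fresh a
        ... | inj₁ a with ∈-++⁻ (hostsOf L.es) (subst (_ ∈_) (hostsOf-++ L.es (e ∷ M.es)) a)
        ... | inj₁ b = L.fresh (∈-++⁺ˡ b)
        ... | inj₂ b with ∈-++⁻ (Event.hosts e) b
        ... | inj₂ c = M.fresh (∈-++⁺ˡ c)
        ... | inj₁ c with ∈-++⁻ cl₁ c
        ... | inj₁ d = clean-good (lo P) d
        ... | inj₂ d = [ clean-good (lo Q) , Z-fresh ]′ (∈-++⁻ cl₂ d)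

      -- If the halves are too small, the size of `P` is charged to the term 2`k` + 8`E` of the node
      -- in `bound`; if too many of the vertices are exceptional, it is charged to these. A used
      -- pair contributes a quota of about 1/(8`E`) of the size of `P`.
      node-plan : Plan (node l P Q m)
      node-plan with k + 2 * E ≤? h | 2 * E * (hit P + hit Q) ≤? h
      ... | yes a | yes b = use a b
      ... | no a | _ = skip (≤-trans (2*half (length P)) (≤-trans (s≤s (+-mono-≤ (≤-refl {h}) (n≤1+n h)))
              (≤-trans (+-mono-≤ (≰⇒> a) (≰⇒> a)) (≤-trans (arith k E) (m≤m+n _ _)))))
        where
        arith : ∀ k E → (k + 2 * E) + (k + 2 * E) ≤ 2 * k + 8 * E
        arith k E = ≤-trans (≤-reflexive (eq k E)) (+-monoʳ-≤ (2 * k) (*-monoˡ-≤ E {4} {8} (s≤s (s≤s (s≤s (s≤s z≤n))))))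
          where
          eq : ∀ k E → (k + 2 * E) + (k + 2 * E) ≡ 2 * k + 4 * E
          eq = solve-∀
      ... | yes _ | no b = skip (≤-trans (2*half (length P)) (≤-trans (s≤s (+-mono-≤ (≤-refl {h}) (n≤1+n h)))
              (≤-trans (+-mono-≤ (≰⇒> b) (≰⇒> b)) (≤-trans (≤-reflexive (arith E (hit P + hit Q))) (m≤n+m (4 * E * (hit P + hit Q)) (2 * k + 8 * E))))))
        where
        arith : ∀ E x → 2 * E * x + 2 * E * x ≡ 4 * E * x
        arith = solve-∀

    plan : ∀ σ {W} → OK red σ W → W ⊑ V → Unique (core σ) → badOf σ ⊑ Bd → Plan σ
    plan leaf _ _ _ _ = record
      { es = [] ; zf = [] ; rest = [] ; perm = ↭-refl ; good = tt ; entry = λ _ → [] ; gate = inj₁ refl ; fresh = λ ()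
      ; bound = z≤n }
    plan (node l P Q m) {W} (node X Y nXY nQP p q len ol om x y) W⊑ u b =
      node-plan l m P Q X Y W nXY nQP p q len ol om (W⊑ ∘ x) (W⊑ ∘ y) u b
        (plan l ol (W⊑ ∘ x) (unique-++ˡ (core l) ulm) (λ z → b (∈-++⁺ʳ bs (∈-++⁺ˡ z))))
        (plan m om (W⊑ ∘ y) (unique-++ʳ (core l) ulm) (λ z → b (∈-++⁺ʳ bs (∈-++⁺ʳ (badOf l) z))))
      where
      ulm = unique-++ʳ (P ++ Q) u
      bs = bad (lo P) ++ bad (hi P) ++ bad (lo Q) ++ bad (hi Q)

  abstract
    -- The price of one pair: 2`k` + 8`E` is lost at its node, and each of its four halves has at
    -- most `k` exceptional vertices, each costing 4`E`.
    K : ℕ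
    K = 2 * k + 8 * E + 16 * E * k

    K≡ : K ≡ 2 * k + 8 * E + 16 * E * k
    K≡ = refl

    k≤K : k ≤ K
    k≤K = ≤-trans (m≤m+n k _) (≤-trans (m≤m+n (2 * k) _) (m≤m+n (2 * k + 8 * E) _))

    E≤K : E ≤ K
    E≤K = ≤-trans (m≤m+n E _) (≤-trans (m≤n+m (8 * E) (2 * k)) (m≤m+n (2 * k + 8 * E) _))

  K>0 : 0 < K
  K>0 = ≤-trans k>0 k≤K

  -- The coefficient is 8`E` times 2: a unit of quota costs 8`E` vertices of weight, and a quota
  -- above 2n is required. The root goes to a vertex of the entry `zf`.
  embed-in-core : ∀ σ {W} → OK red σ W → W ⊑ V → Unique (core σ) → 16 * E * n + events σ * K < weight σ → Embedded
  embed-in-core σ ok W⊑ u heavy with plan (badOf σ) σ ok W⊑ u id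
  ... | p = go P.gate
    where
    module P = Plan p
    open Clean (badOf σ)
    q = quota S _≟_ blue P.es
    hit≤ : hit (core σ) ≤ events σ * (4 * k)
    hit≤ = ≤-trans (hit-≤ u) (length-badOf σ u)
    enough : n + n < q
    enough = ≰⇒> λ q≤ → <-irrefl refl (begin-strict
      16 * E * n + events σ * K <⟨ heavy ⟩
      weight σ ≤⟨ P.bound ⟩
      8 * E * q + events σ * (2 * k + 8 * E) + 4 * E * hit (core σ)
        ≤⟨ +-mono-≤ (+-monoˡ-≤ _ (*-monoʳ-≤ (8 * E) q≤)) (*-monoʳ-≤ (4 * E) hit≤) ⟩
      8 * E * (n + n) + events σ * (2 * k + 8 * E) + 4 * E * (events σ * (4 * k)) ≡⟨ trans (arith E n k (events σ)) (cong (λ z → 16 * E * n + events σ * z) (sym K≡)) ⟩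
      16 * E * n + events σ * K ∎)
      where
      open ≤-Reasoning
      arith : ∀ E n k ν → 8 * E * (n + n) + ν * (2 * k + 8 * E) + 4 * E * (ν * (4 * k)) ≡ 16 * E * n + ν * (2 * k + 8 * E + 16 * E * k)
      arith = solve-∀
    go : P.es ≡ [] ⊎ Gate (badOf σ) (core σ) P.es P.zf → Embedded
    go (inj₁ e) = contradiction enough (<⇒≱ (subst (λ z → quota S _≟_ blue z < suc (n + n)) (sym e) (s≤s z≤n)))
    go (inj₂ g) with Gate.some g
    ... | z , z∈ = embed-in-events S _≟_ blue P.es z P.good (Gate.exits g z∈)
            (λ z∈′ → unique-disj (hostsOf (badOf σ) P.es) (unique-++ˡ (hostsOf (badOf σ) P.es ++ P.zf) (unique-↭ P.perm u)) z∈′ z∈) enough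

-- Blocks and red paths

module _ {A : Set} where

  unique-⊆ : ∀ {xs ys : List A} → xs ⊆ ys → Unique ys → Unique xs
  unique-⊆ ⊆[] u = u
  unique-⊆ (y ⊆∷ʳ s) (_ ∷ u) = unique-⊆ s u
  unique-⊆ (refl ⊆∷ s) w@(_ ∷ u) = unique-cons (λ p → ∉-unique w (sublist-∈ s p)) (unique-⊆ s u)

  concat-map-⊆ : ∀ (f : List A → List A) → (∀ p → f p ⊆ p) → ∀ ps → concat (map f ps) ⊆ concat ps
  concat-map-⊆ f h [] = ⊆[]
  concat-map-⊆ f h (p ∷ ps) = sublist-++ (h p) (concat-map-⊆ f h ps)

  concat-filterᵇ-⊆ : ∀ (f : List A → Bool) ps → concat (filterᵇ f ps) ⊆ concat ps
  concat-filterᵇ-⊆ f [] = ⊆[]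
  concat-filterᵇ-⊆ f (p ∷ ps) with f p
  ... | true = sublist-++ (⊆-refl {x = p}) (concat-filterᵇ-⊆ f ps)
  ... | false = sublist-++ˡ p (concat-filterᵇ-⊆ f ps)

  length-concat : ∀ d (ps : List (List A)) → All (λ p → length p ≡ d) ps → length (concat ps) ≡ length ps * d
  length-concat d [] [] = refl
  length-concat d (p ∷ ps) (e ∷ es) = trans (length-++ p) (cong₂ _+_ e (length-concat d ps es))

  length-concat-map : ∀ d (f : List A → List A) ps → (∀ {p} → p ∈ ps → length (f p) ≡ d) → length (concat (map f ps)) ≡ length ps * d
  length-concat-map d f [] h = refl
  length-concat-map d f (p ∷ ps) h = trans (length-++ (f p)) (cong₂ _+_ (h (here refl)) (length-concat-map d f ps (h ∘ there)))

  module _ (r : A → A → Bool) (s : ℕ) where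

    record Grouping (hs : List (List A)) : Set where
      field
        cur : List A
        Ds : List (List A)
        eq : concat hs ≡ cur ++ concat Ds
        small : length cur < s
        sizes : All (λ D → s ≤ length D × length D ≤ s + s) Ds
        sep : AllPairs (None r) (cur ∷ Ds)

    sep-++ : ∀ {h hs cur Ds} → concat hs ≡ cur ++ concat Ds → All (None r h) hs → AllPairs (None r) (cur ∷ Ds) → AllPairs (None r) ((h ++ cur) ∷ Ds)
    sep-++ {h} {hs} {cur} {Ds} eq n (a ∷ p) =
      All.tabulate (λ D∈ x y → [ (λ x∈ → outside x∈ D∈ y) , (λ x∈ → All.lookup a D∈ x∈ y) ]′ (∈-++⁻ h x)) ∷ p
      where
      outside : ∀ {x y D} → x ∈ h → D ∈ Ds → y ∈ D → r x y ≡ false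
      outside x∈ D∈ y∈ with ∈-concat⁻′ hs (subst (_ ∈_) (sym eq) (∈-++⁺ʳ cur (concat-⊑ D∈ y∈)))
      ... | h′ , y∈′ , h′∈ = All.lookup n h′∈ x∈ y∈′

    -- Sets are added from the right to the open block `cur` until it reaches size `s`. The last set
    -- added is smaller than `s`, so a closed block has at most 2`s` vertices. Blocks are made of
    -- consecutive sets, so the separation is inherited.
    group : ∀ hs → 0 < s → All (λ h → length h < s) hs → AllPairs (None r) hs → Grouping hs
    group [] s>0 _ _ = record { cur = [] ; Ds = [] ; eq = refl ; small = s>0 ; sizes = [] ; sep = [] ∷ [] }
    group (h ∷ hs) s>0 (h< ∷ hs<) (none ∷ nones) with group hs s>0 hs< nones
    ... | G with length (h ++ Grouping.cur G) <? s
    ... | yes lt = record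
      { cur = h ++ G.cur ; Ds = G.Ds ; eq = trans (cong (h ++_) G.eq) (sym (++-assoc h G.cur _)) ; small = lt ; sizes = G.sizes
      ; sep = sep-++ G.eq none G.sep }
      where module G = Grouping G
    ... | no ge = record
      { cur = [] ; Ds = (h ++ G.cur) ∷ G.Ds ; eq = trans (cong (h ++_) G.eq) (sym (++-assoc h G.cur _)) ; small = s>0
      ; sizes = (≮⇒≥ ge , ≤-trans (≤-reflexive (length-++ h)) (+-mono-≤ (<⇒≤ h<) (<⇒≤ G.small))) ∷ G.sizes
      ; sep = All.tabulate (λ _ ()) ∷ sep-++ G.eq none G.sep }
      where module G = Grouping G

    grouping-size : ∀ {hs} (G : Grouping hs) → length (concat hs) ≤ s + length (Grouping.Ds G) * (s + s)
    grouping-size {hs} G = begin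
      length (concat hs) ≡⟨ trans (cong length G.eq) (length-++ G.cur) ⟩
      length G.cur + length (concat G.Ds) ≤⟨ +-mono-≤ (<⇒≤ G.small) (sum-sizes G.Ds G.sizes) ⟩
      s + length G.Ds * (s + s) ∎
      where
      module G = Grouping G
      open ≤-Reasoning
      sum-sizes : ∀ Ds → All (λ D → s ≤ length D × length D ≤ s + s) Ds → length (concat Ds) ≤ length Ds * (s + s)
      sum-sizes [] [] = z≤n
      sum-sizes (D ∷ Ds) ((_ , h) ∷ a) = ≤-trans (≤-reflexive (length-++ D)) (+-mono-≤ h (sum-sizes Ds a))

  -- Linking red blocks

  module PathStack (r : A → A → Bool) (ℓ β : ℕ) (ℓ>0 : 0 < ℓ) (β>0 : 0 < β) where

    first last : List A → List A
    first p = take ℓ p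
    last p = drop (ℓ + ℓ) p

    -- Trails enter a run in its first third and end in its last third. Whatever the exact places,
    -- they cross the middle third and thus gain `ℓ` vertices.
    Run : List A → Set
    Run = IsPath r (ℓ + (ℓ + ℓ))

    -- Trails are stored with the final vertex in front.
    Trail : ℕ → List A → A → Set
    Trail c B x = Σ[ q ∈ List A ] Unique (x ∷ q) × Linked (λ a b → r b a ≡ true) (x ∷ q) × x ∷ q ⊑ B × c ≤ length (x ∷ q)

    segment : ∀ {p y x} → Run p → y ∈ first p → x ∈ last p →
      Σ[ q ∈ List A ] Unique ((x ∷ q) ++ [ y ]) × Linked (λ a b → r b a ≡ true) ((x ∷ q) ++ [ y ]) ×
        (x ∷ q) ++ [ y ] ⊑ p × ℓ ≤ length (x ∷ q)
    segment {p} {y} {x} (len , u , lk) y∈ x∈ with ∈-∃++ y∈ | ∈-∃++ x∈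
    ... | f₁ , f₂ , e₁ | l₁ , l₂ , e₂ = reverse s ,
        subst Unique (sym flip) (unique-↭ (↭-sym (↭-reverse ((y ∷ s) ++ [ x ]))) (unique-++ˡ ((y ∷ s) ++ [ x ]) (subst Unique (sym (++-assoc (y ∷ s) [ x ] l₂)) (unique-++ʳ f₁ (subst Unique p≡ u))))) ,
        subst (Linked _) (sym flip) (linked-reverse (linked-prefix (y ∷ s) (linked-suffix f₁ (subst (Linked _) p≡ lk)))) ,
        (λ {v} z → inp (∈-resp-↭ (↭-reverse ((y ∷ s) ++ [ x ])) (subst (v ∈_) flip z))) ,
        m≤n⇒m≤1+n (≤-trans (≤-reflexive (sym lenm)) (≤-trans (≤-trans (m≤m+n (length mid) (length l₁)) (≤-reflexive (sym (length-++ mid))))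
          (≤-trans (m≤n+m (length (mid ++ l₁)) (length f₂)) (≤-reflexive (trans (sym (length-++ f₂)) (sym (length-reverse s)))))))
      where
      mid = take ℓ (drop ℓ p)
      s = f₂ ++ mid ++ l₁
      p-thirds : p ≡ first p ++ mid ++ last p
      p-thirds = trans (sym (take++drop≡id ℓ p)) (cong (first p ++_) (trans (sym (take++drop≡id ℓ (drop ℓ p))) (cong (mid ++_) (trans (drop-drop ℓ ℓ p) refl))))
      p≡ : p ≡ f₁ ++ (y ∷ s) ++ x ∷ l₂
      p≡ = trans p-thirds (trans (cong₂ (λ a b → a ++ mid ++ b) e₁ e₂)
             (trans (++-assoc f₁ (y ∷ f₂) _) (cong (λ z → f₁ ++ y ∷ z) (trans (cong (f₂ ++_) (sym (++-assoc mid l₁ (x ∷ l₂)))) (sym (++-assoc f₂ (mid ++ l₁) _))))))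
      lenm : length mid ≡ ℓ
      lenm = length-take-≤ ℓ (drop ℓ p) (≤-trans (≤-trans (m≤m+n ℓ ℓ) (≤-reflexive (sym (m+n∸m≡n ℓ (ℓ + ℓ))))) (≤-reflexive (trans (cong (_∸ ℓ) (sym len)) (sym (length-drop ℓ p)))))
      flip : (x ∷ reverse s) ++ [ y ] ≡ reverse ((y ∷ s) ++ [ x ])
      flip = sym (trans (reverse-++ (y ∷ s) [ x ]) (cong (x ∷_) (unfold-reverse y s)))
      inp : (y ∷ s) ++ [ x ] ⊑ p
      inp {v} z = subst (v ∈_) (sym p≡) (∈-++⁺ʳ f₁ (subst (v ∈_) (++-assoc (y ∷ s) [ x ] l₂) (∈-++⁺ˡ z)))

    trail-start : ∀ {p x B} → p ⊑ B → Run p → x ∈ last p → Trail (1 * ℓ) B x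
    trail-start {p} p⊑ run x∈ with first p in eq
    ... | [] = contradiction (trans (cong length (sym eq)) (length-take-≤ ℓ p (subst (ℓ ≤_) (sym (proj₁ run)) (m≤m+n ℓ _)))) (<⇒≢ ℓ>0)
    ... | y ∷ _ with segment {p} {y} run (subst (y ∈_) (sym eq) (here refl)) x∈
    ... | q , u , lk , s , l = q ++ [ y ] , u , lk , p⊑ ∘ s ,
            ≤-trans (≤-reflexive (*-identityˡ ℓ)) (≤-trans l (s≤s (≤-trans (m≤m+n (length q) 1) (≤-reflexive (sym (length-++ q))))))

    trail-step : ∀ {p x y z B B′ d} → B ⊑ B′ → p ⊑ B′ → Disj p B → Run p → Trail (d * ℓ) B z → r z y ≡ true →
      y ∈ first p → x ∈ last p → Trail (suc d * ℓ) B′ x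
    trail-step {p} {x} {y} {z} B⊑ p⊑ dis run (q′ , u′ , lk′ , s′ , l′) e y∈ x∈ with segment run y∈ x∈
    ... | q , u , lk , s , l = q ++ [ y ] ++ z ∷ q′ ,
            subst Unique (++-assoc (x ∷ q) [ y ] (z ∷ q′)) (unique-++ u u′ (λ a b → dis (s a) (s′ b))) ,
            subst (Linked _) (++-assoc (x ∷ q) [ y ] (z ∷ q′)) (linked-join (x ∷ q) lk e lk′) ,
            (λ {v} a → [ p⊑ ∘ s , B⊑ ∘ s′ ]′ (∈-++⁻ ((x ∷ q) ++ [ y ]) (subst (v ∈_) (sym (++-assoc (x ∷ q) [ y ] (z ∷ q′))) a))) ,
            ≤-trans (+-mono-≤ l (m≤n⇒m≤1+n l′)) (≤-reflexive (sym (length-++ (x ∷ q))))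

    -- At each level all vertices in the last thirds of the runs, at least β in total, are ends of
    -- trails of the length belonging to the level. Many ends are kept so that a failure to continue
    -- gives a large pair. The trails of a level do not involve the levels above it, so the top
    -- level can be given up.
    data Stack (B : List A) : ℕ → Set where
      empty : Stack B 0
      push : ∀ {d} (ps : List (List A)) → All Run ps → concat ps ⊑ B → 3 * β ≤ length (concat ps) →
             (∀ {p x} → p ∈ ps → x ∈ last p → Trail (suc d * ℓ) B x) → Stack B d → Stack B (suc d)

    stacked : ∀ {B d} → Stack B d → List A
    stacked empty = []
    stacked (push ps _ _ _ _ st) = concat ps ++ stacked st

    weaken : ∀ {B B′ d} → B ⊑ B′ → Stack B d → Stack B′ d
    weaken s empty = empty
    weaken s (push ps a b c t st) = push ps a (s ∘ b) c (λ p x → let (q , u , l , w , n) = t p x in q , u , l , s ∘ w , n) (weaken s st)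

    stacked-weaken : ∀ {B B′ d} (s : B ⊑ B′) (st : Stack B d) → stacked (weaken s st) ≡ stacked st
    stacked-weaken s empty = refl
    stacked-weaken s (push ps a b c t st) = cong (concat ps ++_) (stacked-weaken s st)

    stacked-⊑ : ∀ {B d} (st : Stack B d) → stacked st ⊑ B
    stacked-⊑ (push ps a b c t st) p = [ b , stacked-⊑ st ]′ (∈-++⁻ (concat ps) p)

    RedBlock : List (List A) → Set
    RedBlock ps = All Run ps × 6 * β ≤ length (concat ps)

    -- A block either raises the depth by one, or lowers it by one and creates a pair. Hence twice
    -- the number of pairs plus the depth is the number of blocks absorbed.
    record State (B : List A) (c : ℕ) : Set where
      field
        {d} : ℕ
        st : Stack B d
        σ : Str A
        ok : OK r σ B
        uniq : Unique (stacked st ++ core σ)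
        heavy : weight σ ≡ events σ * β
        tally : events σ + events σ + d ≡ c

    length-runs : ∀ ps → All Run ps → length (concat ps) ≡ length ps * (ℓ + (ℓ + ℓ))
    length-runs ps a = length-concat _ ps (All.map proj₁ a)

    third-size : ∀ f ps → 3 * β ≤ length (concat ps) → All Run ps → (∀ {p} → p ∈ ps → length (f p) ≡ ℓ) → β ≤ length (concat (map f ps))
    third-size f ps h a e = *-cancelˡ-≤ 3 (≤-trans h (≤-reflexive (trans (length-runs ps a) (trans (arith (length ps) ℓ) (cong (3 *_) (sym (length-concat-map ℓ f ps e)))))))
      where
      arith : ∀ a l → a * (l + (l + l)) ≡ 3 * (a * l)
      arith = solve-∀

    length-first : ∀ {p} → Run p → length (first p) ≡ ℓ
    length-first {p} (e , _) = length-take-≤ ℓ p (subst (ℓ ≤_) (sym e) (m≤m+n ℓ _))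

    length-last : ∀ {p} → Run p → length (last p) ≡ ℓ
    length-last {p} (e , _) = trans (length-drop (ℓ + ℓ) p) (trans (cong (_∸ (ℓ + ℓ)) (trans e (sym (+-assoc ℓ ℓ ℓ)))) (m+n∸m≡n (ℓ + ℓ) ℓ))

    all-filterᵇ : ∀ {P : List A → Set} (f : List A → Bool) {ps} → All P ps → All P (filterᵇ f ps)
    all-filterᵇ f {ps} a = All.tabulate λ p∈ → All.lookup a (proj₁ (∈-filterᵇ⁻ f {xs = ps} p∈))

    half : ∀ (f : List A → Bool) ps → RedBlock ps → 3 * β ≤ length (concat (filterᵇ f ps)) ⊎ 3 * β ≤ length (concat (filterᵇ (not ∘ f) ps))
    half f ps (a , h) with 3 * β ≤? length (concat (filterᵇ f ps)) | 3 * β ≤? length (concat (filterᵇ (not ∘ f) ps))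
    ... | yes p | _ = inj₁ p
    ... | no _ | yes q = inj₂ q
    ... | no p | no q = contradiction (+-mono-< (≰⇒> p) (≰⇒> q)) (≤⇒≯ (≤-trans (≤-reflexive (arith β)) (≤-trans h (≤-reflexive
            (trans (length-runs ps a) (trans (cong (_* (ℓ + (ℓ + ℓ))) (sym (length-filterᵇ-not f ps))) (trans (*-distribʳ-+ _ (length (filterᵇ f ps)) _)
              (cong₂ _+_ (sym (length-runs _ (all-filterᵇ f a))) (sym (length-runs _ (all-filterᵇ (not ∘ f) a)))))))))))
      where
      arith : ∀ β → 3 * β + 3 * β ≡ 6 * β
      arith = solve-∀

    -- The new block stands to the left of `B`, so trails continue from `B` into it. A run is hit if
    -- its first third receives a red edge from a last third of the top level. If the hit runs
    -- contain half of the required vertices, they form a new level. Otherwise the first thirds of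
    -- the other runs and the last thirds of the top level have no red edges in either direction; β
    -- vertices of each form a pair, at the price of the top level.
    absorb : ∀ ps {B c} → RedBlock ps → Unique (concat ps) → Disj (concat ps) B → None r (concat ps) B → State B c → State (concat ps ++ B) (suc c)
    absorb ps {B} {c} red@(runs , big) u dis none record { st = empty ; σ = σ ; ok = ok ; uniq = uniq ; heavy = heavy ; tally = tally } = record
      { st = push ps runs ∈-++⁺ˡ (≤-trans (*-monoˡ-≤ β {3} {6} (s≤s (s≤s (s≤s z≤n)))) big)
               (λ p∈ x∈ → trail-start (∈-++⁺ˡ ∘ concat-⊑ p∈) (All.lookup runs p∈) x∈) empty
      ; σ = σ ; ok = OK-mono r (∈-++⁺ʳ (concat ps)) ok
      ; uniq = unique-++ (subst Unique (sym (++-identityʳ _)) u) uniq (λ a b → dis (subst (_ ∈_) (++-identityʳ _) a) (core-⊑ ok b))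
      ; heavy = heavy ; tally = trans (+-suc _ 0) (cong suc tally) }
    absorb ps {B} {c} red@(runs , big) u dis none record { d = suc d ; st = full@(push rs runsR rs⊑ bigR trail st) ; σ = σ ; ok = ok ; uniq = uniq ; heavy = heavy ; tally = tally }
      = go (half hit ps red)
      where
      Y = concat (map last rs)
      hit : List A → Bool
      hit q with find₂? r Y (first q)
      ... | inj₁ _ = true
      ... | inj₂ _ = false
      hit-true : ∀ q → hit q ≡ true → Σ[ z ∈ A ] Σ[ y ∈ A ] z ∈ Y × y ∈ first q × r z y ≡ true
      hit-true q e with find₂? r Y (first q)
      ... | inj₁ w = w
      hit-true q () | inj₂ _
      hit-false : ∀ q → not (hit q) ≡ true → ∀ {x y} → x ∈ Y → y ∈ first q → r x y ≡ false
      hit-false q e with find₂? r Y (first q)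
      hit-false q () | inj₁ w
      ... | inj₂ w = w
      B⊑ : B ⊑ concat ps ++ B
      B⊑ = ∈-++⁺ʳ (concat ps)
      go : 3 * β ≤ length (concat (filterᵇ hit ps)) ⊎ 3 * β ≤ length (concat (filterᵇ (not ∘ hit) ps)) → State (concat ps ++ B) (suc c)
      go (inj₁ h) = record
        { st = push (filterᵇ hit ps) (all-filterᵇ hit runs) (λ z → ∈-++⁺ˡ (sublist-∈ (concat-filterᵇ-⊆ hit ps) z)) h trail′ (weaken B⊑ full)
        ; σ = σ ; ok = OK-mono r B⊑ ok
        ; uniq = subst Unique (sym (++-assoc (concat (filterᵇ hit ps)) (stacked (weaken B⊑ full)) _))
            (unique-++ (unique-⊆ (concat-filterᵇ-⊆ hit ps) u) (subst (λ z → Unique (z ++ core σ)) (sym (stacked-weaken B⊑ full)) uniq)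
              (λ a b → dis (sublist-∈ (concat-filterᵇ-⊆ hit ps) a) ([ (λ w → stacked-⊑ full (subst (_ ∈_) (stacked-weaken B⊑ full) w)) , core-⊑ ok ]′ (∈-++⁻ (stacked (weaken B⊑ full)) b))))
        ; heavy = heavy ; tally = trans (+-suc _ (suc d)) (cong suc tally) }
        where
        trail′ : ∀ {p x} → p ∈ filterᵇ hit ps → x ∈ last p → Trail (suc (suc d) * ℓ) (concat ps ++ B) x
        trail′ {p} p∈ x∈ with ∈-filterᵇ⁻ hit {xs = ps} p∈
        ... | p∈ps , e with hit-true p e
        ... | z , y , z∈ , y∈ , rzy with ∈-concat⁻′ (map last rs) z∈
        ... | l , z∈l , l∈ with ∈-map⁻ last l∈
        ... | q , q∈ , refl = trail-step {d = suc d} B⊑ (∈-++⁺ˡ ∘ concat-⊑ p∈ps) (dis ∘ concat-⊑ p∈ps) (All.lookup runs p∈ps) (trail q∈ z∈l) rzy y∈ x∈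
      go (inj₂ h) = record
        { st = weaken B⊑ st ; σ = node leaf P Q σ
        ; ok = node (concat ps) B none noneQP P⊑ Q⊑ (trans lenP (sym lenQ)) leaf ok ∈-++⁺ˡ B⊑
        ; uniq = subst (λ z → Unique (z ++ (P ++ Q) ++ core σ)) (sym (stacked-weaken B⊑ st)) uniq′
        ; heavy = cong₂ _+_ lenP heavy
        ; tally = trans (arith (events σ) d) (cong suc tally) }
        where
        arith : ∀ p d → suc p + suc p + d ≡ suc (p + p + suc d)
        arith = solve-∀
        non = filterᵇ (not ∘ hit) ps
        Fs = concat (map first non)
        P = take β Fs
        Q = take β Y
        lenP : length P ≡ β
        lenP = length-take-≤ β Fs (third-size first non h (all-filterᵇ (not ∘ hit) runs) (λ p∈ → length-first (All.lookup (all-filterᵇ (not ∘ hit) runs) p∈)))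
        lenQ : length Q ≡ β
        lenQ = length-take-≤ β Y (third-size last rs bigR runsR (λ p∈ → length-last (All.lookup runsR p∈)))
        P⊆ : P ⊆ concat ps
        P⊆ = ⊆-trans (Sublistₚ.take-⊆ β Fs) (⊆-trans (concat-map-⊆ first (Sublistₚ.take-⊆ ℓ) non) (concat-filterᵇ-⊆ (not ∘ hit) ps))
        Q⊆ : Q ⊆ concat rs
        Q⊆ = ⊆-trans (Sublistₚ.take-⊆ β Y) (concat-map-⊆ last (Sublistₚ.drop-⊆ (ℓ + ℓ)) rs)
        P⊑ : P ⊑ concat ps
        P⊑ = sublist-∈ P⊆
        Q⊑ : Q ⊑ B
        Q⊑ = rs⊑ ∘ sublist-∈ Q⊆
        noneQP : None r Q P
        noneQP q∈ p∈ with ∈-concat⁻′ (map first non) (take-⊑ β p∈)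
        ... | f , y∈ , f∈ with ∈-map⁻ first f∈
        ... | p , p∈′ , refl = hit-false p (proj₂ (∈-filterᵇ⁻ (not ∘ hit) {xs = ps} p∈′)) (take-⊑ β q∈) y∈
        rest⊑ : stacked st ++ Q ++ core σ ⊑ B
        rest⊑ z = [ stacked-⊑ st , (λ w → [ Q⊑ , core-⊑ ok ]′ (∈-++⁻ Q w)) ]′ (∈-++⁻ (stacked st) z)
        move : ∀ (a b c : List A) → (a ++ b) ++ c ↭ b ++ a ++ c
        move a b c = ↭-trans (↭-++⁺ʳ c (↭-++-comm a b)) (↭-reflexive (++-assoc b a c))
        uniq′ : Unique (stacked st ++ (P ++ Q) ++ core σ)
        uniq′ = unique-↭ (↭-trans (↭-++-comm P _) (↭-trans (↭-reflexive (++-assoc (stacked st) (Q ++ core σ) P)) (↭-++⁺ˡ (stacked st)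
                   (↭-trans (↭-++-comm (Q ++ core σ) P) (↭-reflexive (sym (++-assoc P Q (core σ))))))))
                 (unique-++ (unique-⊆ P⊆ u) (unique-↭ (move Q (stacked st) (core σ)) (unique-⊆ (sublist-++ (sublist-++ Q⊆ (⊆-refl {x = stacked st})) (⊆-refl {x = core σ})) uniq))
                   (λ a b → dis (P⊑ a) (rest⊑ b)))

    run-stack : ∀ Rs → All RedBlock Rs → AllPairs (None r) (map concat Rs) → Unique (concat (map concat Rs)) → State (concat (map concat Rs)) (length Rs)
    run-stack [] _ _ _ = record { st = empty ; σ = leaf ; ok = leaf ; uniq = [] ; heavy = refl ; tally = refl }
    run-stack (ps ∷ Rs) (red ∷ reds) (none ∷ nones) u =
      absorb ps red (unique-++ˡ (concat ps) u) (unique-disj (concat ps) u)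
        (λ a b → let (D , y∈ , D∈) = ∈-concat⁻′ (map concat Rs) b in All.lookup none D∈ a y∈)
        (run-stack Rs reds nones (unique-++ʳ (concat ps) u))

    stack-path : ∀ {B d} → Stack B (suc d) → Σ[ p ∈ List A ] p ⊑ B × Unique p × Linked (λ x y → r x y ≡ true) p × suc d * ℓ ≤ length p
    stack-path (push [] _ _ big _ _) = contradiction big (<⇒≱ (≤-trans β>0 (m≤m+n β _)))
    stack-path (push (p ∷ ps) (run ∷ _) p⊑ big trail st) with last p in eq
    ... | [] = contradiction (trans (cong length (sym eq)) (length-last run)) (<⇒≢ ℓ>0)
    ... | x ∷ _ with trail (here refl) (subst (x ∈_) (sym eq) (here refl))
    ... | q , u , lk , s , l = reverse (x ∷ q) , (λ z → s (∈-resp-↭ (↭-reverse _) z)) , unique-↭ (↭-sym (↭-reverse _)) u ,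
            linked-reverse lk , ≤-trans l (≤-reflexive (sym (length-reverse (x ∷ q))))

RedPath : {A : Set} → (A → A → Bool) → ℕ → List A → Set
RedPath {A} r m W = Σ[ p ∈ List A ] IsPath r m p × p ⊑ W

red-path-⊑ : {A B : Set} {r : A → A → Bool} → ∀ {m X Y} → X ⊑ Y → RedPath r m X ⊎ B → RedPath r m Y ⊎ B
red-path-⊑ s (inj₁ (p , a , b)) = inj₁ (p , a , s ∘ b)
red-path-⊑ s (inj₂ e) = inj₂ e

red-path-take : {A : Set} {r : A → A → Bool} → ∀ {m p W} → Unique p → Linked (λ x y → r x y ≡ true) p → p ⊑ W → m ≤ length p → RedPath r m W
red-path-take {m = m} {p} u lk s h = take m p , (length-take-≤ m p h , Uniqueₚ.take⁺ m u , linked-take m lk) , s ∘ take-⊑ m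

-- Many small subtrees

module Hanging {A : Set} (𝒢 : Coloured A) (V : List A) (uV : Unique V) {n : ℕ} (S : OutTree n) where
  open Coloured 𝒢
  open Density 𝒢 V uV
  open EventPlan 𝒢 V uV S using (embed-in-core; K; K>0)
  open Embedding S _≟_ blue using (Embedded; nb)
  open DecMembership _≟_ using (_∈?_)
  open GallaiMilgram _≟_ red irr using (extract)

  blue-complete : ∀ {x y} → x ≢ y → red x y ≡ false → red y x ≡ false → blue x y ≡ true ⊎ blue y x ≡ true
  blue-complete x≢y p q with total x≢y
  ... | inj₁ e = inj₁ (blue-rest e p)
  ... | inj₂ e = inj₂ (blue-rest e q)

  module _ (ℓ β n₀ : ℕ) (ℓ>0 : 0 < ℓ) (β>0 : 0 < β)
           (short : (ℓ + (ℓ + ℓ)) * (suc n₀ + suc n₀) ≤ 12 * β) (k≤ : k ≤ 3 * β) (En≤ : E * suc n₀ ≤ 3 * β) where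
    open PathStack red ℓ β ℓ>0 β>0

    Blk : Set
    Blk = Block S _≟_ blue (suc n₀)

    U′ : List Blk → List A
    U′ = allU S _≟_ blue

    badF : List Blk → List A
    badF es = concat (map (bad ∘ Block.F) es)

    record Classified (Ds : List (List A)) : Set where
      field
        es : List Blk
        Rs : List (List (List A))
        skips : ℕ
        -- vertices of skipped sets lying in the bad sets of later blocks, which bounds the number of skips
        wit : List A
        tally : length es + length Rs + skips ≡ length Ds
        forward : Forward S _≟_ blue es
        es⊑ : U′ es ⊑ concat Ds
        big : All (λ e → 3 * β ≤ length (Block.F e)) es
        reds : All RedBlock Rs
        Rs⊑ : concat (map concat Rs) ⊑ concat Ds
        uniqR : Unique (concat (map concat Rs))
        sepR : AllPairs (None red) (map concat Rs)
        uniqW : Unique wit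
        wit⊑ : wit ⊑ badF es
        wit⊑Ds : wit ⊑ concat Ds
        sizeW : skips * (24 * β) ≤ length wit

    -- The blue paths are twice as long as needed: from any vertex of the first half at least
    -- `suc n₀` vertices remain.
    make-block : ∀ bs → All (IsPath blue (suc n₀ + suc n₀)) bs → Unique (concat bs) → 6 * β ≤ length (concat bs) →
      Σ[ e ∈ Blk ] 3 * β ≤ length (Block.F e) × Block.U e ≡ concat bs
    make-block bs paths u big = record
      { F = F ; U = concat bs ; uniqF = unique-⊆ F⊆ u ; F⊑U = sublist-∈ F⊆ ; run = run } , size , refl
      where
      F = concat (map (take (suc n₀)) bs)
      F⊆ : F ⊆ concat bs
      F⊆ = concat-map-⊆ (take (suc n₀)) (Sublistₚ.take-⊆ (suc n₀)) bs
      lenTake : ∀ {p} → p ∈ bs → length (take (suc n₀) p) ≡ suc n₀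
      lenTake {p} p∈ = length-take-≤ (suc n₀) p (≤-trans (m≤m+n (suc n₀) (suc n₀)) (≤-reflexive (sym (proj₁ (All.lookup paths p∈)))))
      size : 3 * β ≤ length F
      size = *-cancelˡ-≤ 2 (≤-trans (≤-reflexive (sym (*-assoc 2 3 β))) (≤-trans big (≤-reflexive
               (trans (length-concat _ bs (All.map proj₁ paths)) (trans (*-distribˡ-+ (length bs) (suc n₀) (suc n₀))
                 (trans (cong₂ _+_ e e) (cong (length F +_) (sym (+-identityʳ (length F))))))))))
        where
        e : length bs * suc n₀ ≡ length F
        e = sym (length-concat-map (suc n₀) (take (suc n₀)) bs lenTake)
      run : ∀ {w} → w ∈ F → Σ[ p ∈ List A ] length (w ∷ p) ≡ suc n₀ × Unique (w ∷ p) × Linked (λ x y → blue x y ≡ true) (w ∷ p) × w ∷ p ⊑ concat bs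
      run {w} w∈ with ∈-concat⁻′ (map (take (suc n₀)) bs) w∈
      ... | t , w∈t , t∈ with ∈-map⁻ (take (suc n₀)) t∈
      ... | p , p∈ , refl with ∈-∃++ w∈t | All.lookup paths p∈
      ... | t₁ , t₂ , eq | len , up , lp = take n₀ q , length-take-≤ (suc n₀) (w ∷ q) (s≤s (≤-trans (n≤1+n n₀) (≤-trans (≤-reflexive (sym lenD)) (≤-trans (m≤n+m _ (length t₂)) (≤-reflexive (sym (length-++ t₂))))))) ,
                Uniqueₚ.take⁺ (suc n₀) (unique-++ʳ t₁ (subst Unique p≡ up)) ,
                linked-take (suc n₀) (linked-suffix t₁ (subst (Linked _) p≡ lp)) ,
                (λ {v} z → concat-⊑ p∈ (subst (v ∈_) (sym p≡) (∈-++⁺ʳ t₁ (take-⊑ (suc n₀) z))))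
        where
        q = t₂ ++ drop (suc n₀) p
        p≡ : p ≡ t₁ ++ w ∷ q
        p≡ = trans (sym (take++drop≡id (suc n₀) p)) (trans (cong (_++ drop (suc n₀) p) eq) (++-assoc t₁ (w ∷ t₂) _))
        lenD : length (drop (suc n₀) p) ≡ suc n₀
        lenD = trans (length-drop (suc n₀) p) (trans (cong (_∸ suc n₀) len) (m+n∸n≡m (suc n₀) (suc n₀)))

    open-blocks : ∀ es {v} → All (λ e → 3 * β ≤ length (Block.F e)) es → v ∈ V → v ∉ badF es → v ∉ U′ es →
      (∀ {x} → x ∈ U′ es → red v x ≡ false) → Open S _≟_ blue es v
    open-blocks [] _ _ _ _ _ = []
    open-blocks (e ∷ es) {v} (b ∷ bs) v∈ v∉ v∉U none =
      *-cancelˡ-≤ E (≤-trans En≤ (≤-trans b (deg-blue {X = Block.F e} (≤-trans k≤ b) v∈ (λ z → v∉U (∈-++⁺ˡ (Block.F⊑U e z))) (λ z → v∉ (∈-++⁺ˡ z))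
        (λ z → none (∈-++⁺ˡ (Block.F⊑U e z)))))) ∷
      open-blocks es bs v∈ (λ z → v∉ (∈-++⁺ʳ (bad (Block.F e)) z)) (λ z → v∉U (∈-++⁺ʳ (Block.U e) z)) (λ z → none (∈-++⁺ʳ (Block.U e) z))

    -- Later sets are treated before `D`, so that vertices exceptional for their blue blocks can be
    -- removed from `D`. If 24β vertices remain, fewer than 12β are left outside the extracted
    -- paths, so the red or the blue paths cover 6β. Otherwise `D` is skipped, and at least 24β of
    -- its vertices are exceptional.
    classify : ∀ Ds → AllPairs (None red) Ds → Unique (concat Ds) → concat Ds ⊑ V → All (λ D → 48 * β ≤ length D) Ds → Classified Ds
    classify [] _ _ _ _ = record
      { es = [] ; Rs = [] ; skips = 0 ; wit = [] ; tally = refl ; forward = tt ; es⊑ = λ () ; big = [] ; reds = [] ; Rs⊑ = λ ()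
      ; uniqR = [] ; sepR = [] ; uniqW = [] ; wit⊑ = λ () ; wit⊑Ds = λ () ; sizeW = z≤n }
    classify (D ∷ Ds) (none ∷ nones) u s (bigD ∷ bigs) with classify Ds nones (unique-++ʳ D u) (s ∘ ∈-++⁺ʳ D) bigs
    ... | C = go (24 * β ≤? length D′)
      where
      module C = Classified C
      Bd = badF C.es
      D′ = _∖_ _≟_ D Bd
      D∩ = filter (_∈? Bd) D
      uD : Unique D
      uD = unique-++ˡ D u
      disD : Disj D (concat Ds)
      disD = unique-disj D u
      none′ : None red D (concat Ds)
      none′ x∈ y∈ with ∈-concat⁻′ Ds y∈
      ... | D₁ , y∈′ , D∈ = All.lookup none D∈ x∈ y∈′
      D′⊑ : D′ ⊑ D
      D′⊑ z = proj₁ (∈-∖⁻ _≟_ D Bd z)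
      24+24 : 24 * β + 24 * β ≡ 48 * β
      24+24 = sym (*-distribʳ-+ β 24 24)
      go : Dec (24 * β ≤ length D′) → Classified (D ∷ Ds)
      go (no few) = record
        { es = C.es ; Rs = C.Rs ; skips = suc C.skips ; wit = D∩ ++ C.wit ; tally = trans (+-suc _ _) (cong suc C.tally)
        ; forward = C.forward ; es⊑ = ∈-++⁺ʳ D ∘ C.es⊑ ; big = C.big ; reds = C.reds ; Rs⊑ = ∈-++⁺ʳ D ∘ C.Rs⊑ ; uniqR = C.uniqR ; sepR = C.sepR
        ; uniqW = unique-++ (Uniqueₚ.filter⁺ (_∈? Bd) uD) C.uniqW (λ a b → disD (in∩ a) (C.wit⊑Ds b))
        ; wit⊑ = λ z → [ (λ a → proj₂ (∈-filter⁻ (_∈? Bd) {xs = D} a)) , C.wit⊑ ]′ (∈-++⁻ D∩ z)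
        ; wit⊑Ds = λ z → [ ∈-++⁺ˡ ∘ in∩ , ∈-++⁺ʳ D ∘ C.wit⊑Ds ]′ (∈-++⁻ D∩ z)
        ; sizeW = ≤-trans (+-mono-≤ enough C.sizeW) (≤-reflexive (sym (length-++ D∩))) }
        where
        in∩ : D∩ ⊑ D
        in∩ a = proj₁ (∈-filter⁻ (_∈? Bd) {xs = D} a)
        enough : 24 * β ≤ length D∩
        enough = +-cancelʳ-≤ (24 * β) _ _ (≤-trans (≤-reflexive 24+24) (≤-trans bigD (≤-trans (≤-reflexive (sym (length-∩-∖ _≟_ D Bd))) (+-monoʳ-≤ (length D∩) (<⇒≤ (≰⇒> few))))))
      go (yes many) with extract blue blue-complete (length D′) (ℓ + (ℓ + ℓ)) (suc n₀ + suc n₀) D′ ≤-refl (unique-∖ _≟_ Bd uD) (≤-trans ℓ>0 (m≤m+n ℓ _)) (s≤s z≤n)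
      ... | rs , bs , rest , perm , reds , blues , few = split (6 * β ≤? length (concat rs)) (6 * β ≤? length (concat bs))
        where
        uall : Unique (concat rs ++ concat bs ++ rest)
        uall = unique-↭ perm (unique-∖ _≟_ Bd uD)
        rs⊑ : concat rs ⊑ D
        rs⊑ z = D′⊑ (∈-resp-↭ (↭-sym perm) (∈-++⁺ˡ z))
        bs⊑′ : concat bs ⊑ D′
        bs⊑′ z = ∈-resp-↭ (↭-sym perm) (∈-++⁺ʳ (concat rs) (∈-++⁺ˡ z))
        split : Dec (6 * β ≤ length (concat rs)) → Dec (6 * β ≤ length (concat bs)) → Classified (D ∷ Ds)
        split (yes h) _ = record
          { es = C.es ; Rs = rs ∷ C.Rs ; skips = C.skips ; wit = C.wit
          ; tally = trans (cong (_+ C.skips) (+-suc (length C.es) _)) (cong suc C.tally)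
          ; forward = C.forward ; es⊑ = ∈-++⁺ʳ D ∘ C.es⊑ ; big = C.big
          ; reds = (reds , h) ∷ C.reds
          ; Rs⊑ = λ z → [ ∈-++⁺ˡ ∘ rs⊑ , ∈-++⁺ʳ D ∘ C.Rs⊑ ]′ (∈-++⁻ (concat rs) z)
          ; uniqR = unique-++ (unique-++ˡ (concat rs) uall) C.uniqR (λ a b → disD (rs⊑ a) (C.Rs⊑ b))
          ; sepR = All.tabulate (λ R∈ a b → none′ (rs⊑ a) (C.Rs⊑ (concat-⊑ R∈ b))) ∷ C.sepR
          ; uniqW = C.uniqW ; wit⊑ = C.wit⊑ ; wit⊑Ds = ∈-++⁺ʳ D ∘ C.wit⊑Ds ; sizeW = C.sizeW }
        split (no _) (yes h) with make-block bs blues (unique-++ˡ (concat bs) (unique-++ʳ (concat rs) uall)) h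
        ... | e , bigF , refl = record
          { es = e ∷ C.es ; Rs = C.Rs ; skips = C.skips ; wit = C.wit
          ; tally = cong suc C.tally
          ; forward = (λ z → open-blocks C.es C.big (s (∈-++⁺ˡ (D′⊑ (bs⊑′ z)))) (proj₂ (∈-∖⁻ _≟_ D Bd (bs⊑′ z)))
                         (λ w → disD (D′⊑ (bs⊑′ z)) (C.es⊑ w)) (λ w → none′ (D′⊑ (bs⊑′ z)) (C.es⊑ w))) ,
                      (λ a b → disD (D′⊑ (bs⊑′ a)) (C.es⊑ b)) , C.forward
          ; es⊑ = λ z → [ ∈-++⁺ˡ ∘ D′⊑ ∘ bs⊑′ , ∈-++⁺ʳ D ∘ C.es⊑ ]′ (∈-++⁻ (concat bs) z)
          ; big = bigF ∷ C.big
          ; reds = C.reds ; Rs⊑ = ∈-++⁺ʳ D ∘ C.Rs⊑ ; uniqR = C.uniqR ; sepR = C.sepR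
          ; uniqW = C.uniqW ; wit⊑ = ∈-++⁺ʳ (bad (Block.F e)) ∘ C.wit⊑ ; wit⊑Ds = ∈-++⁺ʳ D ∘ C.wit⊑Ds ; sizeW = C.sizeW }
        split (no p) (no q) = contradiction many (<⇒≱ (begin-strict
          length D′ ≡⟨ trans (↭-length perm) (trans (length-++ (concat rs)) (cong (length (concat rs) +_) (length-++ (concat bs)))) ⟩
          length (concat rs) + (length (concat bs) + length rest) <⟨ +-mono-< (≰⇒> p) (+-mono-< (≰⇒> q) (<-≤-trans few short)) ⟩
          6 * β + (6 * β + 12 * β) ≡⟨ arith β ⟩
          24 * β ∎))
          where
          open ≤-Reasoning
          arith : ∀ β → 6 * β + (6 * β + 12 * β) ≡ 24 * β
          arith = solve-∀

    module _ {Ds} (C : Classified Ds) where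
      private module C = Classified C

      length-badF : length (badF C.es) ≤ length C.es * k
      length-badF = go C.es
        where
        go : ∀ es → length (badF es) ≤ length es * k
        go [] = z≤n
        go (e ∷ es) = ≤-trans (≤-reflexive (length-++ (bad (Block.F e)))) (+-mono-≤ (length-bad (Block.F e) (Block.uniqF e)) (go es))

      -- The skipped sets are disjoint, and each contains 24β vertices that are exceptional for blue
      -- blocks. One blue block has at most `k` exceptional vertices, which is at most 24β.
      skips≤ : C.skips ≤ length C.es
      skips≤ = *-cancelʳ-≤ C.skips (length C.es) (24 * β) {{>-nonZero (*-mono-≤ (s≤s (z≤n {23})) β>0)}} (≤-trans C.sizeW (≤-trans (length-⊑ C.uniqW C.wit⊑)
                 (≤-trans length-badF (*-monoʳ-≤ (length C.es) (≤-trans k≤ (*-monoˡ-≤ β {3} {24} (s≤s (s≤s (s≤s z≤n)))))))))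

      -- The additional first block supplies the host of the root.
      blue-many : ∀ a → n ≤ suc n₀ * a → suc (a + suc n₀) ≤ length C.es → Embedded
      blue-many a cover len = go C.es C.forward C.big len
        where
        go : ∀ es → Forward S _≟_ blue es → All (λ e → 3 * β ≤ length (Block.F e)) es → suc (a + suc n₀) ≤ length es → Embedded
        go (e ∷ es) (fw , dis , fw′) (b ∷ _) (s≤s h) with Block.F e in eq
        ... | [] = contradiction (≤-trans β>0 (m≤m+n β _)) (<⇒≱ (s≤s b))
        ... | x ∷ _ = embed-in-blocks S _≟_ blue es x a fw′ (fw x∈) (dis x∈) cover h
          where
          x∈ : x ∈ Block.U e
          x∈ = Block.F⊑U e (subst (x ∈_) (sym eq) (here refl))

    -- Unless S embeds in the blue blocks, there are at most `a + suc n₀` of these, and no more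
    -- skipped sets. A stack of depth τ contains the red path; with a smaller depth the remaining
    -- blocks are red and give more than `P₀` pairs. Since β is at least 2`K`, half of the weight of
    -- these pairs pays their price and the other half exceeds 16`E`n.
    hanging : ∀ {m} Ds a τ P₀ → AllPairs (None red) Ds → Unique (concat Ds) → concat Ds ⊑ V → All (λ D → 48 * β ≤ length D) Ds →
      n ≤ suc n₀ * a → m ≤ τ * ℓ → 0 < τ → 16 * E * n ≤ P₀ * K → 2 * K ≤ β →
      2 * (a + suc n₀) + 2 * P₀ + τ ≤ length Ds → RedPath red m (concat Ds) ⊎ Embedded
    hanging {m} Ds a τ P₀ sep u s bigs cover m≤ τ>0 nP₀ 2K≤ len with classify Ds sep u s bigs
    ... | C with suc (a + suc n₀) ≤? length (Classified.es C)
    ... | yes many = inj₂ (blue-many C a cover many)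
    ... | no few with run-stack (Classified.Rs C) (Classified.reds C) (Classified.sepR C) (Classified.uniqR C)
    ... | record { d = d ; st = st ; σ = σ ; ok = ok ; uniq = uniq ; heavy = heavy ; tally = tally } with τ ≤? d
    hanging {m} Ds a τ P₀ sep u s bigs cover m≤ τ>0 nP₀ 2K≤ len | C | no few
      | record { d = zero } | yes τ≤ = contradiction (≤-trans τ>0 τ≤) λ ()
    hanging {m} Ds a τ P₀ sep u s bigs cover m≤ τ>0 nP₀ 2K≤ len | C | no few
      | record { d = suc d ; st = st } | yes τ≤ with stack-path st
    ... | p , p⊑ , up , lp , lenp = inj₁ (red-path-take up lp (Classified.Rs⊑ C ∘ p⊑) (≤-trans m≤ (≤-trans (*-monoˡ-≤ ℓ τ≤) lenp)))
    hanging {m} Ds a τ P₀ sep u s bigs cover m≤ τ>0 nP₀ 2K≤ len | C | no few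
      | record { d = d ; σ = σ ; ok = ok ; uniq = uniq ; st = st ; heavy = heavy ; tally = tally } | no τ≰ =
        inj₂ (embed-in-core σ ok (s ∘ Classified.Rs⊑ C) (unique-++ʳ (stacked st) uniq)
          (subst (16 * E * n + events σ * K <_) (sym heavy) (begin-strict
            16 * E * n + events σ * K ≤⟨ +-monoˡ-≤ _ nP₀ ⟩
            P₀ * K + events σ * K <⟨ +-monoˡ-< (events σ * K) (*-monoˡ-< K {{>-nonZero K>0}} P₀<) ⟩
            events σ * K + events σ * K ≡⟨ arith (events σ) K ⟩
            events σ * (2 * K) ≤⟨ *-monoʳ-≤ (events σ) 2K≤ ⟩
            events σ * β ∎)))
      where
      open ≤-Reasoning
      module C = Classified C
      arith : ∀ a b → a * b + a * b ≡ a * (2 * b)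
      arith = solve-∀
      b = length C.es
      b≤ : b ≤ a + suc n₀
      b≤ = s≤s⁻¹ (≰⇒> few)
      P₀< : P₀ < events σ
      P₀< = ≰⇒> λ ν≤ → <-irrefl refl (begin-strict
        length Ds ≡⟨ sym C.tally ⟩
        b + length C.Rs + C.skips ≡⟨ cong (λ z → b + z + C.skips) (sym tally) ⟩
        b + (events σ + events σ + d) + C.skips ≤⟨ +-monoʳ-≤ _ (skips≤ C) ⟩
        b + (events σ + events σ + d) + b <⟨ +-monoˡ-< b (+-monoʳ-< b (+-monoʳ-< (events σ + events σ) (≰⇒> τ≰))) ⟩
        b + (events σ + events σ + τ) + b ≤⟨ +-mono-≤ (+-mono-≤ b≤ (+-monoˡ-≤ τ (+-mono-≤ ν≤ ν≤))) b≤ ⟩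
        (a + suc n₀) + (P₀ + P₀ + τ) + (a + suc n₀) ≡⟨ arith′ (a + suc n₀) P₀ τ ⟩
        2 * (a + suc n₀) + 2 * P₀ + τ ≤⟨ len ⟩
        length Ds ∎)
        where
        arith′ : ∀ x p t → x + (p + p + t) + x ≡ 2 * x + 2 * p + t
        arith′ = solve-∀

-- Red paths in large sets

module Paths {A : Set} (𝒢 : Coloured A) (V : List A) (uV : Unique V) {n : ℕ} (S : OutTree n) where
  open Coloured 𝒢
  open EventPlan 𝒢 V uV S using (embed-in-core; K; K>0; k≤K; E≤K)
  open Hanging 𝒢 V uV S
  open Embedding S _≟_ blue using (Embedded)

  module _ (u m : ℕ) (u>0 : 0 < u) (K≤u : K ≤ u) (nE : 16 * E * n ≤ u * K) (m≤ : m ≤ u * K) (mn : m * n ≤ K * (u * u)) where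

    abstract
      β s : ℕ
      β = 2 * K
      s = 48 * β

      β≡ : β ≡ 2 * K
      β≡ = refl
      s≡ : s ≡ 48 * β
      s≡ = refl

    private
      instance
        u-nonzero : NonZero u
        u-nonzero = >-nonZero u>0

      x≤[1+x/u]*u : ∀ x → x ≤ suc (x / u) * u
      x≤[1+x/u]*u x = ≤-trans (≤-reflexive (m≡m%n+[m/n]*n x u)) (+-monoˡ-≤ (x / u * u) (<⇒≤ (m%n<n x u)))

      -- Rounded up: `u` levels of `ℓ` vertices reach m, and `u` gains of `suc n₀` vertices reach n.
      ℓ = suc (m / u)
      n₀ = n / u

      K≤β : K ≤ β
      K≤β = ≤-trans (m≤m+n K (K + 0)) (≤-reflexive (sym β≡))

      β≤s : β ≤ s
      β≤s = ≤-trans (m≤m+n β (47 * β)) (≤-reflexive (sym s≡))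

      β>0 : 0 < β
      β>0 = ≤-trans K>0 K≤β

      s>0 : 0 < s
      s>0 = ≤-trans β>0 β≤s

      n≤uK : n ≤ u * K
      n≤uK = ≤-trans (m≤n*m n (16 * E)) nE

      n/u≤K : n / u ≤ K
      n/u≤K = *-cancelʳ-≤ _ _ u (≤-trans (m/n*n≤m n u) (≤-trans n≤uK (≤-reflexive (*-comm u K))))

      m/u≤K : m / u ≤ K
      m/u≤K = *-cancelʳ-≤ _ _ u (≤-trans (m/n*n≤m m u) (≤-trans m≤ (≤-reflexive (*-comm u K))))

      both≤K : m / u * (n / u) ≤ K
      both≤K = *-cancelʳ-≤ _ _ (u * u) {{m*n≢0 u u}} (≤-trans (≤-reflexive (arith (m / u) (n / u) u)) (≤-trans (*-mono-≤ (m/n*n≤m m u) (m/n*n≤m n u)) mn))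
        where
        arith : ∀ a b u → a * b * (u * u) ≡ (a * u) * (b * u)
        arith = solve-∀

      -- The product expands into six times four terms, each at most `K`. For the product of m/u and
      -- n/u this is the hypothesis on mn.
      short : (ℓ + (ℓ + ℓ)) * (suc n₀ + suc n₀) ≤ 12 * β
      short = begin
        (ℓ + (ℓ + ℓ)) * (suc n₀ + suc n₀) ≡⟨ arith (m / u) n₀ ⟩
        6 * (m / u * n₀ + m / u + n₀ + 1) ≤⟨ *-monoʳ-≤ 6 (+-mono-≤ (+-mono-≤ (+-mono-≤ both≤K m/u≤K) n/u≤K) K>0) ⟩
        6 * (K + K + K + K) ≡⟨ trans (arith′ K) (cong (12 *_) (sym β≡)) ⟩
        12 * β ∎
        where
        open ≤-Reasoning
        arith : ∀ a b → (suc a + (suc a + suc a)) * (suc b + suc b) ≡ 6 * (a * b + a + b + 1)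
        arith = solve-∀
        arith′ : ∀ K → 6 * (K + K + K + K) ≡ 12 * (2 * K)
        arith′ = solve-∀

      k≤3β : k ≤ 3 * β
      k≤3β = ≤-trans k≤K (≤-trans K≤β (m≤m+n β _))

      En≤ : E * suc n₀ ≤ 3 * β
      En≤ = begin
        E * suc n₀ ≡⟨ *-suc E n₀ ⟩
        E + E * n₀ ≤⟨ +-mono-≤ E≤K En₀ ⟩
        K + K ≡⟨ trans (cong (K +_) (sym (+-identityʳ K))) (sym β≡) ⟩
        β ≤⟨ m≤m+n β _ ⟩
        3 * β ∎
        where
        open ≤-Reasoning
        En₀ : E * n₀ ≤ K
        En₀ = *-cancelʳ-≤ _ _ u (≤-trans (≤-reflexive (*-assoc E n₀ u)) (≤-trans (*-monoʳ-≤ E (m/n*n≤m n u))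
                (≤-trans (*-monoˡ-≤ n (m≤n*m E 16)) (≤-trans nE (≤-reflexive (*-comm u K))))))

    abstract
      threshold : ℕ
      threshold = 64 * (s * u)

      threshold≡ : threshold ≡ 64 * (s * u)
      threshold≡ = refl

    -- `hanging` is applied with `a`, `τ` and `P₀` all equal to `u`. It then asks for at most 9`u`
    -- blocks, while the grouping provides at least 16`u`.
    hanging-case : ∀ hs → All (λ h → length h < s) hs → AllPairs (None red) hs → Unique (concat hs) → concat hs ⊑ V →
      threshold ≤ length (concat hs) → RedPath red m (concat hs) ⊎ Embedded
    hanging-case hs small sep uhs hs⊑ big with group red s hs s>0 small sep
    ... | G = red-path-⊑ Ds⊑ (hanging ℓ β n₀ (s≤s z≤n) β>0 short k≤3β En≤ {m} G.Ds u u u (tail G.sep)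
                (unique-++ʳ G.cur (subst Unique G.eq uhs)) (hs⊑ ∘ Ds⊑) (All.map (λ h → ≤-trans (≤-reflexive (sym s≡)) (proj₁ h)) G.sizes)
                (x≤[1+x/u]*u n) (≤-trans (x≤[1+x/u]*u m) (≤-reflexive (*-comm ℓ u))) u>0 nE (≤-reflexive (sym β≡)) enough)
      where
      module G = Grouping G
      tail : ∀ {R : List A → List A → Set} {x xs} → AllPairs R (x ∷ xs) → AllPairs R xs
      tail (_ ∷ p) = p
      Ds⊑ : concat G.Ds ⊑ concat hs
      Ds⊑ {x} z = subst (x ∈_) (sym G.eq) (∈-++⁺ʳ G.cur z)
      t = length G.Ds
      t-large : 16 * u ≤ t
      t-large = ≮⇒≥ λ t< → <-irrefl refl (begin-strict
        threshold ≤⟨ big ⟩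
        length (concat hs) ≤⟨ grouping-size red s G ⟩
        s + t * (s + s) <⟨ +-monoˡ-< (t * (s + s)) (m<m+n s s>0) ⟩
        suc t * (s + s) ≤⟨ *-monoˡ-≤ (s + s) t< ⟩
        16 * u * (s + s) ≡⟨ arith s u ⟩
        32 * (s * u) ≤⟨ ≤-trans (*-monoˡ-≤ (s * u) {32} {64} (m≤m+n 32 32)) (≤-reflexive (sym threshold≡)) ⟩
        threshold ∎)
        where
        open ≤-Reasoning
        arith : ∀ s u → 16 * u * (s + s) ≡ 32 * (s * u)
        arith = solve-∀
      n₀≤u : n₀ ≤ u
      n₀≤u = ≤-trans n/u≤K K≤u
      enough : 2 * (u + suc n₀) + 2 * u + u ≤ t
      enough = begin
        2 * (u + suc n₀) + 2 * u + u ≤⟨ +-monoˡ-≤ u (+-monoˡ-≤ (2 * u) (*-monoʳ-≤ 2 (+-monoʳ-≤ u (+-mono-≤ u>0 n₀≤u)))) ⟩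
        2 * (u + (u + u)) + 2 * u + u ≡⟨ arith u ⟩
        9 * u ≤⟨ *-monoˡ-≤ u {9} {16} (m≤m+n 9 7) ⟩
        16 * u ≤⟨ t-large ⟩
        t ∎
        where
        open ≤-Reasoning
        arith : ∀ u → 2 * (u + (u + u)) + 2 * u + u ≡ 9 * u
        arith = solve-∀

    uK≤threshold : u * K ≤ threshold
    uK≤threshold = ≤-trans (*-monoʳ-≤ u (≤-trans K≤β β≤s)) (≤-trans (≤-trans (≤-reflexive (*-comm u s)) (m≤m+n (s * u) _)) (≤-reflexive (sym threshold≡)))

    -- If neither the path nor the small trees suffice, each takes up at most a quarter of `X`. At
    -- least half of `X` is then in pairs, and `weight`, which counts one side of each pair, is at
    -- least a quarter of the size of `X`. By `few` there is less than one pair per `s` vertices, so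
    -- the total price of the pairs stays well below this weight.
    from-layout : ∀ {X R} → Unique X → X ⊑ V → 4 * threshold ≤ length X → Layout red s X R → RedPath red m X ⊎ Embedded
    from-layout {X} uX X⊑ big L = go (m ≤? length L.π) (threshold ≤? length (concat L.hs))
      where
      module L = Layout L
      uall : Unique (L.κ ++ core L.σ ++ concat L.hs)
      uall = unique-↭ L.perm uX
      go : Dec (m ≤ length L.π) → Dec (threshold ≤ length (concat L.hs)) → RedPath red m X ⊎ Embedded
      go (yes h) _ = inj₁ (red-path-take L.uniq L.chain (L.π⊑X) h)
      go (no _) (yes h) = red-path-⊑ L.hs⊑X (hanging-case L.hs L.small L.sep (unique-++ʳ (core L.σ) (unique-++ʳ L.κ uall)) (X⊑ ∘ L.hs⊑X) h)
      go (no short-π) (no small-hang) = inj₂ (embed-in-core L.σ L.ok (X⊑) (unique-++ˡ (core L.σ) (unique-++ʳ L.κ uall)) (heavy L.few))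
        where
        open ≤-Reasoning
        w = length X
        y = weight L.σ
        w≤ : w ≤ 4 * y
        w≤ = +-cancelʳ-≤ (4 * threshold) _ _ (begin
          w + 4 * threshold ≤⟨ +-monoʳ-≤ w big ⟩
          w + w ≡⟨ cong (w +_) (sym (+-identityʳ w)) ⟩
          2 * w ≡⟨ cong (2 *_) (trans (↭-length L.perm) (trans (length-++ L.κ) (cong (length L.κ +_) (trans (length-++ (core L.σ)) (cong (_+ length (concat L.hs)) (length-core red L.ok)))))) ⟩
          2 * (length L.κ + ((y + y) + length (concat L.hs)))
            ≤⟨ *-monoʳ-≤ 2 (+-mono-≤ (≤-trans (sublist-length L.κ⊆π) (≤-trans (<⇒≤ (≰⇒> short-π)) (≤-trans m≤ uK≤threshold))) (+-monoʳ-≤ (y + y) (<⇒≤ (≰⇒> small-hang)))) ⟩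
          2 * (threshold + ((y + y) + threshold)) ≡⟨ arith threshold y ⟩
          4 * y + 4 * threshold ∎)
          where
          arith : ∀ h y → 2 * (h + ((y + y) + h)) ≡ 4 * y + 4 * h
          arith = solve-∀
        threshold>0 : 0 < threshold
        threshold>0 = ≤-trans (*-mono-≤ u>0 K>0) uK≤threshold
        heavy : (L.π ≡ [] × L.σ ≡ leaf) ⊎ s * suc (events L.σ) ≤ length X → 16 * E * n + events L.σ * K < y
        heavy (inj₁ (_ , e)) = contradiction (≤-trans threshold>0 (≤-trans (m≤m+n threshold _) (≤-trans big (≤-trans w≤ (≤-reflexive (cong (λ σ → 4 * weight σ) e)))))) λ ()
        heavy (inj₂ few) = *-cancelˡ-< 8 _ _ (begin-strict
          8 * (16 * E * n + ν * K) ≤⟨ *-monoʳ-≤ 8 (+-monoˡ-≤ (ν * K) nE) ⟩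
          8 * (u * K + ν * K) <⟨ *-monoʳ-< 8 (+-monoʳ-< (u * K) (*-monoˡ-< K {{>-nonZero K>0}} (n<1+n ν))) ⟩
          8 * (u * K + suc ν * K) ≡⟨ arith u K (suc ν) ⟩
          8 * (u * K) + 8 * K * suc ν ≤⟨ +-mono-≤ (≤-trans (≤-reflexive (arith′ u K)) (*-monoʳ-≤ 4 (≤-trans (*-mono-≤ {2} {64} (m≤m+n 2 62) (≤-trans (≤-reflexive (*-comm u K)) (*-monoˡ-≤ u K≤s))) (≤-reflexive (sym threshold≡))))) (*-monoˡ-≤ (suc ν) 8K≤s) ⟩
          4 * threshold + s * suc ν ≤⟨ +-mono-≤ big few ⟩
          w + w ≤⟨ +-mono-≤ w≤ w≤ ⟩
          4 * y + 4 * y ≡⟨ sym (*-distribʳ-+ y 4 4) ⟩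
          8 * y ∎)
          where
          ν = events L.σ
          K≤s : K ≤ s
          K≤s = ≤-trans K≤β β≤s
          8K≤s : 8 * K ≤ s
          8K≤s = ≤-trans (*-mono-≤ {8} {48} (m≤m+n 8 40) K≤β) (≤-reflexive (sym s≡))
          arith : ∀ u K v → 8 * (u * K + v * K) ≡ 8 * (u * K) + 8 * K * v
          arith = solve-∀
          arith′ : ∀ u K → 8 * (u * K) ≡ 4 * (2 * (u * K))
          arith′ = solve-∀

    red-path : ∀ W → Unique W → W ⊑ V → 4 * threshold ≤ length W → RedPath red m W ⊎ Embedded
    red-path W uW W⊑ big with dfs red (length W) W ≤-refl
    ... | F , perm , isDFS = red-path-⊑ (∈-resp-↭ (↭-sym perm))
            (from-layout (unique-↭ perm uW) (W⊑ ∘ ∈-resp-↭ (↭-sym perm)) (≤-trans big (≤-reflexive (↭-length perm)))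
              (forest-layout red s s>0 F isDFS (unique-↭ perm uW)))

-- Gluing paths to a tree

module Attach {A : Set} (_≟_ : DecidableEquality A) (V : List A) {m : ℕ} (T : OutTree m) (ρ : A → A → Bool) (Emb : Set) (c : ℕ)
  (no-gap : ∀ P Q → Unique P → Unique Q → Disj P Q → P ⊑ V → Q ⊑ V → c ≤ length P → c ≤ length Q → None ρ P Q → None ρ Q P → Emb)
  (μ₀ : ℕ) (μ₀>0 : 0 < μ₀) (c≤ : c ≤ 2 * μ₀)
  (find-path : ∀ W → Unique W → W ⊑ V → μ₀ ≤ length W → RedPath ρ m W ⊎ Emb) where
  open OutTree T
  open Embedding T _≟_ ρ
  open DecMembership _≟_ using (_∈?_)

  module _ (Pred : A → Set) (μ : ℕ) (W : List A) (uW : Unique W)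
           (search : ∀ Z → Unique Z → Z ⊑ W → μ ≤ length Z → (Σ[ x ∈ A ] x ∈ Z × Pred x) ⊎ Emb) where

    -- Each search is made in what is left of `W` after removing the vertices already found, and it
    -- applies as long as μ vertices are left.
    collect : ∀ l → μ + l ≤ suc (length W) → (Σ[ X ∈ List A ] length X ≡ l × Unique X × X ⊑ W × (∀ {x} → x ∈ X → Pred x)) ⊎ Emb
    collect zero h = inj₁ ([] , refl , [] , (λ ()) , λ ())
    collect (suc l) h with collect l (≤-trans (+-monoʳ-≤ μ (n≤1+n l)) h)
    ... | inj₂ e = inj₂ e
    ... | inj₁ (X , lX , uX , X⊑ , px) with search (_∖_ _≟_ W X) (unique-∖ _≟_ X uW) (λ z → proj₁ (∈-∖⁻ _≟_ W X z))
            (+-cancelˡ-≤ (length X) _ _ (≤-trans (≤-reflexive (trans (cong (_+ μ) lX) (+-comm l μ))) (≤-trans (s≤s⁻¹ (subst (_≤ suc (length W)) (+-suc μ l) h)) (length-∖ _≟_ X uW))))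
    ... | inj₂ e = inj₂ e
    ... | inj₁ (x , x∈ , p) = inj₁ (x ∷ X , cong suc lX , unique-cons (proj₂ (∈-∖⁻ _≟_ W X x∈)) uX ,
            (λ { (here refl) → proj₁ (∈-∖⁻ _≟_ W X x∈) ; (there z) → X⊑ z }) , λ { (here refl) → p ; (there z) → px z })

  Placed : List (Fin m) → List A → Set
  Placed D W = Σ[ f ∈ (Fin m → A) ] Partial D f × (∀ {x} → x ∈ D → f x ∈ W)

  Find : ℕ → List (Fin m) → Set
  Find μ D = ∀ W → Unique W → W ⊑ V → μ ≤ length W → Placed D W ⊎ Emb

  module _ {D : List (Fin m)} {μ : ℕ} (μ₀≤μ : μ₀ ≤ μ) (findD : Find μ D) (u : Fin m) (q : List (Fin m))
           (u∉ : u ∉ D) (par∈ : par u ∈ D) (lq : Linked (λ x y → y ∈ ch x) (u ∷ q)) (short : length (u ∷ q) ≤ m) where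

    Start : List A → A → Set
    Start W x = Σ[ p ∈ List A ] IsPath ρ (length (u ∷ q)) (x ∷ p) × x ∷ p ⊑ W

    Image : List A → A → Set
    Image W x = Σ[ f ∈ (Fin m → A) ] Partial D f × (∀ {y} → y ∈ D → f y ∈ W) × f (par u) ≡ x

    images : ∀ W → Unique W → W ⊑ V → length W ≡ 4 * μ → (Σ[ X ∈ List A ] length X ≡ 3 * μ × Unique X × X ⊑ W × (∀ {x} → x ∈ X → Image W x)) ⊎ Emb
    images W uW W⊑ l = collect (Image W) μ W uW search (3 * μ) (≤-trans (≤-reflexive (sym l)) (n≤1+n _))
      where
      search : ∀ Z → Unique Z → Z ⊑ W → μ ≤ length Z → (Σ[ x ∈ A ] x ∈ Z × Image W x) ⊎ Emb
      search Z uZ Z⊑ h with findD Z uZ (W⊑ ∘ Z⊑) h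
      ... | inj₂ e = inj₂ e
      ... | inj₁ (f , P , i) = inj₁ (f (par u) , i par∈ , f , P , Z⊑ ∘ i , refl)

    starts : ∀ W → Unique W → W ⊑ V → length W ≡ 4 * μ → (Σ[ X ∈ List A ] length X ≡ 3 * μ × Unique X × X ⊑ W × (∀ {x} → x ∈ X → Start W x)) ⊎ Emb
    starts W uW W⊑ l = collect (Start W) μ W uW search (3 * μ) (≤-trans (≤-reflexive (sym l)) (n≤1+n _))
      where
      search : ∀ Z → Unique Z → Z ⊑ W → μ ≤ length Z → (Σ[ x ∈ A ] x ∈ Z × Start W x) ⊎ Emb
      search Z uZ Z⊑ h with find-path Z uZ (W⊑ ∘ Z⊑) (≤-trans μ₀≤μ h)
      ... | inj₂ e = inj₂ e
      ... | inj₁ (p , (lp , up , kp) , p⊑) with red-path-take {m = length (u ∷ q)} up kp p⊑ (≤-trans short (≤-reflexive (sym lp)))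
      ... | x ∷ p′ , path , s = inj₁ (x , s (here refl) , p′ , path , Z⊑ ∘ s)

    glue : ∀ {W₁ W₂ x y} → Disj W₁ W₂ → Image W₁ x → Start W₂ y → ρ x y ≡ true → Placed (q ʳ++ (u ∷ D)) (W₁ ++ W₂)
    glue {W₁} {W₂} {x} {y} dis (f , P , i , e) (p , (lp , up , kp) , p⊑) r
      with place-path T _≟_ ρ u q y p P u∉ par∈ (subst (λ z → ρ z y ≡ true) (sym e) r) lq kp (sym (suc-injective lp)) up (λ z w → dis (i z) (p⊑ w))
    ... | M , refl = M.f′ , M.partial , inside
      where
      module M = Moved M
      inside : ∀ {v} → v ∈ M.D′ → M.f′ v ∈ W₁ ++ W₂
      inside v∈ with M.where-is v∈
      ... | inj₁ v∈D = ∈-++⁺ˡ (subst (_∈ W₁) (sym (M.old v∈D)) (i v∈D))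
      ... | inj₂ w = ∈-++⁺ʳ W₁ (p⊑ w)

    try : ∀ W₁ W₂ → Unique W₁ → Unique W₂ → Disj W₁ W₂ → W₁ ⊑ V → W₂ ⊑ V → length W₁ ≡ 4 * μ → length W₂ ≡ 4 * μ →
      Placed (q ʳ++ (u ∷ D)) (W₁ ++ W₂) ⊎ (Σ[ X ∈ List A ] Σ[ Y ∈ List A ] length X ≡ 3 * μ × length Y ≡ 3 * μ × Unique X × Unique Y ×
        X ⊑ W₁ × Y ⊑ W₂ × None ρ X Y) ⊎ Emb
    try W₁ W₂ u₁ u₂ dis s₁ s₂ l₁ l₂ with images W₁ u₁ s₁ l₁ | starts W₂ u₂ s₂ l₂
    ... | inj₂ e | _ = inj₂ (inj₂ e)
    ... | inj₁ _ | inj₂ e = inj₂ (inj₂ e)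
    ... | inj₁ (X , lX , uX , X⊑ , im) | inj₁ (Y , lY , uY , Y⊑ , st) with find₂? ρ X Y
    ... | inj₁ (x , y , x∈ , y∈ , r) = inj₁ (glue dis (im x∈) (st y∈) r)
    ... | inj₂ none = inj₂ (inj₁ (X , Y , lX , lY , uX , uY , X⊑ , Y⊑ , none))

    -- Two sets that each fill three quarters of `W` share at least half of it.
    meets : ∀ {W X Y} → length W ≡ 4 * μ → length X ≡ 3 * μ → length Y ≡ 3 * μ → Unique X → Unique Y → X ⊑ W → Y ⊑ W → c ≤ length (filter (_∈? Y) X)
    meets {W} {X} {Y} lW lX lY uX uY X⊑ Y⊑ = ≤-trans (≤-trans c≤ (*-monoʳ-≤ 2 μ₀≤μ)) (+-cancelʳ-≤ μ _ _ (begin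
      2 * μ + μ ≡⟨ trans (arith μ) (sym lX) ⟩
      length X ≡⟨ sym (length-∩-∖ _≟_ X Y) ⟩
      length (filter (_∈? Y) X) + length (_∖_ _≟_ X Y) ≤⟨ +-monoʳ-≤ _ outside ⟩
      length (filter (_∈? Y) X) + μ ∎))
      where
      open ≤-Reasoning
      arith : ∀ μ → 2 * μ + μ ≡ 3 * μ
      arith = solve-∀
      outside : length (_∖_ _≟_ X Y) ≤ μ
      outside = +-cancelʳ-≤ (3 * μ) _ _ (begin
        length (_∖_ _≟_ X Y) + 3 * μ ≡⟨ cong (length (_∖_ _≟_ X Y) +_) (sym lY) ⟩
        length (_∖_ _≟_ X Y) + length Y ≡⟨ sym (length-++ (_∖_ _≟_ X Y)) ⟩
        length (_∖_ _≟_ X Y ++ Y) ≤⟨ length-⊑ (unique-++ (unique-∖ _≟_ Y uX) uY (λ a b → proj₂ (∈-∖⁻ _≟_ X Y a) b))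
                                      (λ z → [ (λ a → X⊑ (proj₁ (∈-∖⁻ _≟_ X Y a))) , Y⊑ ]′ (∈-++⁻ (_∖_ _≟_ X Y) z)) ⟩
        length W ≡⟨ lW ⟩
        μ + 3 * μ ∎)

    -- Each of the two parts, of 4μ vertices, is tried as the place for `D` and as the place for the
    -- new path. If both attempts fail, consider in each part the vertices that are possible images
    -- of `par u` and also possible starts of the path. The first failure excludes red edges between
    -- these two sets in one direction, the second in the other, and `no-gap` applies.
    attach : Find (8 * μ) (q ʳ++ (u ∷ D))
    attach W uW W⊑ h = go
      where
      4μ = 4 * μ
      W₁ = take 4μ W
      W₂ = take 4μ (drop 4μ W)
      W₁₂⊑ : W₁ ++ W₂ ⊑ W
      W₁₂⊑ {v} z = subst (v ∈_) (take++drop≡id 4μ W) ([ ∈-++⁺ˡ , (λ w → ∈-++⁺ʳ W₁ (take-⊑ 4μ w)) ]′ (∈-++⁻ W₁ z))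
      W₁⊑ : W₁ ⊑ V
      W₁⊑ z = W⊑ (W₁₂⊑ (∈-++⁺ˡ z))
      W₂⊑ : W₂ ⊑ V
      W₂⊑ z = W⊑ (W₁₂⊑ (∈-++⁺ʳ W₁ z))
      uall : Unique (W₁ ++ drop 4μ W)
      uall = subst Unique (sym (take++drop≡id 4μ W)) uW
      u₁ : Unique W₁
      u₁ = unique-++ˡ W₁ uall
      u₂ : Unique W₂
      u₂ = Uniqueₚ.take⁺ 4μ (unique-++ʳ W₁ uall)
      dis : Disj W₁ W₂
      dis a b = unique-disj W₁ uall a (take-⊑ 4μ b)
      8μ≤ : 4μ + 4μ ≤ length W
      8μ≤ = ≤-trans (≤-reflexive (sym (*-distribʳ-+ μ 4 4))) h
      l₁ : length W₁ ≡ 4μ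
      l₁ = length-take-≤ 4μ W (≤-trans (m≤m+n 4μ 4μ) 8μ≤)
      l₂ : length W₂ ≡ 4μ
      l₂ = length-take-≤ 4μ (drop 4μ W) (≤-trans (m+n≤o⇒m≤o∸n 4μ 8μ≤) (≤-reflexive (sym (length-drop 4μ W))))
      move : ∀ {U} → U ⊑ W → Placed (q ʳ++ (u ∷ D)) U → Placed (q ʳ++ (u ∷ D)) W
      move s (f , P , i) = f , P , s ∘ i
      go : Placed (q ʳ++ (u ∷ D)) W ⊎ Emb
      go with try W₁ W₂ u₁ u₂ dis W₁⊑ W₂⊑ l₁ l₂
      ... | inj₁ p = inj₁ (move W₁₂⊑ p)
      ... | inj₂ (inj₂ e) = inj₂ e
      ... | inj₂ (inj₁ (X , Y , lX , lY , uX , uY , X⊑ , Y⊑ , none)) with try W₂ W₁ u₂ u₁ (λ a b → dis b a) W₂⊑ W₁⊑ l₂ l₁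
      ... | inj₁ p = inj₁ (move (λ z → W₁₂⊑ ([ ∈-++⁺ʳ W₁ , ∈-++⁺ˡ ]′ (∈-++⁻ W₂ z))) p)
      ... | inj₂ (inj₂ e) = inj₂ e
      ... | inj₂ (inj₁ (X′ , Y′ , lX′ , lY′ , uX′ , uY′ , X′⊑ , Y′⊑ , none′)) = inj₂ (no-gap P Q
            (Uniqueₚ.filter⁺ (_∈? Y′) uX) (Uniqueₚ.filter⁺ (_∈? X′) uY)
            (λ a b → dis (X⊑ (inP a)) (Y⊑ (inQ b)))
            (W₁⊑ ∘ X⊑ ∘ inP) (W₂⊑ ∘ Y⊑ ∘ inQ)
            (meets l₁ lX lY′ uX uY′ X⊑ Y′⊑) (meets l₂ lY lX′ uY uX′ Y⊑ X′⊑)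
            (λ a b → none (inP a) (inQ b)) (λ b a → none′ (proj₂ (∈-filter⁻ (_∈? X′) {xs = Y} b)) (proj₂ (∈-filter⁻ (_∈? Y′) {xs = X} a))))
        where
        P = filter (_∈? Y′) X
        Q = filter (_∈? X′) Y
        inP : P ⊑ X
        inP z = proj₁ (∈-filter⁻ (_∈? Y′) {xs = X} z)
        inQ : Q ⊑ Y
        inQ z = proj₁ (∈-filter⁻ (_∈? X′) {xs = Y} z)

  linked-depth : ∀ {u q} → Linked (λ x y → y ∈ ch x) (u ∷ q) → ∀ {v} → v ∈ q → depth u < depth v
  linked-depth {u} (c∈ ∷ l) v∈ with subst (λ z → depth z < _) (proj₂ (∈-ch⁻ c∈)) (depth-par _ (proj₁ (∈-ch⁻ c∈))) | v∈
  ... | u<c | here refl = u<c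
  ... | u<c | there w∈ = <-trans u<c (linked-depth l w∈)

  linked-unique : ∀ {u q} → Linked (λ x y → y ∈ ch x) (u ∷ q) → Unique (u ∷ q)
  linked-unique [-] = [] ∷ []
  linked-unique l@(_ ∷ l′) = unique-cons (λ u∈ → <-irrefl refl (linked-depth l u∈)) (linked-unique l′)

  up-path : ∀ {D} → root ∈ D → ∀ fuel v q → depth v < fuel → v ∉ D → Linked (λ x y → y ∈ ch x) (v ∷ q) →
    Σ[ u ∈ Fin m ] Σ[ q′ ∈ List (Fin m) ] u ∉ D × par u ∈ D × Linked (λ x y → y ∈ ch x) (u ∷ q′) × v ∷ q ⊑ u ∷ q′
  up-path {D} r∈ (suc fuel) v q (s≤s h) v∉ l with DecMembership._∈?_ Finₚ._≟_ (par v) D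
  ... | yes p∈ = v , q , v∉ , p∈ , l , id
  ... | no p∉ with up-path r∈ fuel (par v) (v ∷ q) (<-≤-trans (depth-par v v≢) h) p∉ (∈-ch⁺ v≢ refl ∷ l)
    where
    v≢ : v ≢ root
    v≢ refl = v∉ r∈
  ... | u , q′ , a , b , c , s = u , q′ , a , b , c , s ∘ there

  ∈-ʳ++ : ∀ (q : List (Fin m)) {D x} → x ∈ q ⊎ x ∈ D → x ∈ q ʳ++ D
  ∈-ʳ++ q {D} {x} h = subst (x ∈_) (sym (ʳ++-defn q)) ([ (λ z → ∈-++⁺ˡ (∈-resp-↭ (↭-sym (↭-reverse q)) z)) , ∈-++⁺ʳ (reverse q) ]′ h)

  attach-all : ∀ {D μ} → root ∈ D → μ₀ ≤ μ → Find μ D → ∀ zs →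
    Σ[ D′ ∈ List (Fin m) ] zs ⊑ D′ × D ⊑ D′ × Find (8 ^ length zs * μ) D′
  attach-all {D} {μ} r∈ h F [] = D , (λ ()) , id , subst (λ z → Find z D) (sym (+-identityʳ μ)) F
  attach-all {D} {μ} r∈ h F (z ∷ zs) with attach-one
    where
    attach-one : Σ[ D′ ∈ List (Fin m) ] z ∈ D′ × D ⊑ D′ × Find (8 * μ) D′
    attach-one with DecMembership._∈?_ Finₚ._≟_ z D
    ... | yes z∈ = D , z∈ , id , λ W uW W⊑ l → F W uW W⊑ (≤-trans (m≤m+n μ _) l)
    ... | no z∉ with up-path r∈ (suc (depth z)) z [] ≤-refl z∉ [-]
    ... | u , q , u∉ , p∈ , l , s = q ʳ++ (u ∷ D) , ∈-ʳ++ (u ∷ q) (inj₁ (s (here refl))) , (λ x∈ → ∈-ʳ++ (u ∷ q) (inj₂ x∈)) ,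
          attach h F u q u∉ p∈ l (length-≤-fin (linked-unique l))
  ... | D₁ , z∈ , s , F₁ with attach-all (s r∈) (≤-trans h (m≤m+n μ _)) F₁ zs
  ... | D₂ , zs⊑ , s₂ , F₂ = D₂ , (λ { (here refl) → s₂ z∈ ; (there w) → zs⊑ w }) , s₂ ∘ s ,
        subst (λ w → Find w D₂) (arith (8 ^ length zs) μ) F₂
    where
    arith : ∀ a μ → a * (8 * μ) ≡ (8 * a) * μ
    arith = solve-∀

  -- `D` contains all vertices without children and the parent of each of its non-root members.
  -- Descending from any vertex ends at a childless one, because no depth exceeds `total`; hence `D`
  -- contains every vertex.
  find-tree : ∀ (zs : List (Fin m)) → (∀ v → ch v ≡ [] → v ∈ zs) → Unique V → 8 ^ length zs * μ₀ ≤ length V → Embedded ⊎ Emb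
  find-tree zs sinks uV h with attach-all {[ root ]} (here refl) ≤-refl F₀ zs
    where
    F₀ : Find μ₀ [ root ]
    F₀ [] _ _ l = contradiction (≤-trans μ₀>0 l) λ ()
    F₀ (x ∷ W) _ _ _ = inj₁ ((λ _ → x) , start x , λ _ → here refl)
  ... | D , zs⊑ , _ , F with F V uV id h
  ... | inj₂ e = inj₂ e
  ... | inj₁ (f , P , _) = inj₁ (complete P λ v v∉ _ → v∉ (all (suc total) v (s≤s (m≤m+n total _))))
    where
    total = sum (map depth (allFin m))
    depth≤ : ∀ v → depth v ≤ total
    depth≤ v = go (∈-allFin v)
      where
      go : ∀ {vs} → v ∈ vs → depth v ≤ sum (map depth vs)
      go (here refl) = m≤m+n _ _
      go {w ∷ _} (there p) = ≤-trans (go p) (m≤n+m _ (depth w))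
    all : ∀ fuel v → total < fuel + depth v → v ∈ D
    all zero v lt = contradiction (depth≤ v) (<⇒≱ lt)
    all (suc fuel) v lt with ch v in eq
    ... | [] = zs⊑ (sinks v eq)
    ... | c ∷ _ with ∈-ch⁻ {v} {c} (subst (c ∈_) (sym eq) (here refl))
    ... | c≢ , pc = subst (_∈ D) pc (proj₁ (Partial.edge P (all fuel c (≤-trans lt (≤-trans (≤-reflexive (sym (+-suc fuel (depth v)))) (+-monoʳ-≤ fuel (subst (λ z → depth z < depth c) pc (depth-par c c≢)))))) c≢))

-- Trees directed either way

converse : {A : Set} → Bool → (A → A → Bool) → A → A → Bool
converse false r x y = r x y
converse true r x y = r y x

converse-path : {A : Set} {r : A → A → Bool} → ∀ b {m W} → RedPath r m W → RedPath (converse b r) m W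
converse-path false p = p
converse-path true (p , (lp , up , kp) , s) =
  reverse p , (trans (length-reverse p) lp , unique-↭ (↭-sym (↭-reverse p)) up , linked-reverse kp) , (λ z → s (∈-resp-↭ (↭-reverse p) z))

converse-none : {A : Set} {r : A → A → Bool} → ∀ b {X Y} → None (converse b r) X Y → None (converse b r) Y X → None r X Y × None r Y X
converse-none false p q = p , q
converse-none true p q = (λ x y → q y x) , (λ y x → p x y)

module _ {A : Set} (𝒢 : Coloured A) (V : List A) (uV : Unique V) {n m : ℕ} (S : OutTree n) (T : OutTree m) (b : Bool) where
  open Coloured 𝒢
  open EventPlan 𝒢 V uV S using (embed-in-core; K; K>0)
  open Paths 𝒢 V uV S

  -- 24576 is 4 · 64 · 48 · 2: `red-path` requires four times the threshold, which is 64 `s` `u`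
  -- with `s` = 48 · 2`K`.
  blue-or-red : ∀ u → 0 < u → K ≤ u → 16 * E * n ≤ u * K → m ≤ u * K → m * n ≤ K * (u * u) →
    ∀ zs → (∀ v → OutTree.ch T v ≡ [] → v ∈ zs) → 8 ^ length zs * (24576 * (K * u)) ≤ length V →
    Embedding.Embedded T _≟_ (converse b red) ⊎ Embedding.Embedded S _≟_ blue
  blue-or-red u u>0 K≤u nE m≤ mn zs sinks big =
    Attach.find-tree _≟_ V T (converse b red) (Embedding.Embedded S _≟_ blue) c no-gap (4 * θ) (*-mono-≤ (s≤s (z≤n {3})) θ>0) c≤
      (λ W uW W⊑ h → converse-red (red-path u m u>0 K≤u nE m≤ mn W uW W⊑ h)) zs sinks uV
      (≤-trans (*-monoʳ-≤ (8 ^ length zs) (≤-reflexive θ≡)) big)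
    where
    θ = threshold u m u>0 K≤u nE m≤ mn
    -- The least weight with which a structure of a single pair satisfies `embed-in-core`.
    c = suc (16 * E * n + K)
    uK≤θ : u * K ≤ θ
    uK≤θ = uK≤threshold u m u>0 K≤u nE m≤ mn
    θ>0 : 0 < θ
    θ>0 = ≤-trans (*-mono-≤ u>0 K>0) uK≤θ
    θ≡ : 4 * θ ≡ 24576 * (K * u)
    θ≡ = trans (cong (4 *_) (threshold≡ u m u>0 K≤u nE m≤ mn)) (trans (cong (λ z → 4 * (64 * (z * u))) (trans (s≡ u m u>0 K≤u nE m≤ mn) (cong (48 *_) (β≡ u m u>0 K≤u nE m≤ mn)))) (arith K u))
      where
      arith : ∀ K u → 4 * (64 * (48 * (2 * K) * u)) ≡ 24576 * (K * u)
      arith K u = trans (sym (*-assoc 4 64 (48 * (2 * K) * u)))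
        (trans (cong (256 *_) (trans (cong (_* u) (sym (*-assoc 48 2 K))) (*-assoc 96 K u))) (sym (*-assoc 256 96 (K * u))))
    c≤ : c ≤ 2 * (4 * θ)
    c≤ = ≤-trans (+-mono-≤ θ>0 (+-mono-≤ (≤-trans nE uK≤θ) (≤-trans (m≤n*m K u {{>-nonZero u>0}}) uK≤θ))) (≤-trans (≤-reflexive (arith θ)) (≤-trans (*-monoˡ-≤ θ {3} {8} (m≤m+n 3 5)) (≤-reflexive (*-assoc 2 4 θ))))
      where
      arith : ∀ t → t + (t + t) ≡ 3 * t
      arith = solve-∀
    converse-red : ∀ {W} → RedPath red m W ⊎ Embedding.Embedded S _≟_ blue → RedPath (converse b red) m W ⊎ Embedding.Embedded S _≟_ blue
    converse-red (inj₁ p) = inj₁ (converse-path b p)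
    converse-red (inj₂ e) = inj₂ e
    no-gap : ∀ P Q → Unique P → Unique Q → Disj P Q → P ⊑ V → Q ⊑ V → c ≤ length P → c ≤ length Q →
      None (converse b red) P Q → None (converse b red) Q P → Embedding.Embedded S _≟_ blue
    no-gap P Q uP uQ dis P⊑ Q⊑ lP lQ n₁ n₂ with converse-none b n₁ n₂
    ... | nPQ , nQP = embed-in-core (node leaf (take c P) (take c Q) leaf) {V}
        (node P Q nPQ (λ q p → nQP (take-⊑ c q) (take-⊑ c p)) (take-⊑ c) (take-⊑ c) (trans (length-take-≤ c P lP) (sym (length-take-≤ c Q lQ))) leaf leaf P⊑ Q⊑)
        id (subst Unique (sym (++-identityʳ (take c P ++ take c Q))) (unique-++ (Uniqueₚ.take⁺ c uP) (Uniqueₚ.take⁺ c uQ) (λ x y → dis (take-⊑ c x) (take-⊑ c y))))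
        (≤-reflexive (trans (cong (λ z → suc (16 * E * n + z)) (+-identityʳ K)) (sym (trans (+-identityʳ _) (length-take-≤ c P lP)))))

-- Directed trees and pseudorandom tournaments

module _ {A : Set} where

  sum-filterᵇ : ∀ (p : A → Bool) (h : A → ℕ) xs → sum (map (λ i → if p i then h i else 0) xs) ≡ sum (map h (filterᵇ p xs))
  sum-filterᵇ p h [] = refl
  sum-filterᵇ p h (x ∷ xs) with p x
  ... | true = cong (h x +_) (sum-filterᵇ p h xs)
  ... | false = sum-filterᵇ p h xs

  sum-ones : ∀ (xs : List A) → sum (map (λ _ → 1) xs) ≡ length xs
  sum-ones [] = refl
  sum-ones (x ∷ xs) = cong suc (sum-ones xs)

  sum-⊑ : ∀ (h : A → ℕ) {xs ys} → Unique xs → xs ⊑ ys → sum (map h xs) ≤ sum (map h ys)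
  sum-⊑ h {xs} {ys} u s with unique-split u s
  ... | zs , p = ≤-trans (m≤m+n _ (sum (map h zs))) (≤-reflexive (trans (trans (sym (sum-++ (map h xs) _)) (cong sum (sym (map-++ h xs zs)))) (sum-↭ (↭-map⁺ h (↭-sym p)))))

  sum-mono : ∀ {h h′ : A → ℕ} xs → (∀ x → h x ≤ h′ x) → sum (map h xs) ≤ sum (map h′ xs)
  sum-mono [] _ = z≤n
  sum-mono (x ∷ xs) h = +-mono-≤ (h x) (sum-mono xs h)

count≡ : ∀ {n} (p : Fin n → Bool) → count p ≡ length (filterᵇ p (allFin n))
count≡ {n} p = trans (sum-filterᵇ p (λ _ → 1) (allFin n)) (sum-ones (filterᵇ p (allFin n)))

module _ {n : ℕ} (D : Digraph n) where

  edges : List (Fin n × Fin n)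
  edges = concat (map (λ i → map (i ,_) (filterᵇ (D i) (allFin n))) (allFin n))

  length-edges : length edges ≡ edgeCount D
  length-edges = go (allFin n)
    where
    go : ∀ is → length (concat (map (λ i → map (i ,_) (filterᵇ (D i) (allFin n))) is)) ≡ sum (map (λ i → count (λ j → D i j)) is)
    go [] = refl
    go (i ∷ is) = trans (length-++ (map (i ,_) (filterᵇ (D i) (allFin n)))) (cong₂ _+_ (trans (length-map (i ,_) (filterᵇ (D i) (allFin n))) (sym (count≡ (D i)))) (go is))

  length-≤-edgeCount : ∀ {ps} → Unique ps → (∀ {i j} → (i , j) ∈ ps → D i j ≡ true) → length ps ≤ edgeCount D
  length-≤-edgeCount u h = ≤-trans (length-⊑ u λ {(i , j)} p∈ → ∈-concat⁺′ (∈-map⁺ (i ,_) (∈-filterᵇ⁺ (D i) (∈-allFin j) (h p∈))) (∈-map⁺ (λ i → map (i ,_) (filterᵇ (D i) (allFin n))) (∈-allFin i)))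
                             (≤-reflexive length-edges)

record Arborescence {n : ℕ} (E : Digraph n) : Set where
  field
    tree : OutTree n
  open OutTree tree
  field
    edge-par : ∀ {u v} → E u v ≡ true → v ≢ root × par v ≡ u
    par-edge : ∀ {v} → v ≢ root → E (par v) v ≡ true

module _ {n : ℕ} (E : Digraph n) (few : ∀ {ps} → Unique ps → (∀ {i j} → (i , j) ∈ ps → E i j ≡ true) → length ps < n)
         (r : Fin n) (walk : ∀ v → Walk E r v) where

  private
    -- Walks from the root built at their end, so that the last edge, whose source becomes the
    -- parent, is exposed.
    data Reach : Fin n → ℕ → Set where
      base : Reach r 0
      snoc : ∀ {w v d} → Reach w d → E w v ≡ true → Reach v (suc d)

    reach-walk : ∀ {u v d} → Reach u d → Walk E u v → Σ[ d ∈ ℕ ] Reach v d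
    reach-walk p here = _ , p
    reach-walk p (step e w) = reach-walk (snoc p e) w

    reach : ∀ v → Σ[ d ∈ ℕ ] Reach v d
    reach v = reach-walk base (walk v)

    before : ∀ {v d} → Reach v d → Fin n
    before base = r
    before (snoc {w} _ _) = w

    before-edge : ∀ {v d} (p : Reach v d) → v ≢ r → E (before p) v ≡ true
    before-edge base v≢ = contradiction refl v≢
    before-edge (snoc _ e) _ = e

    parent : Fin n → Fin n
    parent v = before (proj₂ (reach v))

    others : List (Fin n)
    others = filter (λ v → ¬? (v Finₚ.≟ r)) (allFin n)

    parents : List (Fin n × Fin n)
    parents = map (λ v → parent v , v) others

    unique-parents : Unique parents
    unique-parents = Uniqueₚ.map⁺ (cong proj₂) (Uniqueₚ.filter⁺ (λ v → ¬? (v Finₚ.≟ r)) (Uniqueₚ.allFin⁺ n))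

    n≤parents : n ≤ suc (length parents)
    n≤parents = ≤-trans (≤-reflexive (sym (length-tabulate id))) (≤-trans (length-⊑ {ys = r ∷ others} (Uniqueₚ.allFin⁺ n) cover) (≤-reflexive (cong suc (sym (length-map (λ v → parent v , v) others)))))
      where
      cover : allFin n ⊑ r ∷ others
      cover {v} v∈ with v Finₚ.≟ r
      ... | yes e = here e
      ... | no q = there (∈-filter⁺ (λ v → ¬? (v Finₚ.≟ r)) v∈ q)

    parents-edges : ∀ {i j} → (i , j) ∈ parents → j ≢ r × parent j ≡ i
    parents-edges p with ∈-map⁻ (λ v → parent v , v) p
    ... | v , v∈ , refl = proj₂ (∈-filter⁻ (λ v → ¬? (v Finₚ.≟ r)) {xs = allFin n} v∈) , refl

    -- The n - 1 parent edges exhaust the edges.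
    only-parents : ∀ {u v} → E u v ≡ true → v ≢ r × parent v ≡ u
    only-parents {u} {v} e with v Finₚ.≟ r | parent v Finₚ.≟ u
    ... | no v≢ | yes p = v≢ , p
    ... | yes v≡ | _ = contradiction (few (unique-cons (λ q → proj₁ (parents-edges q) v≡) unique-parents)
            λ { (here refl) → e ; (there q) → subst (λ z → E z _ ≡ true) (proj₂ (parents-edges q)) (before-edge (proj₂ (reach _)) (proj₁ (parents-edges q))) })
            (≤⇒≯ n≤parents)
    ... | no _ | no p≢ = contradiction (few (unique-cons (λ q → p≢ (proj₂ (parents-edges q))) unique-parents)
            λ { (here refl) → e ; (there q) → subst (λ z → E z _ ≡ true) (proj₂ (parents-edges q)) (before-edge (proj₂ (reach _)) (proj₁ (parents-edges q))) })
            (≤⇒≯ n≤parents)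

    -- No edge enters the root and only the parent edge enters any other vertex, so a walk from the
    -- root is determined backwards. This makes the walk length a depth that drops by one at the
    -- parent.
    reach-unique : ∀ {v d d′} → Reach v d → Reach v d′ → d ≡ d′
    reach-unique base base = refl
    reach-unique base (snoc _ e) = contradiction refl (proj₁ (only-parents e))
    reach-unique (snoc _ e) base = contradiction refl (proj₁ (only-parents e))
    reach-unique (snoc p e) (snoc p′ e′) with trans (sym (proj₂ (only-parents e))) (proj₂ (only-parents e′))
    ... | refl = cong suc (reach-unique p p′)

  arborescence : Arborescence E
  arborescence = record
    { tree = record { root = r ; par = parent ; depth = λ v → proj₁ (reach v) ; depth-par = λ v v≢ → drop-one v≢ (proj₂ (reach v)) }
    ; edge-par = only-parents
    ; par-edge = λ {v} → before-edge (proj₂ (reach v)) }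
    where
    drop-one : ∀ {v d} → v ≢ r → (p : Reach v d) → proj₁ (reach (before p)) < d
    drop-one v≢ base = contradiction refl v≢
    drop-one v≢ (snoc {w} p _) = s≤s (≤-reflexive (reach-unique (proj₂ (reach w)) p))

below-size : ∀ {x e n} → e + 1 ≡ n → x ≤ e → x < n
below-size {x} {e} eq h = subst (x <_) eq (subst (x <_) (+-comm 1 e) (s≤s h))

directed-arborescence : ∀ {n} {D : Digraph n} → IsDirectedTree D → Σ[ b ∈ Bool ] Arborescence (converse b D)
directed-arborescence {n} {D} ((_ , _ , size) , r , inj₁ out) = false , arborescence D (λ u h → below-size size (length-≤-edgeCount D u h)) r out
directed-arborescence {n} {D} ((_ , _ , size) , r , inj₂ into) = true , arborescence (converse true D)
  (λ {ps} u h → below-size size (≤-trans (≤-reflexive (sym (length-map flip ps)))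
     (length-≤-edgeCount D (Uniqueₚ.map⁺ flip-injective u) λ p → flipped h p))) r (λ v → reverse-walk (into v) here)
  where
  flip : Fin n × Fin n → Fin n × Fin n
  flip (i , j) = j , i
  flip-injective : ∀ {p q} → flip p ≡ flip q → p ≡ q
  flip-injective refl = refl
  flipped : ∀ {ps} → (∀ {i j} → (i , j) ∈ ps → D j i ≡ true) → ∀ {i j} → (i , j) ∈ map flip ps → D i j ≡ true
  flipped h p with ∈-map⁻ flip p
  ... | (j , i) , q , refl = h q
  reverse-walk : ∀ {u v w} → Walk D u w → Walk (converse true D) u v → Walk (converse true D) w v
  reverse-walk here acc = acc
  reverse-walk (step e p) acc = reverse-walk p (step e acc)

und-edge : ∀ {n} {D : Digraph n} b {u v} → Und D u v ≡ true → converse b D u v ≡ true ⊎ converse b D v u ≡ true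
und-edge {D = D} b {u} {v} e with b | D u v in e₁
... | false | true = inj₁ e₁
... | true | true = inj₂ e₁
... | false | false = inj₂ e
... | true | false = inj₁ e

edge-und : ∀ {n} {D : Digraph n} b {u v} → converse b D v u ≡ true → Und D u v ≡ true
edge-und {D = D} true {u} {v} e = cong (_∨ D v u) e
edge-und {D = D} false {u} {v} e = trans (cong (D u v ∨_) e) (∨-zeroʳ (D u v))

module _ {n : ℕ} {D : Digraph n} (b : Bool) (𝒜 : Arborescence (converse b D)) where
  open Arborescence 𝒜
  open OutTree tree

  private
    isSink : Fin n → Bool
    isSink v = does (length (ch v) ≤? 0)

    isSink-true : ∀ {v} → ch v ≡ [] → isSink v ≡ true
    isSink-true {v} e = does-yes (length (ch v) ≤? 0) (subst (λ c → length c ≤ 0) (sym e) z≤n)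

    sink-empty : ∀ {v w} → isSink v ≡ true → w ∉ ch v
    sink-empty {v} e w∈ with ch v | does-true (length (ch v) ≤? 0) e
    sink-empty e () | [] | _

    root-child : ∀ fuel v → depth v < fuel → v ≢ root → Σ[ c ∈ Fin n ] c ∈ ch root
    root-child (suc fuel) v (s≤s h) v≢ with par v Finₚ.≟ root
    ... | yes e = v , ∈-ch⁺ v≢ e
    ... | no q = root-child fuel (par v) (<-≤-trans (depth-par v v≢) h) q

    sink-degree : ∀ {v} → v ≢ root → isSink v ≡ true → degree D v ≡ 1
    sink-degree {v} v≢ e = trans (count≡ (Und D v)) (≤-antisym
      (length-⊑ {ys = [ par v ]} (unique-filterᵇ (Und D v) (Uniqueₚ.allFin⁺ n)) only)
      (length-⊑ {xs = [ par v ]} ([] ∷ []) λ { (here refl) → ∈-filterᵇ⁺ (Und D v) (∈-allFin (par v)) (edge-und {D = D} b (par-edge v≢)) }))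
      where
      only : filterᵇ (Und D v) (allFin n) ⊑ [ par v ]
      only {w} p with und-edge {D = D} b (proj₂ (∈-filterᵇ⁻ (Und D v) {xs = allFin n} p))
      ... | inj₂ d = here (sym (proj₂ (edge-par d)))
      ... | inj₁ d with edge-par d
      ... | w≢ , pw = contradiction (∈-ch⁺ w≢ pw) (sink-empty e)

  sinks : List (Fin n)
  sinks = filterᵇ isSink (allFin n)

  ∈-sinks : ∀ v → ch v ≡ [] → v ∈ sinks
  ∈-sinks v e = ∈-filterᵇ⁺ isSink (∈-allFin v) (isSink-true e)

  -- A childless vertex other than the root has its parent as its only neighbour, so it is a leaf. A
  -- childless root is the whole tree; it has degree 0 and is counted by `0 < k` instead.
  sinks-leaves : ∀ k → 0 < k → leaves D ≤ k → length sinks ≤ k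
  sinks-leaves k k>0 h with isSink root in e
  ... | true = ≤-trans (length-⊑ {ys = [ root ]} (unique-filterᵇ isSink (Uniqueₚ.allFin⁺ n)) only-root) k>0
    where
    only-root : sinks ⊑ [ root ]
    only-root {v} _ with v Finₚ.≟ root
    ... | yes p = here p
    ... | no q with root-child (suc (depth v)) v ≤-refl q
    ... | c , c∈ = contradiction c∈ (sink-empty e)
  ... | false = ≤-trans (length-⊑ (unique-filterᵇ isSink (Uniqueₚ.allFin⁺ n)) sub) (≤-trans (≤-reflexive (sym (count≡ (λ i → degree D i ≡ᵇ 1)))) h)
    where
    sub : sinks ⊑ filterᵇ (λ i → degree D i ≡ᵇ 1) (allFin n)
    sub {v} p with ∈-filterᵇ⁻ isSink {xs = allFin n} p
    ... | _ , s = ∈-filterᵇ⁺ (λ i → degree D i ≡ᵇ 1) (∈-allFin v) (cong (_≡ᵇ 1) (sink-degree (λ { refl → contradiction (trans (sym s) e) λ () }) s))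

subset-size : ∀ {n} (p : Fin n → Bool) → Subset.∣ tabulate p ∣ ≡ length (filterᵇ p (allFin n))
subset-size {n} p = go n id
  where
  go : ∀ k (f : Fin k → Fin n) → Subset.∣ tabulate (p ∘ f) ∣ ≡ length (filterᵇ p (List.tabulate f))
  go zero f = refl
  go (suc k) f with p (f Fin.zero)
  ... | true = cong suc (go k (f ∘ Fin.suc))
  ... | false = go k (f ∘ Fin.suc)

module _ {N : ℕ} (G : Digraph N) where

  edgesBetween-converse : ∀ X Y → edgesBetween G X Y ≡ edgesBetween (converse true G) Y X
  edgesBetween-converse [] Y = sym (empty Y)
    where
    empty : ∀ Y → edgesBetween (converse true G) Y [] ≡ 0
    empty [] = refl
    empty (y ∷ Y) = empty Y
  edgesBetween-converse (x ∷ X) Y = trans (cong (deg G x Y +_) (edgesBetween-converse X Y)) (add Y)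
    where
    add : ∀ Y → deg G x Y + edgesBetween (converse true G) Y X ≡ edgesBetween (converse true G) Y (x ∷ X)
    add [] = refl
    add (y ∷ Y) with G x y
    ... | true = cong suc (trans (arith (deg G x Y) (deg (converse true G) y X) _) (cong (deg (converse true G) y X +_) (add Y)))
      where
      arith : ∀ a b c → a + (b + c) ≡ b + (a + c)
      arith = solve-∀
    ... | false = trans (arith (deg G x Y) (deg (converse true G) y X) _) (cong (deg (converse true G) y X +_) (add Y))
      where
      arith : ∀ a b c → a + (b + c) ≡ b + (a + c)
      arith = solve-∀

  module _ (εn εd σn σd L : ℕ) (εn>0 : 0 < εn) (σd>0 : 0 < σd) (N≤ : N ≤ 2 ^ L) (pr : IsPseudorandomLog εn εd σn σd G) where
    open DecMembership (Finₚ._≟_ {N}) using (_∈?_)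

    private
      mem : List (Fin N) → Fin N → Bool
      mem X i = does (i ∈? X)

      -- `L` is an integer upper bound of log N and `σd` is at least 1, so `σn * L` vertices exceed
      -- the real threshold.
      big : ∀ {X} → Unique X → σn * L ≤ length X → N ^ σn ≤ 2 ^ (σd * Subset.∣ tabulate (mem X) ∣)
      big {X} u h = begin
        N ^ σn ≤⟨ ^-monoˡ-≤ σn N≤ ⟩
        (2 ^ L) ^ σn ≡⟨ ^-*-assoc 2 L σn ⟩
        2 ^ (L * σn) ≤⟨ ^-monoʳ-≤ 2 (≤-trans (≤-reflexive (*-comm L σn)) (≤-trans h (≤-trans (length-⊑ u sub)
                          (≤-trans (≤-reflexive (sym (subset-size (mem X)))) (m≤n*m _ σd {{>-nonZero σd>0}}))))) ⟩
        2 ^ (σd * Subset.∣ tabulate (mem X) ∣) ∎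
        where
        open ≤-Reasoning
        sub : X ⊑ filterᵇ (mem X) (allFin N)
        sub {x} x∈ = ∈-filterᵇ⁺ (mem X) (∈-allFin x) (does-yes (x ∈? X) x∈)

      filter-mem : ∀ X → filterᵇ (mem X) (allFin N) ⊑ X
      filter-mem X {x} p = does-true (x ∈? X) (proj₂ (∈-filterᵇ⁻ (mem X) {xs = allFin N} p))

      size : ∀ {X} → Unique X → length X ≤ Subset.∣ tabulate (mem X) ∣
      size {X} u = ≤-trans (length-⊑ u (λ {x} x∈ → ∈-filterᵇ⁺ (mem X) (∈-allFin x) (does-yes (x ∈? X) x∈))) (≤-reflexive (sym (subset-size (mem X))))

      edges≤ : ∀ X Y → edgesFromTo G (tabulate (mem X)) (tabulate (mem Y)) ≤ edgesBetween G X Y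
      edges≤ X Y = begin
        edgesFromTo G (tabulate (mem X)) (tabulate (mem Y)) ≤⟨ sum-mono (allFin N) row ⟩
        sum (map (λ i → if mem X i then deg G i Y else 0) (allFin N)) ≡⟨ sum-filterᵇ (mem X) (λ i → deg G i Y) (allFin N) ⟩
        sum (map (λ i → deg G i Y) (filterᵇ (mem X) (allFin N))) ≤⟨ sum-⊑ (λ i → deg G i Y) (unique-filterᵇ (mem X) (Uniqueₚ.allFin⁺ N)) (filter-mem X) ⟩
        edgesBetween G X Y ∎
        where
        open ≤-Reasoning
        entry : Fin N → Fin N → Bool
        entry i j = lookup (tabulate (mem X)) i ∧ lookup (tabulate (mem Y)) j ∧ G i j
        row : ∀ i → count (entry i) ≤ (if mem X i then deg G i Y else 0)
        row i = ≤-trans (≤-reflexive (count≡ (entry i))) (go (mem X i) (lookup∘tabulate (mem X) i))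
          where
          row-in : ∀ c → lookup (tabulate (mem X)) i ≡ c → filterᵇ (entry i) (allFin N) ⊑ filterᵇ (λ j → c ∧ mem Y j ∧ G i j) (allFin N)
          row-in c e {j} p with ∈-filterᵇ⁻ (entry i) {xs = allFin N} p
          ... | _ , t = ∈-filterᵇ⁺ (λ j → c ∧ mem Y j ∧ G i j) (∈-allFin j) (trans (cong₂ (λ a b → a ∧ b ∧ G i j) (sym e) (sym (lookup∘tabulate (mem Y) j))) t)
          go : ∀ c → lookup (tabulate (mem X)) i ≡ c → length (filterᵇ (entry i) (allFin N)) ≤ (if c then deg G i Y else 0)
          go true e = length-⊑ (unique-filterᵇ (entry i) (Uniqueₚ.allFin⁺ N)) λ p → in-row (∈-filterᵇ⁻ (λ j → true ∧ mem Y j ∧ G i j) {xs = allFin N} (row-in true e p))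
            where
            in-row : ∀ {j} → j ∈ allFin N × mem Y j ∧ G i j ≡ true → j ∈ filterᵇ (G i) Y
            in-row {j} (_ , t) with j ∈? Y
            ... | yes j∈ = ∈-filterᵇ⁺ (G i) j∈ t
          go false e = length-⊑ {ys = []} (unique-filterᵇ (entry i) (Uniqueₚ.allFin⁺ N)) λ {j} p → none {j} (proj₂ (∈-filterᵇ⁻ (λ j → false ∧ mem Y j ∧ G i j) {xs = allFin N} (row-in false e p)))
            where
            none : ∀ {j : Fin N} → false ≡ true → j ∈ []
            none ()

    dense-lists : ∀ {X Y} → Unique X → Unique Y → Disj X Y → σn * L ≤ length X → σn * L ≤ length Y → length X * length Y ≤ εd * edgesBetween G X Y
    dense-lists {X} {Y} uX uY dis hX hY = begin
      length X * length Y ≤⟨ *-mono-≤ (≤-trans (size uX) (m≤n*m _ εn {{>-nonZero εn>0}})) (size uY) ⟩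
      εn * Subset.∣ tabulate (mem X) ∣ * Subset.∣ tabulate (mem Y) ∣ ≤⟨ pr (tabulate (mem X)) (tabulate (mem Y)) disjoint (big uX hX) (big uY hY) ⟩
      εd * edgesFromTo G (tabulate (mem X)) (tabulate (mem Y)) ≤⟨ *-monoʳ-≤ εd (edges≤ X Y) ⟩
      εd * edgesBetween G X Y ∎
      where
      open ≤-Reasoning
      in-list : ∀ Z {i} → i Subset.∈ tabulate (mem Z) → i ∈ Z
      in-list Z {i} p = does-true (i ∈? Z) (trans (sym (lookup∘tabulate (mem Z) i)) ([]=⇒lookup p))
      disjoint : Disjoint (tabulate (mem X)) (tabulate (mem Y))
      disjoint i p q = dis (in-list X p) (in-list Y q)

    dense-converse : ∀ b {X Y} → Unique X → Unique Y → Disj X Y → σn * L ≤ length X → σn * L ≤ length Y →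
      length X * length Y ≤ εd * edgesBetween (converse b G) X Y
    dense-converse false = dense-lists
    dense-converse true {X} {Y} uX uY dis hX hY = ≤-trans (≤-reflexive (*-comm (length X) (length Y)))
      (≤-trans (dense-lists uY uX (λ a b → dis b a) hY hX) (≤-reflexive (cong (εd *_) (edgesBetween-converse Y X))))

-- Logarithms and constants

suc≤2^ : ∀ y → suc y ≤ 2 ^ y
suc≤2^ zero = ≤-refl
suc≤2^ (suc y) = ≤-trans (+-mono-≤ {1} {suc y} (s≤s z≤n) (≤-reflexive (sym (+-identityʳ (suc y))))) (*-monoʳ-≤ 2 (suc≤2^ y))

log-floor : ∀ N → 0 < N → Σ[ l ∈ ℕ ] 2 ^ l ≤ N × N < 2 ^ suc l
log-floor (suc zero) _ = 0 , ≤-refl , ≤-refl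
log-floor (suc (suc N)) _ with log-floor (suc N) (s≤s z≤n)
... | l , lo , hi with suc (suc N) <? 2 ^ suc l
... | yes lt = l , ≤-trans lo (n≤1+n _) , lt
... | no ge = suc l , ≮⇒≥ ge , ≤-<-trans hi (^-monoʳ-< 2 (s≤s (s≤s z≤n)) (n<1+n (suc l)))

-- With y = l/3 rounded down, both l + 1 and 27C are at most 3(y + 1), so the left side is at most
-- the cube of y + 1: two factors come from l + 1 and the third absorbs 9C.
square≤2^ : ∀ C l → 27 * C ≤ l → C * (suc l * suc l) ≤ 2 ^ l
square≤2^ C l h = begin
  C * (suc l * suc l) ≤⟨ *-monoʳ-≤ C (*-mono-≤ l≤ l≤) ⟩
  C * (3 * suc y * (3 * suc y)) ≡⟨ arith C (suc y) ⟩
  9 * C * (suc y * suc y) ≤⟨ *-monoˡ-≤ (suc y * suc y) C≤ ⟩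
  suc y * (suc y * suc y) ≤⟨ *-mono-≤ (suc≤2^ y) (*-mono-≤ (suc≤2^ y) (suc≤2^ y)) ⟩
  2 ^ y * (2 ^ y * 2 ^ y) ≡⟨ arith′ (2 ^ y) ⟩
  (2 ^ y) ^ 3 ≡⟨ ^-*-assoc 2 y 3 ⟩
  2 ^ (y * 3) ≤⟨ ^-monoʳ-≤ 2 (m/n*n≤m l 3) ⟩
  2 ^ l ∎
  where
  open ≤-Reasoning
  y = l / 3
  l≤ : suc l ≤ 3 * suc y
  l≤ = begin
    suc l ≡⟨ cong suc (m≡m%n+[m/n]*n l 3) ⟩
    suc (l % 3) + y * 3 ≤⟨ +-monoˡ-≤ (y * 3) (m%n<n l 3) ⟩
    3 + y * 3 ≡⟨ *-comm (suc y) 3 ⟩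
    3 * suc y ∎
  C≤ : 9 * C ≤ suc y
  C≤ = *-cancelˡ-≤ 3 (≤-trans (≤-reflexive (sym (*-assoc 3 9 C))) (≤-trans h (≤-trans (n≤1+n l) l≤)))
  arith : ∀ C y → C * (3 * y * (3 * y)) ≡ 9 * C * (y * y)
  arith = solve-∀
  arith′ : ∀ a → a * (a * a) ≡ a * (a * (a * 1))
  arith′ = solve-∀

2^-cancel-≤ : ∀ {x y} → 2 ^ x ≤ 2 ^ y → x ≤ y
2^-cancel-≤ h = ≮⇒≥ λ lt → <⇒≱ (^-monoʳ-< 2 (s≤s (s≤s z≤n)) lt) h

module _ (E M K n m N l c₀ : ℕ) (M>0 : 0 < M) (K>0 : 0 < K) (l>0 : 0 < l) (2^l≤ : 2 ^ l ≤ N)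
         (K≤ : K ≤ c₀ * suc l) (large : 27 * (M * (c₀ * c₀)) ≤ l)
         (En≤ : 2 * M * (16 * E * n) ≤ N) (m≤ : 2 * M * m ≤ N) (mn≤ : 8 * M * M * c₀ * (l * (m * n)) ≤ N * N) where

  -- `u` is the largest number with `M * (K * u) ≤ N`. `K ≤ u` means that `M` `K`², of order log² N,
  -- is at most N; this is what `large` ensures. As `u` is positive, rounding loses at most a factor
  -- 2, so N is at most 2`M` `u` `K`, and the hypotheses on n, m and mn are divided by this bound or
  -- its square.
  choose-scale : Σ[ u ∈ ℕ ] 0 < u × K ≤ u × 16 * E * n ≤ u * K × m ≤ u * K × m * n ≤ K * (u * u) × M * (K * u) ≤ N
  choose-scale = u , u>0 , K≤u , cancel En≤ , cancel m≤ , product , ≤-trans (≤-reflexive (arith M K u)) (m/n*n≤m N D)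
    where
    open ≤-Reasoning
    D = M * K
    D>0 : 0 < D
    D>0 = *-mono-≤ M>0 K>0
    instance
      D≢0 : NonZero D
      D≢0 = >-nonZero D>0
      M≢0 : NonZero M
      M≢0 = >-nonZero M>0
      K≢0 : NonZero K
      K≢0 = >-nonZero K>0
    u = N / D
    arith : ∀ M K u → M * (K * u) ≡ u * (M * K)
    arith = solve-∀
    N< : N < D + u * D
    N< = ≤-<-trans (≤-reflexive (m≡m%n+[m/n]*n N D)) (+-monoˡ-< (u * D) (m%n<n N D))
    DK≤N : D * K ≤ N
    DK≤N = begin
      M * K * K ≤⟨ *-mono-≤ (*-monoʳ-≤ M K≤) K≤ ⟩
      M * (c₀ * suc l) * (c₀ * suc l) ≡⟨ arith′ M c₀ (suc l) ⟩
      M * (c₀ * c₀) * (suc l * suc l) ≤⟨ square≤2^ (M * (c₀ * c₀)) l large ⟩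
      2 ^ l ≤⟨ 2^l≤ ⟩
      N ∎
      where
      arith′ : ∀ M c s → M * (c * s) * (c * s) ≡ M * (c * c) * (s * s)
      arith′ = solve-∀
    K≤u : K ≤ u
    K≤u = s≤s⁻¹ (*-cancelˡ-< D K (suc u) (≤-<-trans DK≤N (<-≤-trans N< (≤-reflexive (*-comm (suc u) D)))))
    u>0 : 0 < u
    u>0 = ≤-trans K>0 K≤u
    N≤ : N ≤ 2 * M * (u * K)
    N≤ = begin
      N ≤⟨ <⇒≤ N< ⟩
      D + u * D ≤⟨ +-monoˡ-≤ (u * D) (m≤n*m D u {{>-nonZero u>0}}) ⟩
      u * D + u * D ≡⟨ arith′ M K u ⟩
      2 * M * (u * K) ∎
      where
      arith′ : ∀ M K u → u * (M * K) + u * (M * K) ≡ 2 * M * (u * K)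
      arith′ = solve-∀
    cancel : ∀ {x} → 2 * M * x ≤ N → x ≤ u * K
    cancel h = *-cancelˡ-≤ (2 * M) {{m*n≢0 2 M}} (≤-trans h N≤)
    product : m * n ≤ K * (u * u)
    product = *-cancelˡ-≤ (4 * (M * (M * K))) {{m*n≢0 4 (M * (M * K)) {{_}} {{m*n≢0 M (M * K)}}}} (begin
      4 * (M * (M * K)) * (m * n) ≤⟨ *-monoˡ-≤ (m * n) (*-monoʳ-≤ 4 (*-monoʳ-≤ M (*-monoʳ-≤ M (≤-trans K≤ (*-monoʳ-≤ c₀ (+-monoˡ-≤ l l>0)))))) ⟩
      4 * (M * (M * (c₀ * (l + l)))) * (m * n) ≡⟨ arith₁ M c₀ l (m * n) ⟩
      8 * M * M * c₀ * (l * (m * n)) ≤⟨ mn≤ ⟩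
      N * N ≤⟨ *-mono-≤ N≤ N≤ ⟩
      2 * M * (u * K) * (2 * M * (u * K)) ≡⟨ arith₂ M u K ⟩
      4 * (M * (M * K)) * (K * (u * u)) ∎)
      where
      arith₁ : ∀ M c l x → 4 * (M * (M * (c * (l + l)))) * x ≡ 8 * M * M * c * (l * x)
      arith₁ = solve-∀
      arith₂ : ∀ M u K → 2 * M * (u * K) * (2 * M * (u * K)) ≡ 4 * (M * (M * K)) * (K * (u * u))
      arith₂ = solve-∀

converse-edge : ∀ {n N} {D : Digraph n} b (𝒜 : Arborescence (converse b D)) (c : Fin N → Fin N → Bool) →
  Embedding.Embedded (Arborescence.tree 𝒜) Finₚ._≟_ (converse b c) →
  Σ[ f ∈ (Fin n → Fin N) ] (∀ {x y} → f x ≡ f y → x ≡ y) × (∀ u v → D u v ≡ true → c (f u) (f v) ≡ true)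
converse-edge false 𝒜 c (f , inj , edge) = f , inj , λ u v e → let (v≢ , p) = Arborescence.edge-par 𝒜 e in
  subst (λ z → c (f z) (f v) ≡ true) p (edge v v≢)
converse-edge true 𝒜 c (f , inj , edge) = f , inj , λ u v e → let (u≢ , p) = Arborescence.edge-par 𝒜 e in
  subst (λ z → c (f u) (f z) ≡ true) p (edge u u≢)

-- If S is directed towards its root, the whole tournament is reversed; the direction of T must then
-- be read in the reversed tournament.
flips : Bool → Bool → Bool
flips false b = b
flips true b = not b

converse-flips : ∀ {A : Set} (r : A → A → Bool) a b x y → converse (flips a b) (converse a r) x y ≡ converse b r x y
converse-flips r false b x y = refl
converse-flips r true false x y = refl
converse-flips r true true x y = refl

module _ (εn E₀ σn σd k N : ℕ) (εn>0 : 0 < εn) (σn>0 : 0 < σn) (σd>0 : 0 < σd) (G : Digraph N) (tournament : IsTournament G)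
         (pr : IsPseudorandomLog εn (suc E₀) σn σd G) (col : Colouring N) where

  redEdge blueEdge : Fin N → Fin N → Bool
  redEdge x y = G x y ∧ not (col x y)
  blueEdge x y = G x y ∧ col x y

  coloured : ∀ b l → N ≤ 2 ^ suc l → Coloured (Fin N)
  coloured b l N≤ = record
    { _≟_ = Finₚ._≟_ ; g = converse b G ; red = converse b redEdge ; blue = converse b blueEdge ; E₀ = E₀ ; k = σn * suc l
    ; irr = irr b ; blue-rest = rest b ; total = total b ; k>0 = *-mono-≤ σn>0 (s≤s z≤n)
    ; dense = dense-converse G εn (suc E₀) σn σd (suc l) εn>0 σd>0 N≤ pr b }
    where
    irr : ∀ b x → converse b redEdge x x ≡ false
    irr false x = cong (_∧ not (col x x)) (proj₁ tournament x)
    irr true x = cong (_∧ not (col x x)) (proj₁ tournament x)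
    rest′ : ∀ x y → G x y ≡ true → redEdge x y ≡ false → blueEdge x y ≡ true
    rest′ x y e e′ with G x y | col x y
    ... | true | true = refl
    rest : ∀ b {x y} → converse b G x y ≡ true → converse b redEdge x y ≡ false → converse b blueEdge x y ≡ true
    rest false = rest′ _ _
    rest true = rest′ _ _
    total′ : ∀ {x y} → x ≢ y → G x y ≡ true ⊎ G y x ≡ true
    total′ {x} {y} x≢y with G x y | G y x | proj₂ tournament x y x≢y
    ... | true | _ | _ = inj₁ refl
    ... | false | true | _ = inj₂ refl
    total : ∀ b {x y} → x ≢ y → converse b G x y ≡ true ⊎ converse b G y x ≡ true
    total false = total′
    total true x≢y = total′ (x≢y ∘ sym)

  mono-copy : ∀ {n} {D : Digraph n} b (𝒜 : Arborescence (converse b D)) →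
    Embedding.Embedded (Arborescence.tree 𝒜) Finₚ._≟_ (converse b blueEdge) → MonoCopy G col true D
  mono-copy b 𝒜 e with converse-edge b 𝒜 blueEdge e
  ... | f , inj , edge = f , inj , λ u v d → split (f u) (f v) (edge u v d)
    where
    split : ∀ x y → blueEdge x y ≡ true → G x y ≡ true × col x y ≡ true
    split x y e with G x y | col x y
    ... | true | true = refl , refl

  red-copy : ∀ {n} {D : Digraph n} b (𝒜 : Arborescence (converse b D)) →
    Embedding.Embedded (Arborescence.tree 𝒜) Finₚ._≟_ (converse b redEdge) → MonoCopy G col false D
  red-copy b 𝒜 e with converse-edge b 𝒜 redEdge e
  ... | f , inj , edge = f , inj , λ u v d → split (f u) (f v) (edge u v d)
    where
    split : ∀ x y → redEdge x y ≡ true → G x y ≡ true × col x y ≡ false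
    split x y e with G x y | col x y
    ... | true | false = refl , refl

  -- With `σn * suc l` as `k`, each of the three terms of `K` is at most its coefficient times
  -- `suc E₀ * σn * suc l`, and 2 + 8 + 16 = 26.
  c₀ : ℕ
  c₀ = 26 * suc E₀ * σn

  module _ {n m : ℕ} {S : Digraph n} {T : Digraph m} (tS : IsDirectedTree S) (tT : IsDirectedTree T) (k>0 : 0 < k) (few : leaves T ≤ k)
           (M : ℕ) (M≡ : 8 ^ k * 24576 ≡ M) (l : ℕ) (2^l≤ : 2 ^ l ≤ N) (N< : N < 2 ^ suc l) (l>0 : 0 < l)
           (large : 27 * (M * (c₀ * c₀)) ≤ l)
           (En≤ : 2 * M * (16 * suc E₀ * n) ≤ N) (m≤ : 2 * M * m ≤ N) (mn≤ : 8 * M * M * c₀ * (l * (m * n)) ≤ N * N) where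

    copies : MonoCopy G col true S ⊎ MonoCopy G col false T
    copies with directed-arborescence tS | directed-arborescence tT
    ... | a , 𝒮 | b , 𝒯 = finish (choose-scale (suc E₀) M K n m N l c₀ M>0 K>0 l>0 2^l≤ K≤ large En≤ m≤ mn≤)
      where
      𝒢 = coloured a l (<⇒≤ N<)
      uN : Unique (allFin N)
      uN = Uniqueₚ.allFin⁺ N
      open EventPlan 𝒢 (allFin N) uN (Arborescence.tree 𝒮) using (K; K≡; K>0)
      M>0 : 0 < M
      M>0 = subst (0 <_) M≡ (*-mono-≤ (m^n>0 8 k) (s≤s (z≤n {24575})))
      κ = σn * suc l
      K≤ : K ≤ c₀ * suc l
      K≤ = begin
        K ≡⟨ K≡ ⟩
        2 * κ + 8 * suc E₀ + 16 * suc E₀ * κ ≤⟨ +-monoˡ-≤ (16 * suc E₀ * κ) (+-mono-≤ (*-monoʳ-≤ 2 (m≤n*m κ (suc E₀))) (*-monoʳ-≤ 8 (m≤m*n (suc E₀) κ {{>-nonZero (*-mono-≤ σn>0 (s≤s (z≤n {l})))}}))) ⟩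
        2 * (suc E₀ * κ) + 8 * (suc E₀ * κ) + 16 * suc E₀ * κ ≡⟨ arith (suc E₀) σn (suc l) ⟩
        c₀ * suc l ∎
        where
        open ≤-Reasoning
        arith : ∀ E s l → 2 * (E * (s * l)) + 8 * (E * (s * l)) + 16 * E * (s * l) ≡ 26 * E * s * l
        arith = solve-∀
      zs = sinks b 𝒯
      finish : Σ[ u ∈ ℕ ] 0 < u × K ≤ u × 16 * suc E₀ * n ≤ u * K × m ≤ u * K × m * n ≤ K * (u * u) × M * (K * u) ≤ N →
        MonoCopy G col true S ⊎ MonoCopy G col false T
      finish (u , u>0 , K≤u , En , m≤′ , mn , fits) = result (blue-or-red 𝒢 (allFin N) uN (Arborescence.tree 𝒮) (Arborescence.tree 𝒯) (flips a b)
          u u>0 K≤u En m≤′ mn zs (∈-sinks b 𝒯) room)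
        where
        open ≤-Reasoning
        room : 8 ^ length zs * (24576 * (K * u)) ≤ length (allFin N)
        room = begin
          8 ^ length zs * (24576 * (K * u)) ≤⟨ *-monoˡ-≤ (24576 * (K * u)) (^-monoʳ-≤ 8 (sinks-leaves b 𝒯 k k>0 few)) ⟩
          8 ^ k * (24576 * (K * u)) ≡⟨ sym (*-assoc (8 ^ k) 24576 (K * u)) ⟩
          8 ^ k * 24576 * (K * u) ≡⟨ cong (_* (K * u)) M≡ ⟩
          M * (K * u) ≤⟨ fits ⟩
          N ≡⟨ sym (length-tabulate id) ⟩
          length (allFin N) ∎
        result : Embedding.Embedded (Arborescence.tree 𝒯) Finₚ._≟_ (converse (flips a b) (converse a redEdge)) ⊎
                 Embedding.Embedded (Arborescence.tree 𝒮) Finₚ._≟_ (converse a blueEdge) → MonoCopy G col true S ⊎ MonoCopy G col false T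
        result (inj₂ e) = inj₁ (mono-copy a 𝒮 e)
        result (inj₁ (f , inj , edge)) = inj₂ (red-copy b 𝒯 (f , inj , λ v v≢ → trans (sym (converse-flips redEdge a b _ _)) (edge v v≢)))

directed-tree-nonempty : ∀ {n} {D : Digraph n} → IsDirectedTree D → 0 < n
directed-tree-nonempty ((_ , _ , size) , _) = below-size size z≤n

theorem5p1 : (εn εd σn σd k : ℕ) → 0 < εn → 2 * εn < εd → 0 < σn → 0 < σd → 0 < k →
  Σ ℕ (λ ca → Σ ℕ (λ cb → 0 < ca × 0 < cb ×
    (∀ (N : ℕ) (G : Digraph N) → IsTournament G → IsPseudorandomLog εn εd σn σd G →
     ∀ (n : ℕ) (S : Digraph n) → IsDirectedTree S →
     ∀ (m : ℕ) (T : Digraph m) → IsDirectedTree T → leaves T ≤ k →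
     ca * n ≤ cb * N → ca * m ≤ cb * N →
     N ^ (ca * ca * n * m) ≤ 2 ^ (cb * cb * N * N) →
     Arrows G S T)))
theorem5p1 εn zero σn σd k εn>0 () σn>0 σd>0 k>0
theorem5p1 εn (suc E₀) σn σd k εn>0 _ σn>0 σd>0 k>0 = ca (8 ^ k * 24576) , 1 , s≤s z≤n , s≤s z≤n ,
  λ N G tour pr n S tS m T tT few n≤ m≤ nm≤ col → go (8 ^ k * 24576) refl N G tour pr tS tT few n≤ m≤ nm≤ col
  where
  c = 26 * suc E₀ * σn
  C : ℕ → ℕ
  C M = 27 * (M * (c * c))
  -- One summand for each requirement. As n is positive, `ca` is at most N, so the power of 2 makes
  -- log N at least `C M`. The second summand gives the linear bounds on n and m, the third the
  -- bound on nm.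
  ca : ℕ → ℕ
  ca M = suc (2 ^ C M + (2 * M * (16 * suc E₀) + 8 * M * M * c))
  go : ∀ M → 8 ^ k * 24576 ≡ M → ∀ N (G : Digraph N) → IsTournament G → IsPseudorandomLog εn (suc E₀) σn σd G →
    ∀ {n m} {S : Digraph n} {T : Digraph m} → IsDirectedTree S → IsDirectedTree T → leaves T ≤ k →
    ca M * n ≤ 1 * N → ca M * m ≤ 1 * N → N ^ (ca M * ca M * n * m) ≤ 2 ^ (1 * 1 * N * N) → Arrows G S T
  go M M≡ N G tour pr {n} {m} tS tT few n≤ m≤ nm≤ col = by-log (log-floor N (≤-trans (s≤s z≤n) ca≤N))
    where
    open ≤-Reasoning
    n≤N : ca M * n ≤ N
    n≤N = ≤-trans n≤ (≤-reflexive (+-identityʳ N))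
    m≤N : ca M * m ≤ N
    m≤N = ≤-trans m≤ (≤-reflexive (+-identityʳ N))
    ca≤N : ca M ≤ N
    ca≤N = ≤-trans (m≤m*n (ca M) n {{>-nonZero (directed-tree-nonempty tS)}}) n≤N
    32EM≤ : 2 * M * (16 * suc E₀) ≤ ca M
    32EM≤ = ≤-trans (m≤m+n _ (8 * M * M * c)) (≤-trans (m≤n+m _ (2 ^ C M)) (n≤1+n _))
    8MMc≤ : 8 * M * M * c ≤ ca M * ca M
    8MMc≤ = ≤-trans (≤-trans (m≤n+m _ (2 * M * (16 * suc E₀))) (≤-trans (m≤n+m _ (2 ^ C M)) (n≤1+n _))) (m≤m*n (ca M) (ca M))
    by-log : Σ[ l ∈ ℕ ] 2 ^ l ≤ N × N < 2 ^ suc l → MonoCopy G col true _ ⊎ MonoCopy G col false _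
    by-log (l , lo , hi) = copies εn E₀ σn σd k N εn>0 σn>0 σd>0 G tour pr col tS tT k>0 few M M≡ l lo hi l>0 large
      (≤-trans (≤-reflexive (sym (*-assoc (2 * M) (16 * suc E₀) n))) (≤-trans (*-monoˡ-≤ n 32EM≤) n≤N))
      (≤-trans (*-monoˡ-≤ m (≤-trans (m≤m*n (2 * M) (16 * suc E₀)) 32EM≤)) m≤N)
      (≤-trans (*-monoˡ-≤ (l * (m * n)) 8MMc≤) (≤-trans (≤-reflexive (arith (ca M * ca M) l m n))
        (2^-cancel-≤ (begin
          2 ^ (l * (ca M * ca M * n * m)) ≡⟨ sym (^-*-assoc 2 l (ca M * ca M * n * m)) ⟩
          (2 ^ l) ^ (ca M * ca M * n * m) ≤⟨ ^-monoˡ-≤ (ca M * ca M * n * m) lo ⟩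
          N ^ (ca M * ca M * n * m) ≤⟨ nm≤ ⟩
          2 ^ (1 * 1 * N * N) ≡⟨ cong (λ z → 2 ^ (z * N)) (+-identityʳ N) ⟩
          2 ^ (N * N) ∎))))
      where
      arith : ∀ x l m n → x * (l * (m * n)) ≡ l * (x * n * m)
      arith = solve-∀
      large : C M ≤ l
      large = s≤s⁻¹ (2^-cancel-< (≤-<-trans (≤-trans (≤-trans (m≤m+n (2 ^ C M) _) (n≤1+n _)) ca≤N) hi))
        where
        2^-cancel-< : ∀ {x y} → 2 ^ x < 2 ^ y → x < y
        2^-cancel-< h = ≰⇒> λ y≤ → <⇒≱ h (^-monoʳ-≤ 2 y≤)
      M>0 : 0 < M
      M>0 = subst (0 <_) M≡ (*-mono-≤ (m^n>0 8 k) (s≤s (z≤n {24575})))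
      c>0 : 0 < c
      c>0 = *-mono-≤ {1} {26 * suc E₀} (s≤s z≤n) σn>0
      l>0 : 0 < l
      l>0 = ≤-trans (*-mono-≤ {1} {27} (s≤s z≤n) (*-mono-≤ M>0 (*-mono-≤ c>0 c>0))) large
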